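{- The operator $\Xi$ satisfies $\Phi^+\Xi=\Xi\Phi$ and $\sigma_i^+\Xi=\Xi s_i$ for all $1\le i\le n-1$.
   Context: Fix $n\ge1$; $r$ is an indeterminate, $\alpha=1/r$, $\mathbb{F}=\mathbb{Q}(r)$, polynomials lie in $\mathbb{F}[x_1,\dots,x_n]$. Compositions are $\eta\in\mathbb{N}^n$, $|\eta|=\sum\eta_i$, $x^\eta=\prod x_i^{\eta_i}$; partitions are weakly decreasing compositions; $\delta=(n-1,\dots,0)$; permutations act on vectors by $(wv)_{w(i)}=v_i$; $w_\gamma$ is the minimal-length permutation with $w_\gamma^{ -1}(\gamma)$ a partition, $\overline\gamma=\gamma+w_\gamma(r\delta)$. $E_\eta^{r\delta}$ is the unique polynomial of degree $|\eta|$ vanishing at all $\overline\gamma$ with $\gamma\ne\eta$, $|\gamma|\le|\eta|$, with coefficient $1$ on $x^\eta$; $E_\eta^{(\alpha)}$ its top homogeneous component. With $a_\eta(i,j)=\eta_i-j$, $l_\eta(i,j)=\#\{k>i:j\le\eta_k\le\eta_i\}+\#\{k<i:j\le\eta_k+1\le\eta_i\}$, $d_\eta(\alpha)=\prod_{1\le j\le\eta_i}(\alpha(a_\eta(i,j)+1)+l_\eta(i,j)+1)$, set $F_\eta^{(\alpha)}=d_\eta E_\eta^{(\alpha)}$, $F_\eta^{r\delta}(x)=(-1)^{|\eta|}d_\eta E_\eta^{r\delta}(-x)$; $\Xi$ is the unique $\mathbb{F}$-linear operator with $\Xi(F_\eta^{(\alpha)})=F_\eta^{r\delta}$ for all $\eta$.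 Operators: $s_i$ swaps $x_i,x_{i+1}$; $\partial_if=(s_if-f)/(x_i-x_{i+1})$; $\sigma_i^+=s_i+r\partial_i$; $\Phi f(x)=x_nf(x_n,x_1,\dots,x_{n-1})$; $\Phi^+f(x)=x_nf(x_n+1,x_1,\dots,x_{n-1})$. -}

module Defs where

open import Data.Bool using (Bool; true; false; if_then_else_; _∧_)
open import Data.Nat as ℕ using (ℕ; zero; suc; _∸_; _<ᵇ_; _≤ᵇ_; _≡ᵇ_; _<_; _≤_)
open import Data.Fin using (Fin; zero; suc; toℕ; fromℕ; inject₁)
open import Data.Fin.Properties using () renaming (_≟_ to _≟Fin_)
open import Data.Rational as ℚ using (ℚ; 0ℚ; 1ℚ)
import Data.Integer as ℤ
open import Data.List as L using (List; []; _∷_; _++_; _∷ʳ_; allFin)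
open import Data.Vec as V using (Vec; lookup; _[_]≔_)
open import Data.Vec.Properties using (≡-dec)
open import Data.Product using (_×_; _,_; proj₁; proj₂)
open import Relation.Nullary using (does; ¬_)
open import Relation.Binary.PropositionalEquality using (_≡_)

-- ℚ[r]: univariate polynomials in the indeterminate r over ℚ,
-- as coefficient lists (index k = coefficient of r^k).

RPoly : Set
RPoly = List ℚ

addR : RPoly → RPoly → RPoly
addR []      q       = q
addR (a ∷ p) []      = a ∷ p
addR (a ∷ p) (b ∷ q) = (a ℚ.+ b) ∷ addR p q

scaleR : ℚ → RPoly → RPoly
scaleR c = L.map (c ℚ.*_)

mulR : RPoly → RPoly → RPoly
mulR []      q = []
mulR (a ∷ p) q = addR (scaleR a q) (0ℚ ∷ mulR p q)

coeffR : RPoly → ℕ → ℚ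
coeffR []      _       = 0ℚ
coeffR (a ∷ p) zero    = a
coeffR (a ∷ p) (suc k) = coeffR p k

_≈R_ : RPoly → RPoly → Set
p ≈R q = ∀ k → coeffR p k ≡ coeffR q k

monic : List ℚ → RPoly
monic cs = cs ∷ʳ 1ℚ

-- 𝔽 = ℚ(r): fractions num / den, the denominator being a product of
-- monic polynomials (hence nonzero; every element of ℚ(r) has this form).

record 𝔽 : Set where
  constructor _/_
  field
    num : RPoly
    den : List (List ℚ)
open 𝔽 public

denPoly : List (List ℚ) → RPoly
denPoly = L.foldr (λ cs acc → mulR (monic cs) acc) (1ℚ ∷ [])

_≈F_ : 𝔽 → 𝔽 → Set
x ≈F y = mulR (num x) (denPoly (den y)) ≈R mulR (num y) (denPoly (den x))

_+F_ : 𝔽 → 𝔽 → 𝔽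
x +F y = addR (mulR (num x) (denPoly (den y))) (mulR (num y) (denPoly (den x)))
         / (den x ++ den y)

_*F_ : 𝔽 → 𝔽 → 𝔽
x *F y = mulR (num x) (num y) / (den x ++ den y)

-F_ : 𝔽 → 𝔽
-F x = scaleR (ℚ.- 1ℚ) (num x) / den x

0F 1F : 𝔽
0F = [] / []
1F = (1ℚ ∷ []) / []

natF : ℕ → 𝔽
natF k = (((ℤ.+ k) ℚ./ 1) ∷ []) / []

-- the indeterminate r, and α = 1/r  (monic (0ℚ ∷ []) is the polynomial r)
rF αF : 𝔽
rF = (0ℚ ∷ 1ℚ ∷ []) / []
αF = (1ℚ ∷ []) / ((0ℚ ∷ []) ∷ [])

powF : 𝔽 → ℕ → 𝔽
powF x zero    = 1F
powF x (suc k) = x *F powF x k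

prodF : List 𝔽 → 𝔽
prodF = L.foldr _*F_ 1F

-- 𝔽[x_1,…,x_n]: finite sums of terms c·x^ν (ν ∈ ℕ^n), compared by
-- coefficients.  Variable x_{k+1} of the paper is the index k : Fin n.

Comp : ℕ → Set
Comp n = Vec ℕ n

∣_∣ : ∀ {n} → Comp n → ℕ
∣ η ∣ = V.sum η

Poly : ℕ → Set
Poly n = List (𝔽 × Comp n)

coeff : ∀ {n} → Poly n → Comp n → 𝔽
coeff {n} p μ = L.foldr (λ t acc → if does (≡-dec ℕ._≟_ (proj₂ t) μ)
                                     then proj₁ t +F acc else acc) 0F p

_≈P_ : ∀ {n} → Poly n → Poly n → Set
p ≈P q = ∀ μ → coeff p μ ≈F coeff q μ

_+P_ : ∀ {n} → Poly n → Poly n → Poly n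
_+P_ = _++_

scaleP : ∀ {n} → 𝔽 → Poly n → Poly n
scaleP c = L.map (λ t → (c *F proj₁ t , proj₂ t))

mulP : ∀ {n} → Poly n → Poly n → Poly n
mulP p q = L.concatMap
  (λ s → L.map (λ t → (proj₁ s *F proj₁ t , V.zipWith ℕ._+_ (proj₂ s) (proj₂ t))) q) p

constP : ∀ {n} → 𝔽 → Poly n
constP c = (c , V.replicate _ 0) ∷ []

oneP : ∀ {n} → Poly n
oneP = constP 1F

var : ∀ {n} → Fin n → Poly n
var {n} i = (1F , (V.replicate n 0 [ i ]≔ 1)) ∷ []

powP : ∀ {n} → Poly n → ℕ → Poly n
powP p zero    = oneP
powP p (suc k) = mulP p (powP p k)

subst : ∀ {n} → (Fin n → Poly n) → Poly n → Poly n
subst {n} σ p = L.foldr (λ t acc → scaleP (proj₁ t) (mono (proj₂ t)) +P acc) [] p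
  where
  mono : Comp n → Poly n
  mono ν = L.foldr (λ j acc → mulP (powP (σ j) (lookup ν j)) acc) oneP (allFin n)

eval : ∀ {n} → (Fin n → 𝔽) → Poly n → 𝔽
eval {n} pt p = L.foldr (λ t acc → (proj₁ t *F mono (proj₂ t)) +F acc) 0F p
  where
  mono : Comp n → 𝔽
  mono ν = prodF (L.map (λ j → powF (pt j) (lookup ν j)) (allFin n))

top : ∀ {n} → ℕ → Poly n → Poly n
top d = L.filterᵇ (λ t → ∣ proj₂ t ∣ ≡ᵇ d)

count : ∀ {n} → (Fin n → Bool) → ℕ
count {n} P = L.length (L.filterᵇ P (allFin n))

-- rankγ γ j = w_γ⁻¹(j) - 1 (0-based): position of j when γ is sorted
-- into a partition, ties broken by index (this is the minimal-length w_γ).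
rankγ : ∀ {n} → Comp n → Fin n → ℕ
rankγ γ j = count (λ k → lookup γ j <ᵇ lookup γ k)
          ℕ.+ count (λ k → (toℕ k <ᵇ toℕ j) ∧ (lookup γ k ≡ᵇ lookup γ j))

-- γ̄ = γ + w_γ(rδ):  γ̄_j = γ_j + r·δ_{w_γ⁻¹(j)},  δ_i = n - i (1-based i)
bar : ∀ {n} → Comp n → Fin n → 𝔽
bar {n} γ j = natF (lookup γ j) +F (rF *F natF (n ∸ 1 ∸ rankγ γ j))

-- arm and leg of the cell (i,j), 1 ≤ j ≤ η_i
arm : ∀ {n} → Comp n → Fin n → ℕ → ℕ
arm η i j = lookup η i ∸ j

leg : ∀ {n} → Comp n → Fin n → ℕ → ℕ
leg η i j =
  count (λ k → (toℕ i <ᵇ toℕ k) ∧ (j ≤ᵇ lookup η k) ∧ (lookup η k ≤ᵇ lookup η i))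
  ℕ.+ count (λ k → (toℕ k <ᵇ toℕ i) ∧ (j ≤ᵇ suc (lookup η k)) ∧ (suc (lookup η k) ≤ᵇ lookup η i))

dη : ∀ {n} → Comp n → 𝔽
dη {n} η = prodF (L.concatMap
  (λ i → L.map (λ j → (αF *F natF (suc (arm η i j))) +F natF (suc (leg η i j)))
               (L.applyUpTo suc (lookup η i)))
  (allFin n))

IsInterp : ∀ {n} → Comp n → Poly n → Set
IsInterp {n} η E =
    (∀ μ → ∣ η ∣ < ∣ μ ∣ → coeff E μ ≈F 0F)
  × (coeff E η ≈F 1F)
  × (∀ (γ : Comp n) → ∣ γ ∣ ≤ ∣ η ∣ → ¬ (γ ≡ η) → eval (bar γ) E ≈F 0F)

Eα : ∀ {n} → (Comp n → Poly n) → Comp n → Poly n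
Eα E η = top ∣ η ∣ (E η)

Fα : ∀ {n} → (Comp n → Poly n) → Comp n → Poly n
Fα E η = scaleP (dη η) (Eα E η)

negVars : ∀ {n} → Fin n → Poly n
negVars j = scaleP (-F 1F) (var j)

Frδ : ∀ {n} → (Comp n → Poly n) → Comp n → Poly n
Frδ E η = scaleP (powF (-F 1F) ∣ η ∣ *F dη η) (subst negVars (E η))

IsLinear : ∀ {n} → (Poly n → Poly n) → Set
IsLinear Ξ = (∀ f g → f ≈P g → Ξ f ≈P Ξ g)
           × (∀ f g → Ξ (f +P g) ≈P (Ξ f +P Ξ g))
           × (∀ c f → Ξ (scaleP c f) ≈P scaleP c (Ξ f))

-- Operators, for n = suc m.  For i : Fin m, the paper's index is
-- toℕ i + 1, so x_i is inject₁ i and x_{i+1} is suc i.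

module _ {m : ℕ} where
  private
    n = suc m

  swapImg : Fin m → Fin n → Poly n
  swapImg i k with k ≟Fin inject₁ i | k ≟Fin suc i
  ... | Relation.Nullary.yes _ | _ = var (suc i)
  ... | Relation.Nullary.no _  | Relation.Nullary.yes _ = var (inject₁ i)
  ... | Relation.Nullary.no _  | Relation.Nullary.no _  = var k

  s : Fin m → Poly n → Poly n
  s i = subst (swapImg i)

  -- divided difference ∂_i f = (s_i f - f)/(x_i - x_{i+1}), on each term:
  -- with a = ν_i, b = ν_{i+1}:
  --   a > b : -Σ_{k<a-b} x_i^{b+k} x_{i+1}^{a-1-k}
  --   a < b : +Σ_{k<b-a} x_i^{a+k} x_{i+1}^{b-1-k}
  --   a = b : 0
  ∂ : Fin m → Poly n → Poly n
  ∂ i = L.concatMap term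
    where
    term : 𝔽 × Comp n → Poly n
    term (c , ν) with lookup ν (inject₁ i) | lookup ν (suc i)
    ... | a | b =
      if b <ᵇ a
      then L.applyUpTo (λ k → (-F c , ((ν [ inject₁ i ]≔ (b ℕ.+ k)) [ suc i ]≔ (a ∸ 1 ∸ k)))) (a ∸ b)
      else L.applyUpTo (λ k → (c , ((ν [ inject₁ i ]≔ (a ℕ.+ k)) [ suc i ]≔ (b ∸ 1 ∸ k)))) (b ∸ a)

  σ⁺ : Fin m → Poly n → Poly n
  σ⁺ i f = s i f +P scaleP rF (∂ i f)

  ΦImg : Fin n → Poly n
  ΦImg zero    = var (fromℕ m)
  ΦImg (suc k) = var (inject₁ k)

  Φ⁺Img : Fin n → Poly n
  Φ⁺Img zero    = var (fromℕ m) +P oneP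
  Φ⁺Img (suc k) = var (inject₁ k)

  Φ : Poly n → Poly n
  Φ f = mulP (var (fromℕ m)) (subst ΦImg f)

  Φ⁺ : Poly n → Poly n
  Φ⁺ f = mulP (var (fromℕ m)) (subst Φ⁺Img f)

module Submission where

-- The polynomials of degree ≤ d that vanish at all points -γ̄ with |γ| < d are determined by their
-- homogeneous part of degree d, because a polynomial of degree ≤ d vanishing at all -γ̄ with |γ| ≤ d
-- is zero. By expansion in the reflected interpolation polynomials, Ξ sends a homogeneous polynomial
-- of degree d to the polynomial of this class with that top component; the normalisation d_η cancels.
-- The sorting statistics of γ show that Φ⁺ and σᵢ⁺ preserve these classes, raising d by one and by
-- zero, and on top components they act as Φ and sᵢ. Finally, every monomial is obtained from 1 by Φ
-- and the sᵢ, so each monomial is the top component of some polynomial of the class.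

open import Defs
open import Algebra.Bundles using (CommutativeRing; RawRing)
open import Algebra.Structures using (IsCommutativeRing)
open import Data.Bool using (Bool; true; false; T; not; if_then_else_; _∧_; _∨_)
import Data.Bool.Properties as Bool
open import Data.Empty using (⊥-elim)
open import Data.Fin as F using (Fin; zero; suc; toℕ; fromℕ; inject₁)
open import Data.Fin.Induction using (>-weakInduction)
import Data.Fin.Properties as F
open import Data.Fin.Relation.Unary.Top using (view; ‵fromℕ; ‵inject₁)
open import Data.Integer as ℤ using (ℤ)
import Data.Integer.Properties as ℤ
open import Data.List as L using (List; []; _∷_; _++_; length; allFin)
open import Data.List.Membership.Propositional using (_∈_; _∉_)
open import Data.List.Membership.Propositional.Properties using (∈-cartesianProductWith⁺; ∈-upTo⁺)
open import Data.List.Relation.Unary.All as All using (All; []; _∷_)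
import Data.List.Relation.Unary.All.Properties as All
open import Data.List.Relation.Unary.Any using (here; there)
open import Data.Maybe using (Maybe; just; nothing)
open import Data.Nat as ℕ using (ℕ; zero; suc; z≤n; s≤s)
import Data.Nat.Properties as ℕ
open import Data.Rational as ℚ using (ℚ; 0ℚ; 1ℚ)
import Data.Rational.Properties as ℚ
import Data.Rational.Unnormalised as ℚᵘ
import Data.Rational.Unnormalised.Properties as ℚᵘ
import Data.Sign as Sign
open import Data.Sum using (_⊎_; inj₁; inj₂)
open import Data.Vec as V using (Vec; []; _∷_; _∷ʳ_; lookup; tabulate; head; tail; _[_]≔_)
import Data.Vec.Properties as V
open import Function using (_∘_)
open import Level using (0ℓ)
open import Relation.Binary.Definitions using (tri<; tri≈; tri>)
open import Relation.Binary.PropositionalEquality as ≡ using (_≡_; _≢_; cong; cong₂; subst₂; module ≡-Reasoning)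
open import Relation.Nullary using (¬_; Dec; yes; no; does)

-- Commutative rings and ℚ[r]

-- Why the classes are preserved: at the reflected points -γ̄ the substitution of Φ⁺ undoes the
-- rotation (γ₁,...,γₙ) ↦ (γ₂,...,γₙ,γ₁+1), since this rotation permutes the entries of δ along with
-- those of γ. A composition that is not a rotation ends in 0; its last coordinate is then 0, and
-- the factor xₙ kills the value. For σᵢ⁺, the swap carries points to points unless γᵢ = γᵢ₊₁. In a
-- tie the two coordinates differ by exactly -r, so sᵢg + r∂ᵢg takes the same value as g. This is
-- where the constants 1 in Φ⁺ and r in σᵢ⁺ come from. The obstacle is that polynomials and
-- fractions are unreduced lists: equal objects have many representations, terms may cancel only in
-- total, and ∂ᵢ is defined term by term. Hence nearly everything is done with values: degree bounds
-- are derivations attached to functions, equality is equality at all points, and coefficients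
-- reappear only where homogeneity or the final statement calls for them.

module IntegerCoefficients (R : CommutativeRing 0ℓ 0ℓ) where
  open import Data.Integer using (+_; -[1+_])
  open CommutativeRing R
  open import Algebra.Properties.Ring ring
  open import Algebra.Properties.AbelianGroup +-abelianGroup using (⁻¹-∙-comm)
  open import Algebra.Properties.Semiring.Mult.TCOptimised semiring
  open import Algebra.Solver.Ring.AlmostCommutativeRing
  open import Relation.Binary.Reasoning.Setoid setoid

  fromℤ : ℤ → Carrier
  fromℤ (+ n)    = n × 1#
  fromℤ -[1+ n ] = - (suc n × 1#)

  ⊖-homo : ∀ m n → fromℤ (m ℤ.⊖ n) ≈ m × 1# - n × 1#
  ⊖-homo m zero = sym (trans (+-congˡ -0#≈0#) (+-identityʳ _))
  ⊖-homo zero (suc n) = sym (+-identityˡ _)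
  ⊖-homo (suc m) (suc n) = begin
    fromℤ (suc m ℤ.⊖ suc n)          ≡⟨ ≡.cong fromℤ (ℤ.[1+m]⊖[1+n]≡m⊖n m n) ⟩
    fromℤ (m ℤ.⊖ n)                  ≈⟨ ⊖-homo m n ⟩
    m × 1# - n × 1#                  ≈⟨ +-congʳ (+-identityʳ _) ⟨
    (m × 1# + 0#) - n × 1#           ≈⟨ +-congʳ (+-congˡ (-‿inverseʳ 1#)) ⟨
    (m × 1# + (1# - 1#)) - n × 1#    ≈⟨ +-congʳ (+-assoc _ _ _) ⟨
    ((m × 1# + 1#) - 1#) - n × 1#    ≈⟨ +-assoc _ _ _ ⟩
    (m × 1# + 1#) + (- 1# - n × 1#)  ≈⟨ +-cong (+-comm _ _) (⁻¹-∙-comm _ _) ⟩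
    (1# + m × 1#) - (1# + n × 1#)    ≈⟨ +-cong (1+× m 1#) (-‿cong (1+× n 1#)) ⟨
    suc m × 1# - suc n × 1#          ∎

  neg-homo : ∀ i → fromℤ (ℤ.- i) ≈ - fromℤ i
  neg-homo (+ zero)  = sym -0#≈0#
  neg-homo (+ suc n) = refl
  neg-homo -[1+ n ]  = sym (-‿involutive _)

  +-homo : ∀ i j → fromℤ (i ℤ.+ j) ≈ fromℤ i + fromℤ j
  +-homo (+ m)    (+ n)    = ×-homo-+ 1# m n
  +-homo (+ m)    -[1+ n ] = ⊖-homo m (suc n)
  +-homo -[1+ m ] (+ n)    = trans (⊖-homo n (suc m)) (+-comm _ _)
  +-homo -[1+ m ] -[1+ n ] = begin
    - (suc (suc (m ℕ.+ n)) × 1#)     ≡⟨ ≡.cong (λ k → - (k × 1#)) (≡.sym (ℕ.+-suc (suc m) n)) ⟩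
    - ((suc m ℕ.+ suc n) × 1#)       ≈⟨ -‿cong (×-homo-+ 1# (suc m) (suc n)) ⟩
    - (suc m × 1# + suc n × 1#)      ≈⟨ ⁻¹-∙-comm _ _ ⟨
    - (suc m × 1#) - (suc n × 1#)    ∎

  *-homo : ∀ i j → fromℤ (i ℤ.* j) ≈ fromℤ i * fromℤ j
  *-homo (+ m) (+ n) = begin
    fromℤ (Sign.+ ℤ.◃ (m ℕ.* n))  ≡⟨ ≡.cong fromℤ (ℤ.+◃n≡+n (m ℕ.* n)) ⟩
    (m ℕ.* n) × 1#                ≈⟨ ×1-homo-* m n ⟩
    m × 1# * n × 1#               ∎
  *-homo (+ m) -[1+ n ] = begin
    fromℤ (Sign.- ℤ.◃ (m ℕ.* suc n))  ≡⟨ ≡.cong fromℤ (ℤ.-◃n≡-n (m ℕ.* suc n)) ⟩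
    fromℤ (ℤ.- (+ (m ℕ.* suc n)))     ≈⟨ neg-homo (+ (m ℕ.* suc n)) ⟩
    - ((m ℕ.* suc n) × 1#)            ≈⟨ -‿cong (×1-homo-* m (suc n)) ⟩
    - (m × 1# * suc n × 1#)           ≈⟨ -‿distribʳ-* _ _ ⟩
    m × 1# * - (suc n × 1#)           ∎
  *-homo -[1+ m ] (+ n) = begin
    fromℤ (Sign.- ℤ.◃ (suc m ℕ.* n))  ≡⟨ ≡.cong fromℤ (ℤ.-◃n≡-n (suc m ℕ.* n)) ⟩
    fromℤ (ℤ.- (+ (suc m ℕ.* n)))     ≈⟨ neg-homo (+ (suc m ℕ.* n)) ⟩
    - ((suc m ℕ.* n) × 1#)            ≈⟨ -‿cong (×1-homo-* (suc m) n) ⟩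
    - (suc m × 1# * n × 1#)           ≈⟨ -‿distribˡ-* _ _ ⟩
    - (suc m × 1#) * n × 1#           ∎
  *-homo -[1+ m ] -[1+ n ] = begin
    (suc m ℕ.* suc n) × 1#            ≈⟨ ×1-homo-* (suc m) (suc n) ⟩
    suc m × 1# * suc n × 1#           ≈⟨ -‿involutive _ ⟨
    - - (suc m × 1# * suc n × 1#)     ≈⟨ -‿cong (-‿distribʳ-* _ _) ⟩
    - (suc m × 1# * - (suc n × 1#))   ≈⟨ -‿distribˡ-* _ _ ⟩
    - (suc m × 1#) * - (suc n × 1#)   ∎

  ℤ-rawRing : RawRing 0ℓ 0ℓ
  ℤ-rawRing = record { Carrier = ℤ ; _≈_ = _≡_ ; _+_ = ℤ._+_ ; _*_ = ℤ._*_ ; -_ = ℤ.-_ ; 0# = ℤ.0ℤ ; 1# = ℤ.1ℤ }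

  morphism : ℤ-rawRing -Raw-AlmostCommutative⟶ fromCommutativeRing R
  morphism = record
    { ⟦_⟧ = fromℤ ; +-homo = +-homo ; *-homo = *-homo ; -‿homo = neg-homo ; 0-homo = refl ; 1-homo = refl }

  -- A partial test is enough for the solver. Integer coefficients let it cancel terms over rings
  -- whose own equality is not decided.
  coefficient≟ : ∀ i j → Maybe (fromℤ i ≈ fromℤ j)
  coefficient≟ i j with i ℤ.≟ j
  ... | yes ≡.refl = just refl
  ... | no _       = nothing

  open import Algebra.Solver.Ring ℤ-rawRing (fromCommutativeRing R) morphism coefficient≟ public
    using (solve; _:=_; _:+_; _:*_; :-_; _:-_; con)

open import Data.Product using (_×_; _,_; proj₁; proj₂; ∃-syntax)
open ≡ using (refl; sym; trans)

module RationalPolynomials where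
  open import Data.Integer using (+_)
  open IntegerCoefficients ℚ.+-*-commutativeRing using (solve; _:=_; _:+_; _:*_; :-_; con)

  -- `_≈R_` unfolds to a function type from which the two polynomials cannot be inferred; the record
  -- keeps them visible to unification. `_≋_` wraps `_≈F_` for the same reason.
  record _≈ₚ_ (p q : RPoly) : Set where
    constructor ⟨_⟩
    field coefficients : p ≈R q
  open _≈ₚ_ public

  infix 4 _≈ₚ_

  coeff-addR : ∀ p q k → coeffR (addR p q) k ≡ coeffR p k ℚ.+ coeffR q k
  coeff-addR []      q       k       = sym (ℚ.+-identityˡ _)
  coeff-addR (a ∷ p) []      k       = sym (ℚ.+-identityʳ _)
  coeff-addR (a ∷ p) (b ∷ q) zero    = refl
  coeff-addR (a ∷ p) (b ∷ q) (suc k) = coeff-addR p q k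

  coeff-scaleR : ∀ c p k → coeffR (scaleR c p) k ≡ c ℚ.* coeffR p k
  coeff-scaleR c []      k       = sym (ℚ.*-zeroʳ c)
  coeff-scaleR c (a ∷ p) zero    = refl
  coeff-scaleR c (a ∷ p) (suc k) = coeff-scaleR c p k

  coeff-mulR-zero : ∀ a p q → coeffR (mulR (a ∷ p) q) 0 ≡ a ℚ.* coeffR q 0
  coeff-mulR-zero a p q = trans (coeff-addR (scaleR a q) _ 0) (trans (ℚ.+-identityʳ _) (coeff-scaleR a q 0))

  coeff-mulR-suc : ∀ a p q k →
    coeffR (mulR (a ∷ p) q) (suc k) ≡ a ℚ.* coeffR q (suc k) ℚ.+ coeffR (mulR p q) k
  coeff-mulR-suc a p q k = trans (coeff-addR (scaleR a q) _ (suc k)) (cong (ℚ._+ _) (coeff-scaleR a q (suc k)))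

  mulR-congˡ : ∀ p {q q′} → q ≈R q′ → mulR p q ≈R mulR p q′
  mulR-congˡ [] e k = refl
  mulR-congˡ (a ∷ p) {q} {q′} e zero =
    trans (coeff-mulR-zero a p q) (trans (cong (a ℚ.*_) (e 0)) (sym (coeff-mulR-zero a p q′)))
  mulR-congˡ (a ∷ p) {q} {q′} e (suc k) = trans (coeff-mulR-suc a p q k)
    (trans (cong₂ ℚ._+_ (cong (a ℚ.*_) (e (suc k))) (mulR-congˡ p e k)) (sym (coeff-mulR-suc a p q′ k)))

  mulR-zeroʳ : ∀ p → mulR p [] ≈R []
  mulR-zeroʳ []      k       = refl
  mulR-zeroʳ (a ∷ p) zero    = refl
  mulR-zeroʳ (a ∷ p) (suc k) = mulR-zeroʳ p k

  -- `mulR` recurses on its left factor; this is the mirrored recursion, which turns commutativity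
  -- into an induction.
  mulR-∷ʳ : ∀ p b q → mulR p (b ∷ q) ≈R addR (scaleR b p) (0ℚ ∷ mulR p q)
  mulR-∷ʳ [] b q zero = refl
  mulR-∷ʳ [] b q (suc k) = refl
  mulR-∷ʳ (a ∷ p) b q zero = solve 2 (λ a b → a :* b :+ con (+ 0) := b :* a :+ con (+ 0)) refl a b
  mulR-∷ʳ (a ∷ p) b q (suc k) = begin
    coeffR (mulR (a ∷ p) (b ∷ q)) (suc k)
      ≡⟨ coeff-mulR-suc a p (b ∷ q) k ⟩
    a ℚ.* coeffR q k ℚ.+ coeffR (mulR p (b ∷ q)) k
      ≡⟨ cong (a ℚ.* coeffR q k ℚ.+_) (trans (mulR-∷ʳ p b q k)
           (trans (coeff-addR (scaleR b p) _ k) (cong (ℚ._+ _) (coeff-scaleR b p k)))) ⟩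
    a ℚ.* coeffR q k ℚ.+ (b ℚ.* coeffR p k ℚ.+ coeffR (0ℚ ∷ mulR p q) k)
      ≡⟨ solve 3 (λ u v w → u :+ (v :+ w) := v :+ (u :+ w)) refl (a ℚ.* coeffR q k) (b ℚ.* coeffR p k) _ ⟩
    b ℚ.* coeffR p k ℚ.+ (a ℚ.* coeffR q k ℚ.+ coeffR (0ℚ ∷ mulR p q) k)
      ≡⟨ cong₂ ℚ._+_ (sym (coeff-scaleR b p k))
           (trans (cong (ℚ._+ _) (sym (coeff-scaleR a q k))) (sym (coeff-addR (scaleR a q) _ k))) ⟩
    coeffR (scaleR b p) k ℚ.+ coeffR (mulR (a ∷ p) q) k
      ≡⟨ sym (coeff-addR (scaleR b p) _ k) ⟩
    coeffR (addR (scaleR b (a ∷ p)) (0ℚ ∷ mulR (a ∷ p) q)) (suc k) ∎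
    where open ≡-Reasoning

  addR-cong : ∀ {p p′ q q′} → p ≈ₚ p′ → q ≈ₚ q′ → addR p q ≈ₚ addR p′ q′
  addR-cong {p} {p′} {q} {q′} ⟨ e ⟩ ⟨ f ⟩ =
    ⟨ (λ k → trans (coeff-addR p q k) (trans (cong₂ ℚ._+_ (e k) (f k)) (sym (coeff-addR p′ q′ k)))) ⟩

  scaleR-cong : ∀ c {p q} → p ≈ₚ q → scaleR c p ≈ₚ scaleR c q
  scaleR-cong c {p} {q} ⟨ e ⟩ =
    ⟨ (λ k → trans (coeff-scaleR c p k) (trans (cong (c ℚ.*_) (e k)) (sym (coeff-scaleR c q k)))) ⟩

  ∷-cong : ∀ {a b p q} → a ≡ b → p ≈ₚ q → (a ∷ p) ≈ₚ (b ∷ q)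
  ∷-cong {a} {b} {p} {q} e ⟨ f ⟩ = ⟨ pointwise ⟩
    where
    pointwise : (a ∷ p) ≈R (b ∷ q)
    pointwise zero    = e
    pointwise (suc k) = f k

  ≈ₚ-refl : ∀ {p} → p ≈ₚ p
  ≈ₚ-refl = ⟨ (λ _ → refl) ⟩

  ≈ₚ-sym : ∀ {p q} → p ≈ₚ q → q ≈ₚ p
  ≈ₚ-sym ⟨ e ⟩ = ⟨ (λ k → sym (e k)) ⟩

  ≈ₚ-trans : ∀ {p q s} → p ≈ₚ q → q ≈ₚ s → p ≈ₚ s
  ≈ₚ-trans ⟨ e ⟩ ⟨ f ⟩ = ⟨ (λ k → trans (e k) (f k)) ⟩

  mulR-comm : ∀ p q → mulR p q ≈ₚ mulR q p
  mulR-comm [] q = ≈ₚ-sym ⟨ mulR-zeroʳ q ⟩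
  mulR-comm (a ∷ p) q =
    ≈ₚ-trans (addR-cong {scaleR a q} ≈ₚ-refl (∷-cong refl (mulR-comm p q))) (≈ₚ-sym ⟨ mulR-∷ʳ q a p ⟩)

  mulR-cong : ∀ {p p′ q q′} → p ≈ₚ p′ → q ≈ₚ q′ → mulR p q ≈ₚ mulR p′ q′
  mulR-cong {p} {p′} {q} {q′} e ⟨ f ⟩ = ≈ₚ-trans ⟨ mulR-congˡ p f ⟩
    (≈ₚ-trans (mulR-comm p q′) (≈ₚ-trans ⟨ mulR-congˡ q′ (coefficients e) ⟩ (mulR-comm q′ p′)))

  mulR-distribˡ : ∀ p q s → mulR p (addR q s) ≈R addR (mulR p q) (mulR p s)
  mulR-distribˡ [] q s k = refl
  mulR-distribˡ (a ∷ p) q s zero = begin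
    coeffR (mulR (a ∷ p) (addR q s)) 0                     ≡⟨ coeff-mulR-zero a p (addR q s) ⟩
    a ℚ.* coeffR (addR q s) 0                              ≡⟨ cong (a ℚ.*_) (coeff-addR q s 0) ⟩
    a ℚ.* (coeffR q 0 ℚ.+ coeffR s 0)                      ≡⟨ ℚ.*-distribˡ-+ a _ _ ⟩
    a ℚ.* coeffR q 0 ℚ.+ a ℚ.* coeffR s 0                  ≡⟨ cong₂ ℚ._+_ (sym (coeff-mulR-zero a p q)) (sym (coeff-mulR-zero a p s)) ⟩
    coeffR (mulR (a ∷ p) q) 0 ℚ.+ coeffR (mulR (a ∷ p) s) 0 ≡⟨ sym (coeff-addR (mulR (a ∷ p) q) _ 0) ⟩
    coeffR (addR (mulR (a ∷ p) q) (mulR (a ∷ p) s)) 0      ∎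
    where open ≡-Reasoning
  mulR-distribˡ (a ∷ p) q s (suc k) = begin
    coeffR (mulR (a ∷ p) (addR q s)) (suc k)
      ≡⟨ coeff-mulR-suc a p (addR q s) k ⟩
    a ℚ.* coeffR (addR q s) (suc k) ℚ.+ coeffR (mulR p (addR q s)) k
      ≡⟨ cong₂ (λ x y → a ℚ.* x ℚ.+ y) (coeff-addR q s (suc k))
           (trans (mulR-distribˡ p q s k) (coeff-addR (mulR p q) _ k)) ⟩
    a ℚ.* (coeffR q (suc k) ℚ.+ coeffR s (suc k)) ℚ.+ (coeffR (mulR p q) k ℚ.+ coeffR (mulR p s) k)
      ≡⟨ solve 5 (λ a x y u v → a :* (x :+ y) :+ (u :+ v) := (a :* x :+ u) :+ (a :* y :+ v)) refl
           a (coeffR q (suc k)) (coeffR s (suc k)) _ _ ⟩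
    (a ℚ.* coeffR q (suc k) ℚ.+ coeffR (mulR p q) k) ℚ.+ (a ℚ.* coeffR s (suc k) ℚ.+ coeffR (mulR p s) k)
      ≡⟨ cong₂ ℚ._+_ (sym (coeff-mulR-suc a p q k)) (sym (coeff-mulR-suc a p s k)) ⟩
    coeffR (mulR (a ∷ p) q) (suc k) ℚ.+ coeffR (mulR (a ∷ p) s) (suc k)
      ≡⟨ sym (coeff-addR (mulR (a ∷ p) q) _ (suc k)) ⟩
    coeffR (addR (mulR (a ∷ p) q) (mulR (a ∷ p) s)) (suc k) ∎
    where open ≡-Reasoning

  mulR-distribʳ : ∀ s p q → mulR (addR p q) s ≈ₚ addR (mulR p s) (mulR q s)
  mulR-distribʳ s p q = ≈ₚ-trans (mulR-comm (addR p q) s)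
    (≈ₚ-trans ⟨ mulR-distribˡ s p q ⟩ (addR-cong (mulR-comm s p) (mulR-comm s q)))

  mulR-scaleRˡ : ∀ c p q → mulR (scaleR c p) q ≈R scaleR c (mulR p q)
  mulR-scaleRˡ c [] q k = refl
  mulR-scaleRˡ c (a ∷ p) q zero = begin
    coeffR (mulR (c ℚ.* a ∷ scaleR c p) q) 0 ≡⟨ coeff-mulR-zero (c ℚ.* a) (scaleR c p) q ⟩
    c ℚ.* a ℚ.* coeffR q 0                   ≡⟨ ℚ.*-assoc c a _ ⟩
    c ℚ.* (a ℚ.* coeffR q 0)                 ≡⟨ cong (c ℚ.*_) (sym (coeff-mulR-zero a p q)) ⟩
    c ℚ.* coeffR (mulR (a ∷ p) q) 0          ≡⟨ sym (coeff-scaleR c (mulR (a ∷ p) q) 0) ⟩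
    coeffR (scaleR c (mulR (a ∷ p) q)) 0     ∎
    where open ≡-Reasoning
  mulR-scaleRˡ c (a ∷ p) q (suc k) = begin
    coeffR (mulR (c ℚ.* a ∷ scaleR c p) q) (suc k)
      ≡⟨ coeff-mulR-suc (c ℚ.* a) (scaleR c p) q k ⟩
    c ℚ.* a ℚ.* coeffR q (suc k) ℚ.+ coeffR (mulR (scaleR c p) q) k
      ≡⟨ cong (c ℚ.* a ℚ.* coeffR q (suc k) ℚ.+_) (trans (mulR-scaleRˡ c p q k) (coeff-scaleR c (mulR p q) k)) ⟩
    c ℚ.* a ℚ.* coeffR q (suc k) ℚ.+ c ℚ.* coeffR (mulR p q) k
      ≡⟨ solve 4 (λ c a x y → c :* a :* x :+ c :* y := c :* (a :* x :+ y)) refl c a (coeffR q (suc k)) _ ⟩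
    c ℚ.* (a ℚ.* coeffR q (suc k) ℚ.+ coeffR (mulR p q) k)
      ≡⟨ cong (c ℚ.*_) (sym (coeff-mulR-suc a p q k)) ⟩
    c ℚ.* coeffR (mulR (a ∷ p) q) (suc k)
      ≡⟨ sym (coeff-scaleR c (mulR (a ∷ p) q) (suc k)) ⟩
    coeffR (scaleR c (mulR (a ∷ p) q)) (suc k) ∎
    where open ≡-Reasoning

  mulR-0∷ : ∀ p q → mulR (0ℚ ∷ p) q ≈ₚ (0ℚ ∷ mulR p q)
  mulR-0∷ p q = ⟨ (λ k → trans (coeff-addR (scaleR 0ℚ q) _ k)
    (trans (cong (ℚ._+ coeffR (0ℚ ∷ mulR p q) k) (trans (coeff-scaleR 0ℚ q k) (ℚ.*-zeroˡ (coeffR q k))))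
           (ℚ.+-identityˡ _))) ⟩

  mulR-assoc : ∀ p q s → mulR (mulR p q) s ≈ₚ mulR p (mulR q s)
  mulR-assoc [] q s = ≈ₚ-refl
  mulR-assoc (a ∷ p) q s = ≈ₚ-trans (mulR-distribʳ s (scaleR a q) (0ℚ ∷ mulR p q))
    (addR-cong {mulR (scaleR a q) s} ⟨ mulR-scaleRˡ a q s ⟩ (≈ₚ-trans (mulR-0∷ (mulR p q) s) (∷-cong refl (mulR-assoc p q s))))

  mulR-identityˡ : ∀ p → mulR (1ℚ ∷ []) p ≈R p
  mulR-identityˡ p k = trans (coeff-addR (scaleR 1ℚ p) _ k)
    (trans (cong₂ ℚ._+_ (trans (coeff-scaleR 1ℚ p k) (ℚ.*-identityˡ (coeffR p k))) (zeros k)) (ℚ.+-identityʳ _))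
    where
    zeros : (0ℚ ∷ []) ≈R []
    zeros zero    = refl
    zeros (suc k) = refl

  addR-inverseʳ : ∀ p → addR p (scaleR (ℚ.- 1ℚ) p) ≈R []
  addR-inverseʳ p k = trans (coeff-addR p _ k) (trans (cong (coeffR p k ℚ.+_) (coeff-scaleR (ℚ.- 1ℚ) p k))
    (solve 1 (λ x → x :+ :- con (+ 1) :* x := con (+ 0)) refl (coeffR p k)))

  addR-assoc : ∀ p q s → addR (addR p q) s ≈R addR p (addR q s)
  addR-assoc p q s k = trans (coeff-addR (addR p q) s k) (trans (cong (ℚ._+ coeffR s k) (coeff-addR p q k))
    (trans (ℚ.+-assoc (coeffR p k) _ _) (sym (trans (coeff-addR p _ k) (cong (coeffR p k ℚ.+_) (coeff-addR q s k))))))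

  addR-comm : ∀ p q → addR p q ≈R addR q p
  addR-comm p q k = trans (coeff-addR p q k) (trans (ℚ.+-comm (coeffR p k) _) (sym (coeff-addR q p k)))

  addR-identityʳ : ∀ p → addR p [] ≈R p
  addR-identityʳ p k = trans (coeff-addR p [] k) (ℚ.+-identityʳ _)

  ℚ[r] : CommutativeRing 0ℓ 0ℓ
  ℚ[r] = record
    { Carrier = RPoly ; _≈_ = _≈ₚ_ ; _+_ = addR ; _*_ = mulR ; -_ = scaleR (ℚ.- 1ℚ) ; 0# = [] ; 1# = 1ℚ ∷ []
    ; isCommutativeRing = isCommutativeRing }
    where
    isCommutativeRing : IsCommutativeRing _≈ₚ_ addR mulR (scaleR (ℚ.- 1ℚ)) [] (1ℚ ∷ [])
    isCommutativeRing = record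
      { isRing = record
        { +-isAbelianGroup = record
          { isGroup = record
            { isMonoid = record
              { isSemigroup = record
                { isMagma = record
                  { isEquivalence = record
                    { refl = ≈ₚ-refl ; sym = ≈ₚ-sym ; trans = ≈ₚ-trans }
                  ; ∙-cong = addR-cong }
                ; assoc = λ p q s → ⟨ addR-assoc p q s ⟩ }
              ; identity = (λ p → ⟨ (λ _ → refl) ⟩) , (λ p → ⟨ addR-identityʳ p ⟩) }
            ; inverse = (λ p → ⟨ (λ k → trans (addR-comm (scaleR (ℚ.- 1ℚ) p) p k) (addR-inverseʳ p k)) ⟩) , (λ p → ⟨ addR-inverseʳ p ⟩)
            ; ⁻¹-cong = scaleR-cong (ℚ.- 1ℚ) }
          ; comm = λ p q → ⟨ addR-comm p q ⟩ }
        ; *-cong = mulR-cong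
        ; *-assoc = mulR-assoc
        ; *-identity = (λ p → ⟨ mulR-identityˡ p ⟩) ,
            (λ p → ≈ₚ-trans (mulR-comm p (1ℚ ∷ [])) ⟨ mulR-identityˡ p ⟩)
        ; distrib = (λ p q s → ⟨ mulR-distribˡ p q s ⟩) , mulR-distribʳ }
      ; *-comm = mulR-comm }

  module ℚ[r] = CommutativeRing ℚ[r]

  -- Lists may end in zeros, so their length is not the degree. The true leading coefficient is
  -- split off as a constant because denominators have to be monic.
  data Leading (p : RPoly) : Set where
    vanishes : p ≈ₚ [] → Leading p
    leads    : ∀ c cs → c ≢ 0ℚ → p ≈ₚ scaleR c (monic cs) → Leading p

  leading : ∀ p → Leading p
  leading [] = vanishes ⟨ (λ _ → refl) ⟩
  leading (a ∷ p) with leading p | a ℚ.≟ 0ℚ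
  ... | vanishes z | yes refl = vanishes ⟨ (λ { zero → refl ; (suc k) → coefficients z k }) ⟩
  ... | vanishes z | no a≢0 = leads a [] a≢0 (∷-cong (sym (ℚ.*-identityʳ a)) z)
  ... | leads c cs c≢0 e | _ = leads c (ℚ.1/ c ℚ.* a ∷ cs) c≢0 (∷-cong head-eq e)
    where
    instance c-nonZero : ℚ.NonZero c
             c-nonZero = ℚ.≢-nonZero c≢0
    head-eq : a ≡ c ℚ.* (ℚ.1/ c ℚ.* a)
    head-eq = sym (trans (sym (ℚ.*-assoc c (ℚ.1/ c) a)) (trans (cong (ℚ._* a) (ℚ.*-inverseʳ c)) (ℚ.*-identityˡ a)))

  coeff-monic : ∀ cs → coeffR (monic cs) (length cs) ≡ 1ℚ
  coeff-monic []       = refl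
  coeff-monic (_ ∷ cs) = coeff-monic cs

  scaleR-monic≉0 : ∀ c cs → c ≢ 0ℚ → ¬ (scaleR c (monic cs) ≈ₚ [])
  scaleR-monic≉0 c cs c≢0 e = c≢0 (begin
    c                                          ≡⟨ ℚ.*-identityʳ c ⟨
    c ℚ.* 1ℚ                                   ≡⟨ cong (c ℚ.*_) (coeff-monic cs) ⟨
    c ℚ.* coeffR (monic cs) (length cs)        ≡⟨ coeff-scaleR c (monic cs) (length cs) ⟨
    coeffR (scaleR c (monic cs)) (length cs)   ≡⟨ coefficients e (length cs) ⟩
    0ℚ                                         ∎)
    where open ≡-Reasoning

  -- The length bound keeps `p` away from the leading 1.
  addR-monic : ∀ p cs → length p ℕ.≤ length cs → ∃[ ds ] length ds ≡ length cs × addR p (monic cs) ≡ monic ds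
  addR-monic []      cs       _         = cs , refl , refl
  addR-monic (a ∷ p) (c ∷ cs) (s≤s p≤c) with addR-monic p cs p≤c
  ... | ds , l , e = a ℚ.+ c ∷ ds , cong suc l , cong (_ ∷_) e

  length-scaleR : ∀ c p → length (scaleR c p) ≡ length p
  length-scaleR c []      = refl
  length-scaleR c (a ∷ p) = cong suc (length-scaleR c p)

  length-monic : ∀ cs → length (monic cs) ≡ suc (length cs)
  length-monic []       = refl
  length-monic (c ∷ cs) = cong suc (length-monic cs)

  -- The length of `ds` is carried through the induction because it supplies the bound for
  -- `addR-monic`: the multiple of `monic bs` stays below the top of the shifted product.
  mulR-monic : ∀ as bs → ∃[ ds ] length ds ≡ length as ℕ.+ length bs × mulR (monic as) (monic bs) ≈ₚ monic ds
  mulR-monic [] bs = bs , refl , ℚ[r].*-identityˡ (monic bs)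
  mulR-monic (a ∷ as) bs with mulR-monic as bs
  ... | ds , l , e with addR-monic (scaleR a (monic bs)) (0ℚ ∷ ds)
        (ℕ.≤-trans (ℕ.≤-reflexive (trans (length-scaleR a (monic bs)) (length-monic bs)))
                   (s≤s (ℕ.≤-trans (ℕ.m≤n+m (length bs) (length as)) (ℕ.≤-reflexive (sym l)))))
  ...   | ds′ , l′ , e′ = ds′ , trans l′ (cong suc l) ,
          ℚ[r].trans (addR-cong {scaleR a (monic bs)} ≈ₚ-refl (∷-cong refl e)) (ℚ[r].reflexive e′)

  denPoly-monic : ∀ ds → ∃[ cs ] denPoly ds ≈ₚ monic cs
  denPoly-monic [] = [] , ℚ[r].refl
  denPoly-monic (d ∷ ds) with denPoly-monic ds
  ... | cs , e with mulR-monic d cs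
  ...   | es , _ , e′ = es , ℚ[r].trans (ℚ[r].*-congˡ {monic d} e) e′

  denPoly-++ : ∀ ds es → denPoly (ds ++ es) ≈ₚ mulR (denPoly ds) (denPoly es)
  denPoly-++ [] es = ℚ[r].sym (ℚ[r].*-identityˡ (denPoly es))
  denPoly-++ (d ∷ ds) es = ℚ[r].trans (ℚ[r].*-congˡ {monic d} (denPoly-++ ds es))
    (ℚ[r].sym (ℚ[r].*-assoc (monic d) (denPoly ds) (denPoly es)))

  -- A nonzero p is c times a monic polynomial, and multiplication by a monic denominator keeps the
  -- leading coefficient c. Transitivity of `_≋_` rests on this cancellation.
  mulR-denPoly≈0 : ∀ p ds → mulR p (denPoly ds) ≈ₚ [] → p ≈ₚ []
  mulR-denPoly≈0 p ds e with leading p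
  ... | vanishes z = z
  ... | leads c cs c≢0 l with denPoly-monic ds
  ...   | bs , d with mulR-monic cs bs
  ...     | es , _ , m = ⊥-elim (scaleR-monic≉0 c es c≢0 (begin
    scaleR c (monic es)                       ≈⟨ scaleR-cong c m ⟨
    scaleR c (mulR (monic cs) (monic bs))     ≈⟨ ⟨ mulR-scaleRˡ c (monic cs) (monic bs) ⟩ ⟨
    mulR (scaleR c (monic cs)) (monic bs)     ≈⟨ ℚ[r].*-cong l d ⟨
    mulR p (denPoly ds)                       ≈⟨ e ⟩
    []                                        ∎))
    where
    open import Relation.Binary.Reasoning.Setoid ℚ[r].setoid

open RationalPolynomials

-- The field ℚ(r)

module RationalFunctions where
  open import Data.Integer using (+_)

  record _≋_ (x y : 𝔽) : Set where
    constructor ⟪_⟫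
    field equal : x ≈F y
  open _≋_ public

  infix 4 _≋_

  -- The denominator of a sum or product is an appended list, whose product agrees with the product
  -- of the denominators only up to `_≈ₚ_`. Recording both polynomials up to `_≈ₚ_` reduces each
  -- field law, through `cross`, to a polynomial identity.
  record Value (x : 𝔽) (n d : RPoly) : Set where
    constructor value
    field
      num-value : num x ≈ₚ n
      den-value : denPoly (den x) ≈ₚ d
  open Value

  self : ∀ x → Value x (num x) (denPoly (den x))
  self x = value ≈ₚ-refl ≈ₚ-refl

  infixl 6 _⊕_
  infixl 7 _⊗_
  infix 8 ⊝_

  -- Opacity keeps the type checker from unfolding fraction arithmetic into lists in the long
  -- calculations that follow.
  opaque
    _⊕_ _⊗_ : 𝔽 → 𝔽 → 𝔽
    _⊕_ = _+F_
    _⊗_ = _*F_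

    ⊝_ : 𝔽 → 𝔽
    ⊝_ = -F_

  opaque
    unfolding _⊕_

    value-⊕ : ∀ {x y n d n′ d′} → Value x n d → Value y n′ d′ →
      Value (x ⊕ y) (addR (mulR n d′) (mulR n′ d)) (mulR d d′)
    value-⊕ {x} {y} (value n d) (value n′ d′) = value
      (addR-cong (mulR-cong n d′) (mulR-cong n′ d)) (≈ₚ-trans (denPoly-++ (den x) (den y)) (mulR-cong d d′))

    value-⊗ : ∀ {x y n d n′ d′} → Value x n d → Value y n′ d′ → Value (x ⊗ y) (mulR n n′) (mulR d d′)
    value-⊗ {x} {y} (value n d) (value n′ d′) = value
      (mulR-cong n n′) (≈ₚ-trans (denPoly-++ (den x) (den y)) (mulR-cong d d′))

    value-⊝ : ∀ {x n d} → Value x n d → Value (⊝ x) (scaleR (ℚ.- 1ℚ) n) d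
    value-⊝ (value n d) = value (scaleR-cong (ℚ.- 1ℚ) n) d

  value-0 : Value 0F [] (1ℚ ∷ [])
  value-0 = self 0F

  value-1 : Value 1F (1ℚ ∷ []) (1ℚ ∷ [])
  value-1 = self 1F

  cross : ∀ {x y n d n′ d′} → Value x n d → Value y n′ d′ → mulR n d′ ≈ₚ mulR n′ d → x ≋ y
  cross (value n d) (value n′ d′) e =
    ⟪ coefficients (≈ₚ-trans (mulR-cong n d′) (≈ₚ-trans e (≈ₚ-sym (mulR-cong n′ d)))) ⟫

  uncross : ∀ {x y n d n′ d′} → Value x n d → Value y n′ d′ → x ≋ y → mulR n d′ ≈ₚ mulR n′ d
  uncross (value n d) (value n′ d′) ⟪ e ⟫ =
    ≈ₚ-trans (≈ₚ-sym (mulR-cong n d′)) (≈ₚ-trans ⟨ e ⟩ (mulR-cong n′ d))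

  uncross-self : ∀ {x y} → x ≋ y → mulR (num x) (denPoly (den y)) ≈ₚ mulR (num y) (denPoly (den x))
  uncross-self {x} {y} = uncross (self x) (self y)

  -- An abstract ring is used so that no list arithmetic unfolds inside these identities.
  module FractionLaws (R : CommutativeRing 0ℓ 0ℓ) where
    open CommutativeRing R renaming (refl to ≈-refl; sym to ≈-sym; trans to ≈-trans)
    open IntegerCoefficients R
    open import Relation.Binary.Reasoning.Setoid setoid

    +-cong-law : ∀ a b a′ b′ c d c′ d′ → a * b′ ≈ a′ * b → c * d′ ≈ c′ * d →
      (a * d + c * b) * (b′ * d′) ≈ (a′ * d′ + c′ * b′) * (b * d)
    +-cong-law a b a′ b′ c d c′ d′ e f = begin
      (a * d + c * b) * (b′ * d′)
        ≈⟨ solve 6 (λ a b c d b′ d′ → (a :* d :+ c :* b) :* (b′ :* d′) := (a :* b′) :* (d :* d′) :+ (c :* d′) :* (b :* b′))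
             ≈-refl a b c d b′ d′ ⟩
      (a * b′) * (d * d′) + (c * d′) * (b * b′)
        ≈⟨ +-cong (*-congʳ e) (*-congʳ f) ⟩
      (a′ * b) * (d * d′) + (c′ * d) * (b * b′)
        ≈⟨ solve 6 (λ a b c d b′ d′ → (a :* b) :* (d :* d′) :+ (c :* d) :* (b :* b′) := (a :* d′ :+ c :* b′) :* (b :* d))
             ≈-refl a′ b c′ d b′ d′ ⟩
      (a′ * d′ + c′ * b′) * (b * d) ∎

    *-cong-law : ∀ a b a′ b′ c d c′ d′ → a * b′ ≈ a′ * b → c * d′ ≈ c′ * d →
      (a * c) * (b′ * d′) ≈ (a′ * c′) * (b * d)
    *-cong-law a b a′ b′ c d c′ d′ e f = begin
      (a * c) * (b′ * d′) ≈⟨ solve 4 (λ a c b d → (a :* c) :* (b :* d) := (a :* b) :* (c :* d)) ≈-refl a c b′ d′ ⟩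
      (a * b′) * (c * d′) ≈⟨ *-cong e f ⟩
      (a′ * b) * (c′ * d) ≈⟨ solve 4 (λ a c b d → (a :* b) :* (c :* d) := (a :* c) :* (b :* d)) ≈-refl a′ c′ b d ⟩
      (a′ * c′) * (b * d) ∎

    neg-cong-law : ∀ a b a′ b′ → a * b′ ≈ a′ * b → (- a) * b′ ≈ (- a′) * b
    neg-cong-law a b a′ b′ e = begin
      (- a) * b′   ≈⟨ solve 2 (λ a b → (:- a) :* b := :- (a :* b)) ≈-refl a b′ ⟩
      - (a * b′)   ≈⟨ -‿cong e ⟩
      - (a′ * b)   ≈⟨ solve 2 (λ a b → :- (a :* b) := (:- a) :* b) ≈-refl a′ b ⟩
      (- a′) * b   ∎

    -- Cross-multiplication gives the wanted equation only up to the middle denominator d, which has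
    -- to be cancelled afterwards.
    trans-law : ∀ a b c d e f → a * d ≈ c * b → c * f ≈ e * d → (a * f - e * b) * d ≈ 0#
    trans-law a b c d e f p q = begin
      (a * f - e * b) * d        ≈⟨ solve 5 (λ a f e b d → (a :* f :- e :* b) :* d := (a :* d) :* f :- (e :* d) :* b) ≈-refl a f e b d ⟩
      (a * d) * f - (e * d) * b  ≈⟨ +-cong (*-congʳ p) (-‿cong (*-congʳ (≈-sym q))) ⟩
      (c * b) * f - (c * f) * b  ≈⟨ solve 3 (λ c b f → (c :* b) :* f :- (c :* f) :* b := con (+ 0)) ≈-refl c b f ⟩
      0#                         ∎

    difference-zero : ∀ a b → a - b ≈ 0# → a ≈ b
    difference-zero a b e = begin
      a            ≈⟨ solve 2 (λ a b → a := (a :- b) :+ b) ≈-refl a b ⟩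
      (a - b) + b  ≈⟨ +-congʳ e ⟩
      0# + b       ≈⟨ +-identityˡ b ⟩
      b            ∎

  private module Laws = FractionLaws ℚ[r]

  ≋-trans : ∀ {x y z} → x ≋ y → y ≋ z → x ≋ z
  ≋-trans {x} {y} {z} e f = cross (self x) (self z)
    (Laws.difference-zero (mulR (num x) (denPoly (den z))) (mulR (num z) (denPoly (den x)))
      (mulR-denPoly≈0 _ (den y)
        (Laws.trans-law (num x) (denPoly (den x)) (num y) (denPoly (den y)) (num z) (denPoly (den z))
          (uncross-self e) (uncross-self f))))

  open IntegerCoefficients ℚ[r] using (solve; _:=_; _:+_; _:*_; :-_; con)

  𝔽-isCommutativeRing : IsCommutativeRing _≋_ _⊕_ _⊗_ ⊝_ 0F 1F
  𝔽-isCommutativeRing = record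
    { isRing = record
      { +-isAbelianGroup = record
        { isGroup = record
          { isMonoid = record
            { isSemigroup = record
              { isMagma = record
                { isEquivalence = record
                  { refl = ⟪ (λ _ → refl) ⟫ ; sym = λ e → ⟪ (λ k → sym (equal e k)) ⟫ ; trans = ≋-trans }
                ; ∙-cong = λ {x} {x′} {y} {y′} e f →
                    cross (value-⊕ (self x) (self y)) (value-⊕ (self x′) (self y′))
                      (Laws.+-cong-law (num x) _ (num x′) _ (num y) _ (num y′) _ (uncross-self e) (uncross-self f)) }
              ; assoc = λ x y z →
                  cross (value-⊕ (value-⊕ (self x) (self y)) (self z)) (value-⊕ (self x) (value-⊕ (self y) (self z)))
                    (solve 6 (λ a b c d e f → ((a :* d :+ c :* b) :* f :+ e :* (b :* d)) :* (b :* (d :* f))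
                        := (a :* (d :* f) :+ (c :* f :+ e :* d) :* b) :* ((b :* d) :* f)) ≈ₚ-refl
                      (num x) (denPoly (den x)) (num y) (denPoly (den y)) (num z) (denPoly (den z))) }
            ; identity = (λ x → cross (value-⊕ value-0 (self x)) (self x)
                  (solve 2 (λ a b → (con (+ 0) :* b :+ a :* con (+ 1)) :* b := a :* (con (+ 1) :* b)) ≈ₚ-refl (num x) (denPoly (den x)))) ,
                (λ x → cross (value-⊕ (self x) value-0) (self x)
                  (solve 2 (λ a b → (a :* con (+ 1) :+ con (+ 0) :* b) :* b := a :* (b :* con (+ 1))) ≈ₚ-refl (num x) (denPoly (den x)))) }
          ; inverse = (λ x → cross (value-⊕ (value-⊝ (self x)) (self x)) value-0
                  (solve 2 (λ a b → ((:- a) :* b :+ a :* b) :* con (+ 1) := con (+ 0) :* (b :* b)) ≈ₚ-refl (num x) (denPoly (den x)))) ,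
                (λ x → cross (value-⊕ (self x) (value-⊝ (self x))) value-0
                  (solve 2 (λ a b → (a :* b :+ (:- a) :* b) :* con (+ 1) := con (+ 0) :* (b :* b)) ≈ₚ-refl (num x) (denPoly (den x))))
          ; ⁻¹-cong = λ {x} {y} e → cross (value-⊝ (self x)) (value-⊝ (self y))
                  (Laws.neg-cong-law (num x) _ (num y) _ (uncross-self e)) }
        ; comm = λ x y → cross (value-⊕ (self x) (self y)) (value-⊕ (self y) (self x))
                  (solve 4 (λ a b c d → (a :* d :+ c :* b) :* (d :* b) := (c :* b :+ a :* d) :* (b :* d)) ≈ₚ-refl
                    (num x) (denPoly (den x)) (num y) (denPoly (den y))) }
      ; *-cong = λ {x} {x′} {y} {y′} e f →
          cross (value-⊗ (self x) (self y)) (value-⊗ (self x′) (self y′))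
            (Laws.*-cong-law (num x) _ (num x′) _ (num y) _ (num y′) _ (uncross-self e) (uncross-self f))
      ; *-assoc = λ x y z →
          cross (value-⊗ (value-⊗ (self x) (self y)) (self z)) (value-⊗ (self x) (value-⊗ (self y) (self z)))
            (solve 6 (λ a b c d e f → ((a :* c) :* e) :* (b :* (d :* f)) := (a :* (c :* e)) :* ((b :* d) :* f)) ≈ₚ-refl
              (num x) (denPoly (den x)) (num y) (denPoly (den y)) (num z) (denPoly (den z)))
      ; *-identity = (λ x → cross (value-⊗ value-1 (self x)) (self x)
            (solve 2 (λ a b → (con (+ 1) :* a) :* b := a :* (con (+ 1) :* b)) ≈ₚ-refl (num x) (denPoly (den x)))) ,
          (λ x → cross (value-⊗ (self x) value-1) (self x)
            (solve 2 (λ a b → (a :* con (+ 1)) :* b := a :* (b :* con (+ 1))) ≈ₚ-refl (num x) (denPoly (den x))))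
      ; distrib = (λ x y z →
          cross (value-⊗ (self x) (value-⊕ (self y) (self z))) (value-⊕ (value-⊗ (self x) (self y)) (value-⊗ (self x) (self z)))
            (solve 6 (λ a b c d e f → (a :* (c :* f :+ e :* d)) :* ((b :* d) :* (b :* f))
                := ((a :* c) :* (b :* f) :+ (a :* e) :* (b :* d)) :* (b :* (d :* f))) ≈ₚ-refl
              (num x) (denPoly (den x)) (num y) (denPoly (den y)) (num z) (denPoly (den z)))) ,
          (λ x y z →
          cross (value-⊗ (value-⊕ (self y) (self z)) (self x)) (value-⊕ (value-⊗ (self y) (self x)) (value-⊗ (self z) (self x)))
            (solve 6 (λ a b c d e f → ((c :* f :+ e :* d) :* a) :* ((d :* b) :* (f :* b))
                := ((c :* a) :* (f :* b) :+ (e :* a) :* (d :* b)) :* ((d :* f) :* b)) ≈ₚ-refl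
              (num x) (denPoly (den x)) (num y) (denPoly (den y)) (num z) (denPoly (den z)))) }
    ; *-comm = λ x y → cross (value-⊗ (self x) (self y)) (value-⊗ (self y) (self x))
        (solve 4 (λ a b c d → (a :* c) :* (d :* b) := (c :* a) :* (b :* d)) ≈ₚ-refl
          (num x) (denPoly (den x)) (num y) (denPoly (den y))) }

  ℚ⟨r⟩ : CommutativeRing 0ℓ 0ℓ
  ℚ⟨r⟩ = record { isCommutativeRing = 𝔽-isCommutativeRing }

  inverse : ∀ x → ¬ x ≋ 0F → ∃[ y ] x ⊗ y ≋ 1F
  inverse x x≉0 with leading (num x)
  ... | vanishes z = ⊥-elim (x≉0 (cross (value z ≈ₚ-refl) value-0 ≈ₚ-refl))
  ... | leads c cs c≢0 e = y , cross (value-⊗ (self x) (self y)) value-1 (begin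
      mulR (mulR (num x) (scaleR (ℚ.1/ c) D)) (1ℚ ∷ [])
        ≈⟨ ℚ[r].*-identityʳ _ ⟩
      mulR (num x) (scaleR (ℚ.1/ c) D)
        ≈⟨ mulR-cong e ≈ₚ-refl ⟩
      mulR (scaleR c (monic cs)) (scaleR (ℚ.1/ c) D)
        ≈⟨ ⟨ mulR-scaleRˡ c (monic cs) _ ⟩ ⟩
      scaleR c (mulR (monic cs) (scaleR (ℚ.1/ c) D))
        ≈⟨ scaleR-cong c (mulR-comm (monic cs) _) ⟩
      scaleR c (mulR (scaleR (ℚ.1/ c) D) (monic cs))
        ≈⟨ scaleR-cong c ⟨ mulR-scaleRˡ (ℚ.1/ c) D (monic cs) ⟩ ⟩
      scaleR c (scaleR (ℚ.1/ c) (mulR D (monic cs)))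
        ≈⟨ ⟨ scale-inverse ⟩ ⟩
      mulR D (monic cs)
        ≈⟨ ℚ[r].*-congˡ {D} (ℚ[r].*-identityʳ (monic cs)) ⟨
      mulR D (denPoly (cs ∷ []))
        ≈⟨ ℚ[r].*-identityˡ _ ⟨
      mulR (1ℚ ∷ []) (mulR D (denPoly (cs ∷ []))) ∎)
    where
    open import Relation.Binary.Reasoning.Setoid ℚ[r].setoid
    D : RPoly
    D = denPoly (den x)
    instance c-nonZero : ℚ.NonZero c
             c-nonZero = ℚ.≢-nonZero c≢0
    -- The numerator of x is c times `monic cs`. Only the monic factor may become a denominator, so
    -- 1/c goes into the numerator.
    y : 𝔽
    y = scaleR (ℚ.1/ c) D / (cs ∷ [])
    scale-inverse : scaleR c (scaleR (ℚ.1/ c) (mulR D (monic cs))) ≈R mulR D (monic cs)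
    scale-inverse k = trans (coeff-scaleR c (scaleR (ℚ.1/ c) (mulR D (monic cs))) k) (trans (cong (c ℚ.*_) (coeff-scaleR (ℚ.1/ c) (mulR D (monic cs)) k))
      (trans (sym (ℚ.*-assoc c _ _)) (trans (cong (ℚ._* _) (ℚ.*-inverseʳ c)) (ℚ.*-identityˡ _))))

  natℚ : ℕ → ℚ
  natℚ k = (+ k) ℚ./ 1

  -- Division in ℚ normalises by a gcd that does not reduce for a variable `k`; the comparison is
  -- therefore made among unnormalised fractions.
  natℚ-suc : ∀ k → natℚ (suc k) ≡ 1ℚ ℚ.+ natℚ k
  natℚ-suc k = ℚ.toℚᵘ-injective (begin
    ℚ.toℚᵘ (natℚ (suc k))           ≈⟨ ℚ.toℚᵘ-fromℚᵘ (ℚᵘ.mkℚᵘ (+ suc k) 0) ⟩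
    ℚᵘ.mkℚᵘ (+ suc k) 0             ≈⟨ ℚᵘ.*≡* (cong (ℤ._* ℤ.1ℤ) (cong (ℤ._+_ ℤ.1ℤ) (sym (ℤ.*-identityʳ (+ k))))) ⟩
    ℚᵘ.1ℚᵘ ℚᵘ.+ ℚᵘ.mkℚᵘ (+ k) 0     ≈⟨ ℚᵘ.+-congʳ ℚᵘ.1ℚᵘ (ℚ.toℚᵘ-fromℚᵘ (ℚᵘ.mkℚᵘ (+ k) 0)) ⟨
    ℚᵘ.1ℚᵘ ℚᵘ.+ ℚ.toℚᵘ (natℚ k)     ≈⟨ ℚ.toℚᵘ-homo-+ 1ℚ (natℚ k) ⟨
    ℚ.toℚᵘ (1ℚ ℚ.+ natℚ k)          ∎)
    where
    open ℚᵘ.≃-Reasoning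

  natℚ-injective : ∀ {k l} → natℚ k ≡ natℚ l → k ≡ l
  natℚ-injective {k} {l} e with ℚ.fromℚᵘ-injective {ℚᵘ.mkℚᵘ (+ k) 0} {ℚᵘ.mkℚᵘ (+ l) 0} e
  ... | ℚᵘ.*≡* f = ℤ.+-injective (trans (sym (ℤ.*-identityʳ (+ k))) (trans f (ℤ.*-identityʳ (+ l))))

  opaque
    nat : ℕ → 𝔽
    nat = natF

    natF≡nat : ∀ k → natF k ≡ nat k
    natF≡nat k = refl

    nat-zero : nat 0 ≋ 0F
    nat-zero = cross (self (nat 0)) value-0
      (≈ₚ-trans (ℚ[r].*-identityʳ (natℚ 0 ∷ [])) ⟨ (λ { zero → refl ; (suc _) → refl }) ⟩)

    nat-suc : ∀ k → nat (suc k) ≋ 1F ⊕ nat k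
    nat-suc k = cross (self (nat (suc k))) (value-⊕ value-1 (self (nat k)))
      (≈ₚ-trans (mulR-cong {natℚ (suc k) ∷ []} {addR (1ℚ ∷ []) (natℚ k ∷ [])} {mulR (1ℚ ∷ []) (1ℚ ∷ [])} (∷-cong (natℚ-suc k) ≈ₚ-refl) ≈ₚ-refl)
        (solve 1 (λ a → (con (+ 1) :+ a) :* (con (+ 1) :* con (+ 1)) := (con (+ 1) :* con (+ 1) :+ a :* con (+ 1)) :* con (+ 1))
          ≈ₚ-refl (natℚ k ∷ [])))

  αF-inverse : αF ⊗ rF ≋ 1F
  αF-inverse = cross (value-⊗ (self αF) (self rF)) value-1
    (solve 1 (λ a → (con (+ 1) :* a) :* con (+ 1) := con (+ 1) :* ((a :* con (+ 1)) :* con (+ 1))) ≈ₚ-refl (num rF))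

  opaque
    unfolding nat

    linear : ℕ → ℕ → 𝔽
    linear a b = nat a ⊕ (rF ⊗ nat b)

    value-linear : ∀ a b → Value (linear a b) (addR (natℚ a ∷ []) (mulR (num rF) (natℚ b ∷ []))) (1ℚ ∷ [])
    value-linear a b with value-⊕ (self (nat a)) (value-⊗ (self rF) (self (nat b)))
    ... | value n d = value
      (≈ₚ-trans n (solve 3 (λ a r b → a :* (con (+ 1) :* con (+ 1)) :+ (r :* b) :* con (+ 1) := a :+ r :* b) ≈ₚ-refl
        (natℚ a ∷ []) (num rF) (natℚ b ∷ [])))
      (≈ₚ-trans d (solve 0 (con (+ 1) :* (con (+ 1) :* con (+ 1)) := con (+ 1)) ≈ₚ-refl))

    -- a + rb is a polynomial in r with coefficients a and b. This use of the indeterminacy of r is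
    -- what keeps the interpolation points and their coordinates apart.
    linear-injective : ∀ {a b a′ b′} → linear a b ≋ linear a′ b′ → a ≡ a′ × b ≡ b′
    linear-injective {a} {b} {a′} {b′} e =
      natℚ-injective (trans (sym (constant a b)) (trans (coefficients f 0) (constant a′ b′))) ,
      natℚ-injective (trans (sym (slope b)) (trans (coefficients f 1) (slope b′)))
      where
      f : addR (natℚ a ∷ []) (mulR (num rF) (natℚ b ∷ [])) ≈ₚ addR (natℚ a′ ∷ []) (mulR (num rF) (natℚ b′ ∷ []))
      f = ≈ₚ-trans (≈ₚ-sym (ℚ[r].*-identityʳ _)) (≈ₚ-trans (uncross (value-linear a b) (value-linear a′ b′) e) (ℚ[r].*-identityʳ _))
      constant : ∀ a b → natℚ a ℚ.+ (0ℚ ℚ.* natℚ b ℚ.+ 0ℚ) ≡ natℚ a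
      constant a b = trans (cong (natℚ a ℚ.+_) (trans (ℚ.+-identityʳ (0ℚ ℚ.* natℚ b)) (ℚ.*-zeroˡ (natℚ b)))) (ℚ.+-identityʳ (natℚ a))
      slope : ∀ b → 1ℚ ℚ.* natℚ b ℚ.+ 0ℚ ≡ natℚ b
      slope b = trans (ℚ.+-identityʳ (1ℚ ℚ.* natℚ b)) (ℚ.*-identityˡ (natℚ b))

    linear-nat : ∀ a b → linear a b ≡ nat a ⊕ rF ⊗ nat b
    linear-nat a b = refl

  nat-injective : ∀ {a b} → nat a ≋ nat b → a ≡ b
  nat-injective {a} {b} e = proj₁ (linear-injective {a} {0} {b} {0}
    (≡.subst₂ _≋_ (sym (linear-nat a 0)) (sym (linear-nat b 0)) (ℚ⟨r⟩.+-congʳ e)))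
    where module ℚ⟨r⟩ = CommutativeRing ℚ⟨r⟩

open RationalFunctions

-- Sorting statistics of compositions

module SortingStatistics where
  open import Data.Nat using (_+_; _∸_; _≡ᵇ_; _<ᵇ_; _<_; _≤_)

  bit : Bool → ℕ
  bit b = if b then 1 else 0

  sumFin : ∀ {n} → (Fin n → ℕ) → ℕ
  sumFin {zero}  f = 0
  sumFin {suc n} f = f zero + sumFin (f ∘ suc)

  sumFin-cong : ∀ {n} {f g : Fin n → ℕ} → (∀ k → f k ≡ g k) → sumFin f ≡ sumFin g
  sumFin-cong {zero}  e = refl
  sumFin-cong {suc n} e = cong₂ _+_ (e zero) (sumFin-cong (e ∘ suc))

  exchange : ∀ a b c → a + (b + c) ≡ b + (a + c)
  exchange a b c = trans (sym (ℕ.+-assoc a b c)) (trans (cong (_+ c) (ℕ.+-comm a b)) (ℕ.+-assoc b a c))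

  sumFin-+ : ∀ {n} (f g : Fin n → ℕ) → sumFin (λ k → f k + g k) ≡ sumFin f + sumFin g
  sumFin-+ {zero} f g = refl
  sumFin-+ {suc n} f g = begin
    f zero + g zero + sumFin (λ k → f (suc k) + g (suc k))         ≡⟨ cong (f zero + g zero +_) (sumFin-+ (f ∘ suc) (g ∘ suc)) ⟩
    f zero + g zero + (sumFin (f ∘ suc) + sumFin (g ∘ suc))        ≡⟨ ℕ.+-assoc (f zero) _ _ ⟩
    f zero + (g zero + (sumFin (f ∘ suc) + sumFin (g ∘ suc)))      ≡⟨ cong (f zero +_) (exchange (g zero) (sumFin (f ∘ suc)) _) ⟩
    f zero + (sumFin (f ∘ suc) + (g zero + sumFin (g ∘ suc)))      ≡⟨ ℕ.+-assoc (f zero) _ _ ⟨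
    f zero + sumFin (f ∘ suc) + (g zero + sumFin (g ∘ suc))        ∎
    where open ≡-Reasoning

  sumFin-zero : ∀ n → sumFin {n} (λ _ → 0) ≡ 0
  sumFin-zero zero    = refl
  sumFin-zero (suc n) = sumFin-zero n

  sumFin-one : ∀ n → sumFin {n} (λ _ → 1) ≡ n
  sumFin-one zero    = refl
  sumFin-one (suc n) = cong suc (sumFin-one n)

  sumFin-last : ∀ {n} (f : Fin (suc n) → ℕ) → sumFin f ≡ sumFin (f ∘ inject₁) + f (fromℕ n)
  sumFin-last {zero}  f = ℕ.+-identityʳ (f zero)
  sumFin-last {suc n} f = trans (cong (f zero +_) (sumFin-last (f ∘ suc))) (sym (ℕ.+-assoc (f zero) _ _))

  sumFin-indicator : ∀ {n} (j : Fin n) → sumFin {n} (λ k → bit (toℕ k ≡ᵇ toℕ j)) ≡ 1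
  sumFin-indicator {suc n} zero    = cong suc (sumFin-zero n)
  sumFin-indicator {suc n} (suc j) = sumFin-indicator j

  count-sumFin : ∀ {n} (P : Fin n → Bool) → count P ≡ sumFin (bit ∘ P)
  count-sumFin P = go P (λ k → k)
    where
    go : ∀ {n} {A : Set} (P : A → Bool) (f : Fin n → A) → L.length (L.filterᵇ P (L.tabulate f)) ≡ sumFin (bit ∘ P ∘ f)
    go {zero}  P f = refl
    go {suc n} P f with P (f zero)
    ... | true  = cong suc (go P (f ∘ suc))
    ... | false = go P (f ∘ suc)

  -- Recursion reduces reindexing of sums and monomials to an exchange of the first two entries,
  -- which the index comparisons of `swapImg` would not do.
  transpose : ∀ {m} → Fin m → Fin (suc m) → Fin (suc m)
  transpose zero    zero          = suc zero
  transpose zero    (suc zero)    = zero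
  transpose zero    (suc (suc k)) = suc (suc k)
  transpose (suc i) zero          = zero
  transpose (suc i) (suc k)       = suc (transpose i k)

  transpose-left : ∀ {m} (i : Fin m) → transpose i (inject₁ i) ≡ suc i
  transpose-left zero    = refl
  transpose-left (suc i) = cong suc (transpose-left i)

  transpose-right : ∀ {m} (i : Fin m) → transpose i (suc i) ≡ inject₁ i
  transpose-right zero    = refl
  transpose-right (suc i) = cong suc (transpose-right i)

  transpose-other : ∀ {m} (i : Fin m) k → k ≢ inject₁ i → k ≢ suc i → transpose i k ≡ k
  transpose-other zero    zero          p q = ⊥-elim (p refl)
  transpose-other zero    (suc zero)    p q = ⊥-elim (q refl)
  transpose-other zero    (suc (suc k)) p q = refl
  transpose-other (suc i) zero          p q = refl
  transpose-other (suc i) (suc k)       p q = cong suc (transpose-other i k (p ∘ cong suc) (q ∘ cong suc))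

  transpose-involutive : ∀ {m} (i : Fin m) k → transpose i (transpose i k) ≡ k
  transpose-involutive zero    zero          = refl
  transpose-involutive zero    (suc zero)    = refl
  transpose-involutive zero    (suc (suc k)) = refl
  transpose-involutive (suc i) zero          = refl
  transpose-involutive (suc i) (suc k)       = cong suc (transpose-involutive i k)

  sumFin-sw : ∀ {m} (i : Fin m) (f : Fin (suc m) → ℕ) → sumFin (f ∘ transpose i) ≡ sumFin f
  sumFin-sw {suc m} zero f = exchange (f (suc zero)) (f zero) (sumFin (λ k → f (suc (suc k))))
  sumFin-sw (suc i) f = cong (f zero +_) (sumFin-sw i (f ∘ suc))

  -- An adjacent transposition has a single inversion, so it can disturb the tie-breaking only
  -- between positions i and i+1.
  transpose-preserves-< : ∀ {m} (i : Fin m) j k →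
    (toℕ (transpose i j) <ᵇ toℕ (transpose i k)) ≡ (toℕ j <ᵇ toℕ k) ⊎ (j ≡ inject₁ i × k ≡ suc i) ⊎ (j ≡ suc i × k ≡ inject₁ i)
  transpose-preserves-< zero zero          zero          = inj₁ refl
  transpose-preserves-< zero zero          (suc zero)    = inj₂ (inj₁ (refl , refl))
  transpose-preserves-< zero zero          (suc (suc k)) = inj₁ refl
  transpose-preserves-< zero (suc zero)    zero          = inj₂ (inj₂ (refl , refl))
  transpose-preserves-< zero (suc zero)    (suc zero)    = inj₁ refl
  transpose-preserves-< zero (suc zero)    (suc (suc k)) = inj₁ refl
  transpose-preserves-< zero (suc (suc j)) zero          = inj₁ refl
  transpose-preserves-< zero (suc (suc j)) (suc zero)    = inj₁ refl
  transpose-preserves-< zero (suc (suc j)) (suc (suc k)) = inj₁ refl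
  transpose-preserves-< (suc i) zero    zero    = inj₁ refl
  transpose-preserves-< (suc i) zero    (suc k) = inj₁ refl
  transpose-preserves-< (suc i) (suc j) zero    = inj₁ refl
  transpose-preserves-< (suc i) (suc j) (suc k) with transpose-preserves-< i j k
  ... | inj₁ e                = inj₁ e
  ... | inj₂ (inj₁ (p , q))   = inj₂ (inj₁ (cong suc p , cong suc q))
  ... | inj₂ (inj₂ (p , q))   = inj₂ (inj₂ (cong suc p , cong suc q))

  -- Ties are broken by index, as for the minimal-length w_γ, so that δ γ j is the entry of δ at w_γ⁻¹(j).
  after : ∀ {n} → Comp n → Fin n → Fin n → Bool
  after γ j k = (lookup γ k <ᵇ lookup γ j) ∨ ((toℕ j <ᵇ toℕ k) ∧ (lookup γ k ≡ᵇ lookup γ j))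

  δ : ∀ {n} → Comp n → Fin n → ℕ
  δ γ j = sumFin (bit ∘ after γ j)

  <ᵇ-true : ∀ {a b} → a < b → (a <ᵇ b) ≡ true
  <ᵇ-true {zero}  {suc b} _        = refl
  <ᵇ-true {suc a} {suc b} (s≤s p)  = <ᵇ-true p

  <ᵇ-false : ∀ {a b} → b ≤ a → (a <ᵇ b) ≡ false
  <ᵇ-false {a}     {zero}  _       = refl
  <ᵇ-false {suc a} {suc b} (s≤s p) = <ᵇ-false p

  ≡ᵇ-true : ∀ a → (a ≡ᵇ a) ≡ true
  ≡ᵇ-true zero    = refl
  ≡ᵇ-true (suc a) = ≡ᵇ-true a

  ≡ᵇ-false : ∀ {a b} → a ≢ b → (a ≡ᵇ b) ≡ false
  ≡ᵇ-false {zero}  {zero}  p = ⊥-elim (p refl)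
  ≡ᵇ-false {zero}  {suc b} p = refl
  ≡ᵇ-false {suc a} {zero}  p = refl
  ≡ᵇ-false {suc a} {suc b} p = ≡ᵇ-false (p ∘ cong suc)

  -- Trichotomy of the sorting order: k stands before j, after j, or is j. Summing over k yields
  -- `rank-δ`.
  partition-bits : ∀ {n} (γ : Comp n) j k →
    (bit (lookup γ j <ᵇ lookup γ k) + bit ((toℕ k <ᵇ toℕ j) ∧ (lookup γ k ≡ᵇ lookup γ j)))
      + (bit (after γ j k) + bit (toℕ k ≡ᵇ toℕ j)) ≡ 1
  partition-bits γ j k with ℕ.<-cmp (lookup γ j) (lookup γ k)
  ... | tri< a b c rewrite <ᵇ-true a | <ᵇ-false (ℕ.<⇒≤ a) | ≡ᵇ-false (b ∘ sym) | Bool.∧-zeroʳ (toℕ k <ᵇ toℕ j)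
        | Bool.∧-zeroʳ (toℕ j <ᵇ toℕ k) | ≡ᵇ-false {toℕ k} {toℕ j} (b ∘ cong (lookup γ) ∘ sym ∘ F.toℕ-injective) = refl

  ... | tri> a b c rewrite <ᵇ-true c | <ᵇ-false (ℕ.<⇒≤ c) | ≡ᵇ-false (b ∘ sym) | Bool.∧-zeroʳ (toℕ k <ᵇ toℕ j)
        | ≡ᵇ-false {toℕ k} {toℕ j} (b ∘ cong (lookup γ) ∘ sym ∘ F.toℕ-injective) = refl

  ... | tri≈ a b c with ℕ.<-cmp (toℕ j) (toℕ k)
  ...   | tri< p q r rewrite b | ≡ᵇ-true (lookup γ k) | <ᵇ-false {lookup γ k} ℕ.≤-refl | <ᵇ-true p | <ᵇ-false (ℕ.<⇒≤ p) | ≡ᵇ-false (q ∘ sym) = refl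
  ...   | tri> p q r rewrite b | ≡ᵇ-true (lookup γ k) | <ᵇ-false {lookup γ k} ℕ.≤-refl | <ᵇ-true r | <ᵇ-false (ℕ.<⇒≤ r) | ≡ᵇ-false (q ∘ sym) = refl
  ...   | tri≈ p q r rewrite b | ≡ᵇ-true (lookup γ k) | <ᵇ-false {lookup γ k} ℕ.≤-refl | q | ≡ᵇ-true (toℕ k) | <ᵇ-false {toℕ k} ℕ.≤-refl = refl

  rank-δ : ∀ {n} (γ : Comp n) j → rankγ γ j + (δ γ j + 1) ≡ n
  rank-δ {n} γ j = begin
    rankγ γ j + (δ γ j + 1)
      ≡⟨ cong₂ _+_ (cong₂ _+_ (count-sumFin larger) (count-sumFin tied))
           (cong (δ γ j +_) (sym (sumFin-indicator j))) ⟩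
    (sumFin (bit ∘ larger) + sumFin (bit ∘ tied)) + (δ γ j + sumFin (λ (k : Fin n) → bit (toℕ k ≡ᵇ toℕ j)))
      ≡⟨ cong₂ _+_ (sumFin-+ (bit ∘ larger) (bit ∘ tied)) (sumFin-+ (bit ∘ after γ j) (λ (k : Fin n) → bit (toℕ k ≡ᵇ toℕ j))) ⟨
    sumFin (λ k → bit (larger k) + bit (tied k)) + sumFin (λ k → bit (after γ j k) + bit (toℕ k ≡ᵇ toℕ j))
      ≡⟨ sumFin-+ (λ k → bit (larger k) + bit (tied k)) (λ k → bit (after γ j k) + bit (toℕ k ≡ᵇ toℕ j)) ⟨
    sumFin (λ k → (bit (larger k) + bit (tied k)) + (bit (after γ j k) + bit (toℕ k ≡ᵇ toℕ j)))
      ≡⟨ sumFin-cong (partition-bits γ j) ⟩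
    sumFin {n} (λ _ → 1)
      ≡⟨ sumFin-one n ⟩
    n ∎
    where
    open ≡-Reasoning
    larger tied : Fin n → Bool
    larger k = lookup γ j <ᵇ lookup γ k
    tied k = (toℕ k <ᵇ toℕ j) ∧ (lookup γ k ≡ᵇ lookup γ j)

  -- This trades the truncated subtraction in `bar` for a count, whose behaviour under rotation and
  -- swap can be read off entry by entry.
  codegree-rank : ∀ {n} (γ : Comp n) j → n ∸ 1 ∸ rankγ γ j ≡ δ γ j
  codegree-rank {n} γ j = begin
    n ∸ 1 ∸ ρ                    ≡⟨ cong (λ n → n ∸ 1 ∸ ρ) (trans (ℕ.+-assoc ρ (δ γ j) 1) (rank-δ γ j)) ⟨
    (ρ + δ γ j + 1) ∸ 1 ∸ ρ      ≡⟨ cong (_∸ ρ) (ℕ.m+n∸n≡m (ρ + δ γ j) 1) ⟩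
    (ρ + δ γ j) ∸ ρ              ≡⟨ ℕ.m+n∸m≡n ρ (δ γ j) ⟩
    δ γ j                        ∎
    where
    open ≡-Reasoning
    ρ : ℕ
    ρ = rankγ γ j

  -- The exponent of Φ(x^γ): x₁ becomes xₙ, the other variables move down by one index, and one more
  -- factor xₙ appears.
  rotate : ∀ {m} → Comp (suc m) → Comp (suc m)
  rotate γ = tail γ ∷ʳ suc (head γ)

  swap : ∀ {m} → Fin m → Comp (suc m) → Comp (suc m)
  swap i γ = tabulate (lookup γ ∘ transpose i)

  lookup-∷ʳ-inject₁ : ∀ {A : Set} {n} (xs : Vec A n) x k → lookup (xs ∷ʳ x) (inject₁ k) ≡ lookup xs k
  lookup-∷ʳ-inject₁ (y ∷ xs) x zero    = refl
  lookup-∷ʳ-inject₁ (y ∷ xs) x (suc k) = lookup-∷ʳ-inject₁ xs x k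

  lookup-∷ʳ-fromℕ : ∀ {A : Set} {n} (xs : Vec A n) x → lookup (xs ∷ʳ x) (fromℕ n) ≡ x
  lookup-∷ʳ-fromℕ []       x = refl
  lookup-∷ʳ-fromℕ (y ∷ xs) x = lookup-∷ʳ-fromℕ xs x

  <ᵇ-suc : ∀ a b → (a <ᵇ suc b) ≡ (a <ᵇ b) ∨ (a ≡ᵇ b)
  <ᵇ-suc zero    zero    = refl
  <ᵇ-suc zero    (suc b) = refl
  <ᵇ-suc (suc a) zero    = refl
  <ᵇ-suc (suc a) (suc b) = <ᵇ-suc a b

  suc-<ᵇ : ∀ a b → (suc a <ᵇ b) ∨ (suc a ≡ᵇ b) ≡ (a <ᵇ b)
  suc-<ᵇ a       zero          = refl
  suc-<ᵇ zero    (suc zero)    = refl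
  suc-<ᵇ zero    (suc (suc b)) = refl
  suc-<ᵇ (suc a) (suc b)       = suc-<ᵇ a b

  module _ {m : ℕ} (γ : Comp m) (c : ℕ) where
    private
      toℕ-inject₁<m : ∀ k → toℕ (inject₁ k) < m
      toℕ-inject₁<m k = ≡.subst (_< m) (sym (F.toℕ-inject₁ k)) (F.toℕ<n k)

    after-last-inject₁ : ∀ k → after (γ ∷ʳ c) (fromℕ m) (inject₁ k) ≡ (lookup γ k <ᵇ c)
    after-last-inject₁ k rewrite lookup-∷ʳ-inject₁ γ c k | lookup-∷ʳ-fromℕ γ c | F.toℕ-fromℕ m
      | <ᵇ-false (ℕ.<⇒≤ (toℕ-inject₁<m k)) = Bool.∨-identityʳ _

    after-last-last : after (γ ∷ʳ c) (fromℕ m) (fromℕ m) ≡ false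
    after-last-last rewrite lookup-∷ʳ-fromℕ γ c | <ᵇ-false {c} ℕ.≤-refl | <ᵇ-false {toℕ (fromℕ m)} ℕ.≤-refl = refl

    after-inject₁-inject₁ : ∀ j k → after (γ ∷ʳ c) (inject₁ j) (inject₁ k) ≡ after γ j k
    after-inject₁-inject₁ j k rewrite lookup-∷ʳ-inject₁ γ c k | lookup-∷ʳ-inject₁ γ c j | F.toℕ-inject₁ j | F.toℕ-inject₁ k = refl

    after-inject₁-last : ∀ j → after (γ ∷ʳ c) (inject₁ j) (fromℕ m) ≡ (c <ᵇ lookup γ j) ∨ (c ≡ᵇ lookup γ j)
    after-inject₁-last j rewrite lookup-∷ʳ-inject₁ γ c j | lookup-∷ʳ-fromℕ γ c | F.toℕ-fromℕ m
      | <ᵇ-true (toℕ-inject₁<m j) = refl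

    δ-last : δ (γ ∷ʳ c) (fromℕ m) ≡ sumFin (λ k → bit (lookup γ k <ᵇ c))
    δ-last = begin
      δ (γ ∷ʳ c) (fromℕ m)
        ≡⟨ sumFin-last (bit ∘ after (γ ∷ʳ c) (fromℕ m)) ⟩
      sumFin (bit ∘ after (γ ∷ʳ c) (fromℕ m) ∘ inject₁) + bit (after (γ ∷ʳ c) (fromℕ m) (fromℕ m))
        ≡⟨ cong₂ _+_ (sumFin-cong (cong bit ∘ after-last-inject₁)) (cong bit after-last-last) ⟩
      sumFin (λ k → bit (lookup γ k <ᵇ c)) + 0
        ≡⟨ ℕ.+-identityʳ _ ⟩
      sumFin (λ k → bit (lookup γ k <ᵇ c)) ∎
      where open ≡-Reasoning

    δ-inject₁ : ∀ j → δ (γ ∷ʳ c) (inject₁ j) ≡ bit ((c <ᵇ lookup γ j) ∨ (c ≡ᵇ lookup γ j)) + δ γ j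
    δ-inject₁ j = begin
      δ (γ ∷ʳ c) (inject₁ j)
        ≡⟨ sumFin-last (bit ∘ after (γ ∷ʳ c) (inject₁ j)) ⟩
      sumFin (bit ∘ after (γ ∷ʳ c) (inject₁ j) ∘ inject₁) + bit (after (γ ∷ʳ c) (inject₁ j) (fromℕ m))
        ≡⟨ cong₂ _+_ (sumFin-cong (cong bit ∘ after-inject₁-inject₁ j)) (cong bit (after-inject₁-last j)) ⟩
      δ γ j + bit ((c <ᵇ lookup γ j) ∨ (c ≡ᵇ lookup γ j))
        ≡⟨ ℕ.+-comm (δ γ j) _ ⟩
      bit ((c <ᵇ lookup γ j) ∨ (c ≡ᵇ lookup γ j)) + δ γ j ∎
      where open ≡-Reasoning

  -- As first entry, c wins its ties and so stands before the entries at most c. At the end it loses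
  -- all ties but has grown to c+1, and so it stands before the entries below c+1, which are the
  -- same ones. `δ-rotate-inject₁` is the same compensation seen from the other entries.
  δ-rotate-last : ∀ {m} (γ : Comp (suc m)) → δ (rotate γ) (fromℕ m) ≡ δ γ zero
  δ-rotate-last (c ∷ γ) = trans (δ-last γ (suc c))
    (trans (sumFin-cong (λ k → cong bit (<ᵇ-suc (lookup γ k) c)))
      (cong (_+ sumFin (λ k → bit (after (c ∷ γ) zero (suc k)))) (sym (cong (λ b → bit (b ∨ false)) (<ᵇ-false {c} ℕ.≤-refl)))))

  δ-rotate-inject₁ : ∀ {m} (γ : Comp (suc m)) j → δ (rotate γ) (inject₁ j) ≡ δ γ (suc j)
  δ-rotate-inject₁ (c ∷ γ) j = trans (δ-inject₁ γ (suc c) j)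
    (cong (_+ δ γ j) (cong bit (trans (suc-<ᵇ c (lookup γ j)) (sym (Bool.∨-identityʳ _)))))

  δ-∷ʳ0-last : ∀ {m} (γ : Comp m) → δ (γ ∷ʳ 0) (fromℕ m) ≡ 0
  δ-∷ʳ0-last {m} γ = trans (δ-last γ 0) (trans (sumFin-cong (λ k → cong bit (<ᵇ-false {lookup γ k} z≤n))) (sumFin-zero m))

  -- A final 0 is sorted last, so every other entry gains one successor. The translation parameter
  -- of `pt` is there to absorb this increment.
  δ-∷ʳ0-inject₁ : ∀ {m} (γ : Comp m) j → δ (γ ∷ʳ 0) (inject₁ j) ≡ suc (δ γ j)
  δ-∷ʳ0-inject₁ γ j = trans (δ-inject₁ γ 0 j) (cong (_+ δ γ j) (cong bit (sym (<ᵇ-suc 0 (lookup γ j)))))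

  lookup-swap : ∀ {m} (i : Fin m) (γ : Comp (suc m)) k → lookup (swap i γ) k ≡ lookup γ (transpose i k)
  lookup-swap i γ = V.lookup∘tabulate (lookup γ ∘ transpose i)

  module _ {m : ℕ} (i : Fin m) (γ : Comp (suc m)) where

    after-swap : lookup γ (inject₁ i) ≢ lookup γ (suc i) → ∀ j k → after (swap i γ) j k ≡ after γ (transpose i j) (transpose i k)
    after-swap γᵢ≢γⱼ j k rewrite lookup-swap i γ j | lookup-swap i γ k with transpose-preserves-< i j k
    ... | inj₁ e rewrite e = refl
    ... | inj₂ (inj₁ (refl , refl)) rewrite transpose-left i | transpose-right i | ≡ᵇ-false γᵢ≢γⱼ
          | Bool.∧-zeroʳ (toℕ (inject₁ i) <ᵇ toℕ (suc i)) | Bool.∧-zeroʳ (toℕ (suc i) <ᵇ toℕ (inject₁ i)) = refl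
    ... | inj₂ (inj₂ (refl , refl)) rewrite transpose-left i | transpose-right i | ≡ᵇ-false (γᵢ≢γⱼ ∘ sym)
          | Bool.∧-zeroʳ (toℕ (inject₁ i) <ᵇ toℕ (suc i)) | Bool.∧-zeroʳ (toℕ (suc i) <ᵇ toℕ (inject₁ i)) = refl

    δ-swap : lookup γ (inject₁ i) ≢ lookup γ (suc i) → ∀ j → δ (swap i γ) j ≡ δ γ (transpose i j)
    δ-swap γᵢ≢γⱼ j = trans (sumFin-cong (cong bit ∘ after-swap γᵢ≢γⱼ j)) (sumFin-sw i (bit ∘ after γ (transpose i j)))

    after-tie : lookup γ (inject₁ i) ≡ lookup γ (suc i) → ∀ k →
      bit (after γ (inject₁ i) k) ≡ bit (after γ (suc i) k) + bit (toℕ k ≡ᵇ toℕ (suc i))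
    after-tie tie k rewrite tie | F.toℕ-inject₁ i with ℕ.<-cmp (toℕ k) (suc (toℕ i))
    ... | tri< a b _ rewrite <ᵇ-false (ℕ.≤-pred a) | <ᵇ-false (ℕ.<⇒≤ a) | ≡ᵇ-false b = sym (ℕ.+-identityʳ _)
    ... | tri> _ b c rewrite <ᵇ-true c | <ᵇ-true (ℕ.<⇒≤ c) | ≡ᵇ-false b = sym (ℕ.+-identityʳ _)
    ... | tri≈ _ b _ with F.toℕ-injective {i = k} {j = suc i} b
    ...   | refl rewrite <ᵇ-false {lookup γ (suc i)} ℕ.≤-refl | ≡ᵇ-true (lookup γ (suc i)) | <ᵇ-true {toℕ i} ℕ.≤-refl
            | <ᵇ-false {toℕ i} ℕ.≤-refl | ≡ᵇ-true (toℕ i) = refl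

    -- No index lies between i and i+1, so tied entries there are consecutive in the sorting. Their
    -- coordinates thus differ by exactly r, the coefficient of ∂ᵢ in σᵢ⁺.
    δ-tie : lookup γ (inject₁ i) ≡ lookup γ (suc i) → δ γ (inject₁ i) ≡ suc (δ γ (suc i))
    δ-tie tie = begin
      δ γ (inject₁ i)
        ≡⟨ sumFin-cong (after-tie tie) ⟩
      sumFin (λ k → bit (after γ (suc i) k) + bit (toℕ k ≡ᵇ toℕ (suc i)))
        ≡⟨ sumFin-+ (bit ∘ after γ (suc i)) (λ k → bit (toℕ k ≡ᵇ toℕ (suc i))) ⟩
      δ γ (suc i) + sumFin {suc m} (λ k → bit (toℕ k ≡ᵇ toℕ (suc i)))
        ≡⟨ cong (δ γ (suc i) +_) (sumFin-indicator (suc i)) ⟩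
      δ γ (suc i) + 1
        ≡⟨ ℕ.+-comm _ 1 ⟩
      suc (δ γ (suc i)) ∎
      where open ≡-Reasoning

  sum-∷ʳ : ∀ {m} (γ : Comp m) c → ∣ γ ∷ʳ c ∣ ≡ ∣ γ ∣ + c
  sum-∷ʳ []      c = ℕ.+-identityʳ c
  sum-∷ʳ (a ∷ γ) c = trans (cong (a +_) (sum-∷ʳ γ c)) (sym (ℕ.+-assoc a ∣ γ ∣ c))

  ∣rotate∣ : ∀ {m} (γ : Comp (suc m)) → ∣ rotate γ ∣ ≡ suc ∣ γ ∣
  ∣rotate∣ (c ∷ γ) = trans (sum-∷ʳ γ (suc c)) (ℕ.+-comm ∣ γ ∣ (suc c))

  sum-sumFin : ∀ {n} (γ : Comp n) → ∣ γ ∣ ≡ sumFin (lookup γ)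
  sum-sumFin []      = refl
  sum-sumFin (c ∷ γ) = cong (c +_) (sum-sumFin γ)

  ∣swap∣ : ∀ {m} (i : Fin m) (γ : Comp (suc m)) → ∣ swap i γ ∣ ≡ ∣ γ ∣
  ∣swap∣ i γ = trans (sum-sumFin (swap i γ)) (trans (sumFin-cong (lookup-swap i γ))
    (trans (sumFin-sw i (lookup γ)) (sym (sum-sumFin γ))))

  swap-involutive : ∀ {m} (i : Fin m) (γ : Comp (suc m)) → swap i (swap i γ) ≡ γ
  swap-involutive i γ = trans (V.tabulate-cong (λ k → trans (lookup-swap i γ (transpose i k)) (cong (lookup γ) (transpose-involutive i k))))
    (V.tabulate∘lookup γ)

open SortingStatistics

-- Polynomial functions and uniqueness of interpolation

open import Data.Integer using (+_)
open import Data.Nat using (_+_; _∸_; _≤_; _<_; _≡ᵇ_; _≤ᵇ_; _<ᵇ_)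

module K = CommutativeRing ℚ⟨r⟩
open IntegerCoefficients ℚ⟨r⟩ using (solve; _:=_; _:+_; _:*_; :-_; _:-_; con)
open import Relation.Binary.Reasoning.Setoid K.setoid

private variable
  n m : ℕ

⊗-cancel : ∀ {x y} → ¬ x ≋ 0F → x ⊗ y ≋ 0F → y ≋ 0F
⊗-cancel {x} {y} x≉0 xy≋0 with inverse x x≉0
... | w , xw≋1 = begin
  y            ≈⟨ K.*-identityˡ y ⟨
  1F ⊗ y       ≈⟨ K.*-congʳ xw≋1 ⟨
  x ⊗ w ⊗ y    ≈⟨ solve 3 (λ x w y → x :* w :* y := w :* (x :* y)) K.refl x w y ⟩
  w ⊗ (x ⊗ y)  ≈⟨ K.*-congˡ xy≋0 ⟩
  w ⊗ 0F       ≈⟨ K.zeroʳ w ⟩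
  0F           ∎

difference≋0 : ∀ {x y} → x ⊕ ⊝ y ≋ 0F → x ≋ y
difference≋0 {x} {y} e = begin
  x               ≈⟨ solve 2 (λ x y → x := (x :- y) :+ y) K.refl x y ⟩
  x ⊕ ⊝ y ⊕ y     ≈⟨ K.+-congʳ e ⟩
  0F ⊕ y          ≈⟨ K.+-identityˡ y ⟩
  y               ∎

⊝-injective : ∀ {x y} → ⊝ x ≋ ⊝ y → x ≋ y
⊝-injective {x} {y} e = begin
  x      ≈⟨ solve 1 (λ x → x := :- (:- x)) K.refl x ⟩
  ⊝ ⊝ x  ≈⟨ K.-‿cong e ⟩
  ⊝ ⊝ y  ≈⟨ solve 1 (λ x → :- (:- x) := x) K.refl y ⟩
  y      ∎

Pt : ℕ → Set
Pt n = Fin n → 𝔽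

infix 4 _≗ₚ_
_≗ₚ_ : ∀ {n} → Pt n → Pt n → Set
z ≗ₚ z′ = ∀ j → z j ≋ z′ j

-- Derivations that a function is polynomial of degree at most d. The index is an upper bound read
-- off the derivation, which avoids normal forms; `resp` weakens it and passes to any pointwise
-- equal function.
data PFun {n : ℕ} : ℕ → (Pt n → 𝔽) → Set where
  const : ∀ {d} c → PFun d (λ _ → c)
  coord : ∀ {d} j → PFun (suc d) (λ z → z j)
  add   : ∀ {d F G} → PFun d F → PFun d G → PFun d (λ z → F z ⊕ G z)
  mul   : ∀ {d e F G} → PFun d F → PFun e G → PFun (d + e) (λ z → F z ⊗ G z)
  resp  : ∀ {d e F G} → d ≤ e → (∀ z → F z ≋ G z) → PFun d F → PFun e G

-- Degree below 0 means the zero function. With this convention, quotients and lower-order terms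
-- need no separate treatment in degree 0.
PFun< : ∀ {n} → ℕ → (Pt n → 𝔽) → Set
PFun< zero    F = ∀ z → F z ≋ 0F
PFun< (suc d) F = PFun d F

module _ {n : ℕ} where
  private variable
    d e : ℕ
    F G : Pt n → 𝔽

  PFun-ext : PFun d F → ∀ {z z′} → z ≗ₚ z′ → F z ≋ F z′
  PFun-ext (const c)    e = K.refl
  PFun-ext (coord j)    e = e j
  PFun-ext (add p q)    e = K.+-cong (PFun-ext p e) (PFun-ext q e)
  PFun-ext (mul p q)    e = K.*-cong (PFun-ext p e) (PFun-ext q e)
  PFun-ext (resp _ f p) {z} {z′} e = K.trans (K.sym (f z)) (K.trans (PFun-ext p e) (f z′))

  PFun-comp : ∀ {k} {T : Fin n → Pt k → 𝔽} → (∀ j → PFun 1 (T j)) → PFun d F → PFun d (λ z → F (λ j → T j z))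
  PFun-comp t (const c)    = const c
  PFun-comp t (coord j)    = resp (s≤s z≤n) (λ _ → K.refl) (t j)
  PFun-comp t (add p q)    = add (PFun-comp t p) (PFun-comp t q)
  PFun-comp t (mul p q)    = mul (PFun-comp t p) (PFun-comp t q)
  PFun-comp {T = T} t (resp l f p) = resp l (λ z → f (λ j → T j z)) (PFun-comp t p)

  PFun<-resp : d ≤ e → (∀ z → F z ≋ G z) → PFun< d F → PFun< e G
  PFun<-resp {zero}  {zero}  l       f p = λ z → K.trans (K.sym (f z)) (p z)
  PFun<-resp {zero}  {suc e} l       f p = resp z≤n (λ z → K.trans (K.sym (p z)) (f z)) (const 0F)
  PFun<-resp {suc d} {suc e} (s≤s l) f p = resp l f p

  PFun<⇒PFun : PFun< d F → PFun d F
  PFun<⇒PFun {zero}  p = resp z≤n (λ z → K.sym (p z)) (const 0F)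
  PFun<⇒PFun {suc d} p = resp (ℕ.n≤1+n d) (λ _ → K.refl) p

  PFun<-zero : PFun< {n} d (λ _ → 0F)
  PFun<-zero {zero}  = λ _ → K.refl
  PFun<-zero {suc d} = const 0F

  PFun<-add : PFun< d F → PFun< d G → PFun< d (λ z → F z ⊕ G z)
  PFun<-add {zero}  p q = λ z → K.trans (K.+-cong (p z) (q z)) (K.+-identityˡ 0F)
  PFun<-add {suc d} p q = add p q

  PFun<-mul : PFun< d F → PFun e G → PFun< (d + e) (λ z → F z ⊗ G z)
  PFun<-mul {zero}  p q = PFun<-resp z≤n (λ z → K.sym (K.trans (K.*-congʳ (p z)) (K.zeroˡ _))) (PFun<-zero {zero})
  PFun<-mul {suc d} p q = mul p q

  PFun<-scale : ∀ c → PFun< d F → PFun< d (λ z → c ⊗ F z)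
  PFun<-scale {d} c p = PFun<-resp (ℕ.≤-reflexive (ℕ.+-identityʳ d)) (λ _ → K.*-comm _ _) (PFun<-mul {d} p (const {d = 0} c))

  PFun<-comp : ∀ {k} {T : Fin n → Pt k → 𝔽} → (∀ j → PFun 1 (T j)) → PFun< d F → PFun< d (λ z → F (λ j → T j z))
  PFun<-comp {zero}  {T = T} t p = λ z → p (λ j → T j z)
  PFun<-comp {suc d} t p = PFun-comp t p

-- The cases L = z_last - a, L = z_i - z_{i+1} and L = 1 give division by the equation of a hyperplane,
-- the divided difference, and the effect of a translation on terms of top degree.
difference-quotient : ∀ {n k d} {F : Pt n → 𝔽} {T U : Fin n → Pt k → 𝔽} → (∀ j → PFun 1 (T j)) → (∀ j → PFun 1 (U j)) →
  (L : Pt k → 𝔽) (c : Fin n → 𝔽) → (∀ j z → T j z ≋ U j z ⊕ L z ⊗ c j) → PFun d F →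
  ∃[ Q ] PFun< d Q × (∀ z → F (λ j → T j z) ≋ F (λ j → U j z) ⊕ L z ⊗ Q z)
difference-quotient {d = d} t u L c e (const a) = (λ _ → 0F) , PFun<-zero {d = d} ,
  λ z → solve 2 (λ a l → a := a :+ l :* con (+ 0)) K.refl a (L z)
difference-quotient t u L c e (coord j) = (λ _ → c j) , const (c j) , e j
difference-quotient {d = d} {U = U} t u L c e (add {F = A} {G = B} p q)
  with difference-quotient t u L c e p | difference-quotient t u L c e q
... | P , P< , P≋ | Q , Q< , Q≋ = (λ z → P z ⊕ Q z) , PFun<-add {d = d} P< Q< , λ z →
  K.trans (K.+-cong (P≋ z) (Q≋ z))
    (solve 5 (λ a b l p q → (a :+ l :* p) :+ (b :+ l :* q) := (a :+ b) :+ l :* (p :+ q)) K.refl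
      (A (λ j → U j z)) (B (λ j → U j z)) (L z) (P z) (Q z))
difference-quotient {T = T} {U} t u L c e′ (mul {d} {e} {F = A} {G = B} p q)
  with difference-quotient t u L c e′ p | difference-quotient t u L c e′ q
-- Twisted Leibniz rule: one factor is already moved to T while the other is still at U.
... | P , P< , P≋ | Q , Q< , Q≋ = (λ z → P z ⊗ B (λ j → T j z) ⊕ Q z ⊗ A (λ j → U j z)) ,
  PFun<-add {d = d + e} (PFun<-mul {d = d} P< (PFun-comp t q))
    (PFun<-resp (ℕ.≤-reflexive (ℕ.+-comm e d)) (λ _ → K.refl) (PFun<-mul {d = e} Q< (PFun-comp u p))) , λ z → begin
  A (λ j → T j z) ⊗ B (λ j → T j z)
    ≈⟨ K.*-congʳ (P≋ z) ⟩
  (A (λ j → U j z) ⊕ L z ⊗ P z) ⊗ B (λ j → T j z)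
    ≈⟨ solve 4 (λ a l p b → (a :+ l :* p) :* b := a :* b :+ l :* (p :* b)) K.refl (A (λ j → U j z)) (L z) (P z) (B (λ j → T j z)) ⟩
  A (λ j → U j z) ⊗ B (λ j → T j z) ⊕ L z ⊗ (P z ⊗ B (λ j → T j z))
    ≈⟨ K.+-congʳ (K.*-congˡ (Q≋ z)) ⟩
  A (λ j → U j z) ⊗ (B (λ j → U j z) ⊕ L z ⊗ Q z) ⊕ L z ⊗ (P z ⊗ B (λ j → T j z))
    ≈⟨ solve 5 (λ a b l q s → a :* (b :+ l :* q) :+ l :* s := a :* b :+ l :* (s :+ q :* a)) K.refl
         (A (λ j → U j z)) (B (λ j → U j z)) (L z) (Q z) (P z ⊗ B (λ j → T j z)) ⟩
  A (λ j → U j z) ⊗ B (λ j → U j z) ⊕ L z ⊗ (P z ⊗ B (λ j → T j z) ⊕ Q z ⊗ A (λ j → U j z)) ∎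
difference-quotient {T = T} {U} t u L c e′ (resp {d} {e} l f p) with difference-quotient t u L c e′ p
... | P , P< , P≋ = P , PFun<-resp l (λ _ → K.refl) P< , λ z →
  K.trans (K.sym (f (λ j → T j z))) (K.trans (P≋ z) (K.+-congʳ (f (λ j → U j z))))

snoc : ∀ {A : Set} {m} → (Fin m → A) → A → Fin (suc m) → A
snoc {m = zero}  f a _       = a
snoc {m = suc m} f a zero    = f zero
snoc {m = suc m} f a (suc k) = snoc (f ∘ suc) a k

snoc-inject₁ : ∀ {A : Set} {m} (f : Fin m → A) a k → snoc f a (inject₁ k) ≡ f k
snoc-inject₁ {m = suc m} f a zero    = refl
snoc-inject₁ {m = suc m} f a (suc k) = snoc-inject₁ (f ∘ suc) a k

snoc-fromℕ : ∀ {A : Set} {m} (f : Fin m → A) a → snoc f a (fromℕ m) ≡ a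
snoc-fromℕ {m = zero}  f a = refl
snoc-fromℕ {m = suc m} f a = snoc-fromℕ (f ∘ suc) a

last-elim : ∀ {m} (P : Fin (suc m) → Set) → P (fromℕ m) → (∀ k → P (inject₁ k)) → ∀ k → P k
last-elim P l i k with view k
... | ‵fromℕ     = l
... | ‵inject₁ j = i j

snoc-PFun : ∀ {n m d} {f : Fin m → Pt n → 𝔽} {g : Pt n → 𝔽} → (∀ k → PFun d (f k)) → PFun d g →
  ∀ j → PFun d (λ z → snoc (λ k → f k z) (g z) j)
snoc-PFun {d = d} {f} {g} p q = last-elim (λ j → PFun d (λ z → snoc (λ k → f k z) (g z) j))
  (resp ℕ.≤-refl (λ z → K.reflexive (≡.sym (snoc-fromℕ (λ k → f k z) (g z)))) q)
  (λ k → resp ℕ.≤-refl (λ z → K.reflexive (≡.sym (snoc-inject₁ (λ k → f k z) (g z) k))) (p k))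

-- The negated interpolation points -γ̄, with all of them translated by -rc.
pt : ∀ {n} → ℕ → Comp n → Pt n
pt c γ j = ⊝ linear (lookup γ j) (δ γ j + c)

linear-suc : ∀ a b → linear (suc a) b ≋ linear a b ⊕ 1F
linear-suc a b = begin
  linear (suc a) b            ≡⟨ linear-nat (suc a) b ⟩
  nat (suc a) ⊕ rF ⊗ nat b    ≈⟨ K.+-congʳ (nat-suc a) ⟩
  1F ⊕ nat a ⊕ rF ⊗ nat b     ≈⟨ solve 2 (λ a b → con (+ 1) :+ a :+ b := a :+ b :+ con (+ 1)) K.refl (nat a) (rF ⊗ nat b) ⟩
  nat a ⊕ rF ⊗ nat b ⊕ 1F     ≡⟨ cong (_⊕ 1F) (linear-nat a b) ⟨
  linear a b ⊕ 1F             ∎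

unrotate : ∀ {m} → Pt (suc m) → Pt (suc m)
unrotate y = snoc (y ∘ suc) (y zero ⊕ ⊝ 1F)

-- Every entry keeps its δ under rotation, and the entry moved to the end grows by 1, which becomes
-- a subtraction at the negated points.
pt-rotate : ∀ {m} c (γ : Comp (suc m)) → pt c (rotate γ) ≗ₚ unrotate (pt c γ)
pt-rotate {m} c (a ∷ γ) = last-elim (λ j → pt c (rotate (a ∷ γ)) j ≋ unrotate (pt c (a ∷ γ)) j)
  (begin
    pt c (rotate (a ∷ γ)) (fromℕ m)
      ≡⟨ cong₂ (λ x y → ⊝ linear x (y + c)) (lookup-∷ʳ-fromℕ γ (suc a)) (δ-rotate-last (a ∷ γ)) ⟩
    ⊝ linear (suc a) (δ (a ∷ γ) zero + c)
      ≈⟨ K.-‿cong (linear-suc a (δ (a ∷ γ) zero + c)) ⟩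
    ⊝ (linear a (δ (a ∷ γ) zero + c) ⊕ 1F)
      ≈⟨ solve 1 (λ x → :- (x :+ con (+ 1)) := :- x :- con (+ 1)) K.refl (linear a (δ (a ∷ γ) zero + c)) ⟩
    ⊝ linear a (δ (a ∷ γ) zero + c) ⊕ ⊝ 1F
      ≡⟨ snoc-fromℕ (pt c (a ∷ γ) ∘ suc) _ ⟨
    unrotate (pt c (a ∷ γ)) (fromℕ m) ∎)
  (λ k → K.reflexive (≡.trans
    (cong₂ (λ x y → ⊝ linear x (y + c)) (lookup-∷ʳ-inject₁ γ (suc a) k) (δ-rotate-inject₁ (a ∷ γ) k))
    (≡.sym (snoc-inject₁ (pt c (a ∷ γ) ∘ suc) _ k))))

pt-∷ʳ0 : ∀ {m} c (γ : Comp m) → pt c (γ ∷ʳ 0) ≗ₚ snoc (pt (suc c) γ) (⊝ linear 0 c)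
pt-∷ʳ0 {m} c γ = last-elim (λ j → pt c (γ ∷ʳ 0) j ≋ snoc (pt (suc c) γ) (⊝ linear 0 c) j)
  (K.reflexive (≡.trans
    (cong₂ (λ x y → ⊝ linear x (y + c)) (lookup-∷ʳ-fromℕ γ 0) (δ-∷ʳ0-last γ))
    (≡.sym (snoc-fromℕ (pt (suc c) γ) _))))
  (λ k → K.reflexive (≡.trans
    (cong₂ (λ x y → ⊝ linear x y) (lookup-∷ʳ-inject₁ γ 0 k)
      (≡.trans (cong (_+ c) (δ-∷ʳ0-inject₁ γ k)) (≡.sym (ℕ.+-suc (δ γ k) c))))
    (≡.sym (snoc-inject₁ (pt (suc c) γ) _ k))))

hyperplane-division : ∀ {m d} a {F : Pt (suc m) → 𝔽} → PFun d F →
  ∃[ Q ] PFun< d Q × (∀ z → F z ≋ F (snoc (z ∘ inject₁) a) ⊕ (z (fromℕ m) ⊕ ⊝ a) ⊗ Q z)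
hyperplane-division {m} a p =
  difference-quotient {T = λ j z → z j} {U = U} coord (snoc-PFun (coord ∘ inject₁) (const a)) L c
    (last-elim (λ j → ∀ z → z j ≋ U j z ⊕ L z ⊗ c j)
      (λ z → subst₂ (λ x y → z (fromℕ m) ≋ x ⊕ L z ⊗ y)
        (≡.sym (snoc-fromℕ (z ∘ inject₁) a)) (≡.sym (snoc-fromℕ {m = m} (λ _ → 0F) 1F))
        (solve 2 (λ x a → x := a :+ (x :- a) :* con (+ 1)) K.refl (z (fromℕ m)) a))
      (λ k z → subst₂ (λ x y → z (inject₁ k) ≋ x ⊕ L z ⊗ y)
        (≡.sym (snoc-inject₁ (z ∘ inject₁) a k)) (≡.sym (snoc-inject₁ (λ _ → 0F) 1F k))
        (solve 2 (λ x l → x := x :+ l :* con (+ 0)) K.refl (z (inject₁ k)) (L z))))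
    p
  where
  U : Fin (suc m) → Pt (suc m) → 𝔽
  U j z = snoc (z ∘ inject₁) a j
  L : Pt (suc m) → 𝔽
  L z = z (fromℕ m) ⊕ ⊝ a
  c : Fin (suc m) → 𝔽
  c = snoc (λ _ → 0F) 1F

rotate-point : ∀ {m} → Pt (suc m) → Pt (suc m)
rotate-point {m} z zero    = z (fromℕ m) ⊕ 1F
rotate-point {m} z (suc k) = z (inject₁ k)

unrotate-rotate : ∀ {m} (z : Pt (suc m)) → unrotate (rotate-point z) ≗ₚ z
unrotate-rotate {m} z = last-elim (λ j → unrotate (rotate-point z) j ≋ z j)
  (K.trans (K.reflexive (snoc-fromℕ (z ∘ inject₁) _))
    (solve 1 (λ x → x :+ con (+ 1) :- con (+ 1) := x) K.refl (z (fromℕ m))))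
  (λ k → K.reflexive (snoc-inject₁ (z ∘ inject₁) _ k))

off-hyperplane : ∀ {m} c (γ : Comp (suc m)) → ¬ (pt c (rotate γ) (fromℕ m) ⊕ ⊝ ⊝ linear 0 c ≋ 0F)
off-hyperplane {m} c (k ∷ γ) e =
  ℕ.1+n≢0 (≡.trans (≡.sym (lookup-∷ʳ-fromℕ γ (suc k)))
    (proj₁ (linear-injective {lookup (rotate (k ∷ γ)) (fromℕ m)} {δ (rotate (k ∷ γ)) (fromℕ m) + c} {0} {c}
      (⊝-injective (difference≋0 e)))))

-- The hyperplane z_last = -rc contains exactly the points with γ_last = 0; dividing by its
-- equation leaves a polynomial of lower degree vanishing on the remaining, rotated points.
vanishing : ∀ n d c {F : Pt n → 𝔽} → PFun d F → (∀ γ → ∣ γ ∣ ≤ d → F (pt c γ) ≋ 0F) → ∀ z → F z ≋ 0F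
vanishing zero    d c p v z = K.trans (PFun-ext p (λ ())) (v [] z≤n)
vanishing (suc m) d c {F} p v = conclude (hyperplane-division a p)
  where
  a : 𝔽
  a = ⊝ linear 0 c

  on-hyperplane : ∀ y → F (snoc y a) ≋ 0F
  on-hyperplane = vanishing m d (suc c) (PFun-comp (snoc-PFun coord (const a)) p)
    (λ γ γ≤d → K.trans (K.sym (PFun-ext p (pt-∷ʳ0 c γ)))
      (v (γ ∷ʳ 0) (≡.subst (_≤ d) (≡.sym (≡.trans (sum-∷ʳ γ 0) (ℕ.+-identityʳ _))) γ≤d)))

  quotient≋0 : ∀ {Q} d → PFun< d Q → (∀ γ → ∣ γ ∣ ≤ d → F (pt c γ) ≋ 0F) →
    (∀ z → F z ≋ (z (fromℕ m) ⊕ ⊝ a) ⊗ Q z) → ∀ z → Q z ≋ 0F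
  quotient≋0 zero    q v F≋ z = q z
  -- `Q` vanishes at the rotated points, so `Q ∘ unrotate` vanishes at all points of size at most e.
  -- The induction on the degree applies to the latter, and its value at `rotate-point z` is `Q z`.
  quotient≋0 (suc e) q v F≋ z = K.trans (K.sym (PFun-ext q (unrotate-rotate z)))
    (vanishing (suc m) e c
      (PFun-comp (snoc-PFun (coord ∘ suc) (add (coord zero) (const (⊝ 1F)))) q)
      (λ γ γ≤e → K.trans (K.sym (PFun-ext q (pt-rotate c γ)))
        (⊗-cancel (off-hyperplane c γ) (K.trans (K.sym (F≋ (pt c (rotate γ))))
          (v (rotate γ) (≡.subst (_≤ suc e) (≡.sym (∣rotate∣ γ)) (s≤s γ≤e))))))
      (rotate-point z))

  conclude : ∃[ Q ] PFun< d Q × (∀ z → F z ≋ F (snoc (z ∘ inject₁) a) ⊕ (z (fromℕ m) ⊕ ⊝ a) ⊗ Q z) → ∀ z → F z ≋ 0F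
  conclude (Q , Q< , F≋) z =
    K.trans (F≋LQ z) (K.trans (K.*-congˡ (quotient≋0 d Q< v F≋LQ z)) (K.zeroʳ _))
    where
    F≋LQ : ∀ z → F z ≋ (z (fromℕ m) ⊕ ⊝ a) ⊗ Q z
    F≋LQ z = K.trans (F≋ z) (K.trans (K.+-congʳ (on-hyperplane (z ∘ inject₁))) (K.+-identityˡ _))

-- Coefficients and values of polynomials

pow : 𝔽 → ℕ → 𝔽
pow x zero    = 1F
pow x (suc k) = x ⊗ pow x k

mono : Pt n → Comp n → 𝔽
mono z []      = 1F
mono z (k ∷ ν) = pow (z zero) k ⊗ mono (z ∘ suc) ν

-- One functional for both readings of a list of terms: `mono z` in place of φ gives the value at z,
-- `ind μ` gives the coefficient at μ.
lin : (Comp n → 𝔽) → Poly n → 𝔽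
lin φ []            = 0F
lin φ ((c , ν) ∷ p) = c ⊗ φ ν ⊕ lin φ p

ev : Pt n → Poly n → 𝔽
ev z = lin (mono z)

ind : Comp n → Comp n → 𝔽
ind []      []      = 1F
ind (k ∷ μ) (l ∷ ν) = if k ≡ᵇ l then ind μ ν else 0F

ind-refl : (μ : Comp n) → ind μ μ ≡ 1F
ind-refl []      = refl
ind-refl (k ∷ μ) rewrite ≡ᵇ-true k = ind-refl μ

ind-≢ : (μ ν : Comp n) → μ ≢ ν → ind μ ν ≡ 0F
ind-≢ []      []      p = ⊥-elim (p refl)
ind-≢ (k ∷ μ) (l ∷ ν) p with k ℕ.≟ l
... | no k≢l   rewrite ≡ᵇ-false k≢l = refl
... | yes refl rewrite ≡ᵇ-true k = ind-≢ μ ν (p ∘ cong (k ∷_))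

opaque
  unfolding _⊕_

  +F≡⊕ : ∀ x y → x +F y ≡ x ⊕ y
  +F≡⊕ x y = refl

  *F≡⊗ : ∀ x y → x *F y ≡ x ⊗ y
  *F≡⊗ x y = refl

  -F≡⊝ : ∀ x → -F x ≡ ⊝ x
  -F≡⊝ x = refl

powF≡pow : ∀ x k → powF x k ≡ pow x k
powF≡pow x zero    = refl
powF≡pow x (suc k) = ≡.trans (*F≡⊗ x (powF x k)) (cong (x ⊗_) (powF≡pow x k))

-- `eval` looks exponents up in the full vector, whereas `mono` recurses on it. Generalising the
-- identity to an index map f allows the induction to move along the vector; `ev-power-product` has
-- the same form.
prodF-tabulate : ∀ {k} (z : Pt n) (ν : Comp n) (f : Fin k → Fin n) (ν′ : Comp k) → (∀ i → lookup ν (f i) ≡ lookup ν′ i) →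
  prodF (L.map (λ j → powF (z j) (lookup ν j)) (L.tabulate f)) ≡ mono (z ∘ f) ν′
prodF-tabulate z ν f []       e = refl
prodF-tabulate z ν f (l ∷ ν′) e = ≡.trans
  (*F≡⊗ (powF (z (f zero)) (lookup ν (f zero))) (prodF (L.map (λ j → powF (z j) (lookup ν j)) (L.tabulate (f ∘ suc)))))
  (cong₂ _⊗_
    (≡.trans (powF≡pow (z (f zero)) (lookup ν (f zero))) (cong (pow (z (f zero))) (e zero)))
    (prodF-tabulate z ν (f ∘ suc) ν′ (e ∘ suc)))

eval≡ev : ∀ (z : Pt n) p → eval z p ≡ ev z p
eval≡ev z []            = refl
eval≡ev {n} z ((c , ν) ∷ p) = ≡.trans (+F≡⊕ (c *F monomial) (eval z p)) (cong₂ _⊕_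
  (≡.trans (*F≡⊗ c monomial) (cong (c ⊗_) (prodF-tabulate z ν (λ j → j) ν (λ _ → refl)))) (eval≡ev z p))
  where
  monomial : 𝔽
  monomial = prodF (L.map (λ j → powF (z j) (lookup ν j)) (allFin n))

coeff≋lin : ∀ (p : Poly n) μ → coeff p μ ≋ lin (ind μ) p
coeff≋lin []            μ = K.refl
coeff≋lin ((c , ν) ∷ p) μ with V.≡-dec ℕ._≟_ ν μ
... | yes refl = begin
  c +F coeff p ν             ≡⟨ +F≡⊕ c (coeff p ν) ⟩
  c ⊕ coeff p ν              ≈⟨ K.+-cong (K.sym (K.*-identityʳ c)) (coeff≋lin p ν) ⟩
  c ⊗ 1F ⊕ lin (ind ν) p     ≡⟨ cong (λ i → c ⊗ i ⊕ lin (ind ν) p) (ind-refl ν) ⟨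
  c ⊗ ind ν ν ⊕ lin (ind ν) p ∎
... | no ν≢μ = begin
  coeff p μ                  ≈⟨ coeff≋lin p μ ⟩
  lin (ind μ) p              ≈⟨ solve 2 (λ c x → x := c :* con (+ 0) :+ x) K.refl c (lin (ind μ) p) ⟩
  c ⊗ 0F ⊕ lin (ind μ) p     ≡⟨ cong (λ i → c ⊗ i ⊕ lin (ind μ) p) (ind-≢ μ ν (ν≢μ ∘ ≡.sym)) ⟨
  c ⊗ ind μ ν ⊕ lin (ind μ) p ∎

lin-scaleP : ∀ φ c (p : Poly n) → lin φ (scaleP c p) ≋ c ⊗ lin φ p
lin-scaleP φ c []            = K.sym (K.zeroʳ c)
lin-scaleP φ c ((b , ν) ∷ p) = begin
  (c *F b) ⊗ φ ν ⊕ lin φ (scaleP c p)  ≡⟨ cong (λ x → x ⊗ φ ν ⊕ lin φ (scaleP c p)) (*F≡⊗ c b) ⟩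
  (c ⊗ b) ⊗ φ ν ⊕ lin φ (scaleP c p)   ≈⟨ K.+-congˡ (lin-scaleP φ c p) ⟩
  (c ⊗ b) ⊗ φ ν ⊕ c ⊗ lin φ p          ≈⟨ solve 4 (λ c b x y → c :* b :* x :+ c :* y := c :* (b :* x :+ y)) K.refl c b (φ ν) (lin φ p) ⟩
  c ⊗ (b ⊗ φ ν ⊕ lin φ p)              ∎

lin-ext : ∀ {φ ψ : Comp n → 𝔽} → (∀ ν → φ ν ≋ ψ ν) → ∀ p → lin φ p ≋ lin ψ p
lin-ext e []            = K.refl
lin-ext e ((c , ν) ∷ p) = K.+-cong (K.*-congˡ (e ν)) (lin-ext e p)

lin-++ : ∀ φ (p q : Poly n) → lin φ (p ++ q) ≋ lin φ p ⊕ lin φ q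
lin-++ φ []            q = K.sym (K.+-identityˡ _)
lin-++ φ ((c , ν) ∷ p) q = K.trans (K.+-congˡ (lin-++ φ p q)) (K.sym (K.+-assoc _ _ _))

remove : Comp n → Poly n → Poly n
remove ν [] = []
remove ν ((c , μ) ∷ p) = if does (V.≡-dec ℕ._≟_ μ ν) then remove ν p else (c , μ) ∷ remove ν p

length-remove : ∀ (ν : Comp n) p → length (remove ν p) ≤ length p
length-remove ν [] = z≤n
length-remove ν ((c , μ) ∷ p) with does (V.≡-dec ℕ._≟_ μ ν)
... | true  = ℕ.m≤n⇒m≤1+n (length-remove ν p)
... | false = s≤s (length-remove ν p)

lin-remove : ∀ φ (ν : Comp n) p → lin φ p ≋ lin (ind ν) p ⊗ φ ν ⊕ lin φ (remove ν p)
lin-remove φ ν [] = solve 1 (λ x → con (+ 0) := con (+ 0) :* x :+ con (+ 0)) K.refl (φ ν)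
lin-remove φ ν ((c , μ) ∷ p) with V.≡-dec ℕ._≟_ μ ν
... | yes refl = begin
  c ⊗ φ μ ⊕ lin φ p
    ≈⟨ K.+-congˡ (lin-remove φ μ p) ⟩
  c ⊗ φ μ ⊕ (lin (ind μ) p ⊗ φ μ ⊕ lin φ (remove μ p))
    ≈⟨ solve 4 (λ c x y z → c :* x :+ (y :* x :+ z) := (c :* con (+ 1) :+ y) :* x :+ z) K.refl c (φ μ) (lin (ind μ) p) _ ⟩
  (c ⊗ 1F ⊕ lin (ind μ) p) ⊗ φ μ ⊕ lin φ (remove μ p)
    ≡⟨ cong (λ i → (c ⊗ i ⊕ lin (ind μ) p) ⊗ φ μ ⊕ lin φ (remove μ p)) (ind-refl μ) ⟨
  (c ⊗ ind μ μ ⊕ lin (ind μ) p) ⊗ φ μ ⊕ lin φ (remove μ p) ∎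
... | no μ≢ν = begin
  c ⊗ φ μ ⊕ lin φ p
    ≈⟨ K.+-congˡ (lin-remove φ ν p) ⟩
  c ⊗ φ μ ⊕ (lin (ind ν) p ⊗ φ ν ⊕ lin φ (remove ν p))
    ≈⟨ solve 5 (λ c x y z w → c :* x :+ (y :* w :+ z) := (c :* con (+ 0) :+ y) :* w :+ (c :* x :+ z)) K.refl
         c (φ μ) (lin (ind ν) p) (lin φ (remove ν p)) (φ ν) ⟩
  (c ⊗ 0F ⊕ lin (ind ν) p) ⊗ φ ν ⊕ (c ⊗ φ μ ⊕ lin φ (remove ν p))
    ≡⟨ cong (λ i → (c ⊗ i ⊕ lin (ind ν) p) ⊗ φ ν ⊕ (c ⊗ φ μ ⊕ lin φ (remove ν p))) (ind-≢ ν μ (μ≢ν ∘ ≡.sym)) ⟨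
  (c ⊗ ind ν μ ⊕ lin (ind ν) p) ⊗ φ ν ⊕ (c ⊗ φ μ ⊕ lin φ (remove ν p)) ∎

-- Terms may cancel only in total, so recursion on the tail fails. Instead all terms with the
-- exponent of the head are removed at once: their coefficients add up to zero, and the list becomes
-- shorter. The bound k on the length serves as the measure.
lin-zero : ∀ φ (p : Poly n) → (∀ μ → lin (ind μ) p ≋ 0F) → lin φ p ≋ 0F
lin-zero {n} φ p = go φ (length p) p ℕ.≤-refl
  where
  go : ∀ φ k (p : Poly n) → length p ≤ k → (∀ μ → lin (ind μ) p ≋ 0F) → lin φ p ≋ 0F
  go φ k [] _ _ = K.refl
  go φ (suc k) p@((c , ν) ∷ q) (s≤s l) z = begin
    lin φ p
      ≈⟨ expand φ ⟩
    lin φ (remove ν q)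
      ≈⟨ go φ k (remove ν q) (ℕ.≤-trans (length-remove ν q) l) (λ μ → K.trans (K.sym (expand (ind μ))) (z μ)) ⟩
    0F ∎
    where
    remove-head : ∀ φ → lin φ (remove ν p) ≋ lin φ (remove ν q)
    remove-head φ with V.≡-dec ℕ._≟_ ν ν
    ... | yes _  = K.refl
    ... | no ν≢ν = ⊥-elim (ν≢ν refl)
    expand : ∀ φ → lin φ p ≋ lin φ (remove ν q)
    expand φ = begin
      lin φ p                                        ≈⟨ lin-remove φ ν p ⟩
      lin (ind ν) p ⊗ φ ν ⊕ lin φ (remove ν p)       ≈⟨ K.+-cong (K.*-congʳ (z ν)) (remove-head φ) ⟩
      0F ⊗ φ ν ⊕ lin φ (remove ν q)                  ≈⟨ solve 2 (λ x y → con (+ 0) :* x :+ y := y) K.refl (φ ν) _ ⟩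
      lin φ (remove ν q)                             ∎

lin-neg : ∀ φ (p q : Poly n) → lin φ (p ++ scaleP (⊝ 1F) q) ≋ lin φ p ⊕ ⊝ lin φ q
lin-neg φ p q = K.trans (lin-++ φ p _) (K.+-congˡ (K.trans (lin-scaleP φ (⊝ 1F) q)
  (solve 1 (λ x → (:- con (+ 1)) :* x := :- x) K.refl (lin φ q))))

lin-cong : ∀ φ (p q : Poly n) → (∀ μ → lin (ind μ) p ≋ lin (ind μ) q) → lin φ p ≋ lin φ q
lin-cong φ p q e = difference≋0 (K.trans (K.sym (lin-neg φ p q)) (lin-zero φ (p ++ scaleP (⊝ 1F) q) (λ μ →
  K.trans (lin-neg (ind μ) p q) (K.trans (K.+-congʳ (e μ)) (K.-‿inverseʳ _)))))

-- Polynomials over an infinite field are determined by their values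

slice₀ : Poly (suc n) → Poly n
slice₀ []                    = []
slice₀ ((c , zero  ∷ ν) ∷ p) = (c , ν) ∷ slice₀ p
slice₀ ((c , suc k ∷ ν) ∷ p) = slice₀ p

down : Poly (suc n) → Poly (suc n)
down []                    = []
down ((c , zero  ∷ ν) ∷ p) = down p
down ((c , suc k ∷ ν) ∷ p) = (c , k ∷ ν) ∷ down p

increment : Comp (suc n) → Comp (suc n)
increment (k ∷ ν) = suc k ∷ ν

-- The decomposition p = p₀ + x₁p₁, with `slice₀` for p₀, free of x₁, and `down` for p₁. Iterating
-- it expands p in powers of the first variable.
lin-slice₀-down : ∀ φ (p : Poly (suc n)) → lin φ p ≋ lin (φ ∘ (0 ∷_)) (slice₀ p) ⊕ lin (φ ∘ increment) (down p)
lin-slice₀-down φ []                    = K.sym (K.+-identityʳ 0F)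
lin-slice₀-down φ ((c , zero  ∷ ν) ∷ p) = K.trans (K.+-congˡ (lin-slice₀-down φ p)) (K.sym (K.+-assoc _ _ _))
lin-slice₀-down φ ((c , suc k ∷ ν) ∷ p) = K.trans (K.+-congˡ (lin-slice₀-down φ p))
  (solve 3 (λ x y z → x :+ (y :+ z) := y :+ (x :+ z)) K.refl (c ⊗ φ (suc k ∷ ν)) _ _)

lin-0 : ∀ (p : Poly n) → lin (λ _ → 0F) p ≋ 0F
lin-0 []            = K.refl
lin-0 ((c , ν) ∷ p) = K.trans (K.+-cong (K.zeroʳ c) (lin-0 p)) (K.+-identityʳ 0F)

lin-⊗ : ∀ x φ (p : Poly n) → lin (λ ν → x ⊗ φ ν) p ≋ x ⊗ lin φ p
lin-⊗ x φ []            = K.sym (K.zeroʳ x)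
lin-⊗ x φ ((c , ν) ∷ p) = K.trans (K.+-congˡ (lin-⊗ x φ p))
  (solve 4 (λ c x y z → c :* (x :* y) :+ x :* z := x :* (c :* y :+ z)) K.refl c x (φ ν) _)

horner : List 𝔽 → 𝔽 → 𝔽
horner []       x = 0F
horner (a ∷ as) x = a ⊕ x ⊗ horner as x

-- The quotient of a + x h(x) by x - b does not depend on a; here h is given by the list.
synthetic : 𝔽 → List 𝔽 → List 𝔽
synthetic b []       = []
synthetic b (a ∷ as) = horner (a ∷ as) b ∷ synthetic b as

length-synthetic : ∀ b as → length (synthetic b as) ≡ length as
length-synthetic b []       = refl
length-synthetic b (a ∷ as) = cong suc (length-synthetic b as)

horner-synthetic : ∀ b as x → x ⊗ horner as x ≋ b ⊗ horner as b ⊕ (x ⊕ ⊝ b) ⊗ horner (synthetic b as) x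
horner-synthetic b [] x = solve 2 (λ x b → x :* con (+ 0) := b :* con (+ 0) :+ (x :- b) :* con (+ 0)) K.refl x b
horner-synthetic b (a ∷ as) x = begin
  x ⊗ (a ⊕ x ⊗ horner as x)
    ≈⟨ K.*-congˡ (K.+-congˡ (horner-synthetic b as x)) ⟩
  x ⊗ (a ⊕ (b ⊗ horner as b ⊕ (x ⊕ ⊝ b) ⊗ horner (synthetic b as) x))
    ≈⟨ solve 5 (λ x a b h s → x :* (a :+ (b :* h :+ (x :- b) :* s)) :=
         b :* (a :+ b :* h) :+ (x :- b) :* ((a :+ b :* h) :+ x :* s)) K.refl x a b (horner as b) (horner (synthetic b as) x) ⟩
  b ⊗ (a ⊕ b ⊗ horner as b) ⊕ (x ⊕ ⊝ b) ⊗ (horner (a ∷ as) b ⊕ x ⊗ horner (synthetic b as) x) ∎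

-- The passage to the quotient is unitriangular: each of its coefficients is `a` plus a multiple of
-- the next Horner value, which vanishes by induction.
synthetic-zero : ∀ b as → All (_≋ 0F) (synthetic b as) → All (_≋ 0F) as × horner as b ≋ 0F
synthetic-zero b []       []       = [] , K.refl
synthetic-zero b (a ∷ as) (z ∷ zs) with synthetic-zero b as zs
... | as≋0 , h≋0 = (a≋0 ∷ as≋0) , z
  where
  a≋0 : a ≋ 0F
  a≋0 = begin
    a                       ≈⟨ solve 2 (λ a b → a := a :+ b :* con (+ 0)) K.refl a b ⟩
    a ⊕ b ⊗ 0F              ≈⟨ K.+-congˡ (K.*-congˡ h≋0) ⟨
    a ⊕ b ⊗ horner as b     ≈⟨ z ⟩
    0F                      ∎

-- The root N is split off. The quotient vanishes at all larger naturals, because naturals stay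
-- distinct in 𝔽, and it is one coefficient shorter. The length is a separate argument since the
-- quotient is not a sublist.
horner-zero : ∀ l N as → length as ≡ l → (∀ k → N ≤ k → horner as (nat k) ≋ 0F) → All (_≋ 0F) as
horner-zero l       N []       _ _ = []
horner-zero (suc l) N (a ∷ as) e v = a≋0 ∷ as≋0
  where
  b : 𝔽
  b = nat N
  quotient-zero : ∀ k → suc N ≤ k → horner (synthetic b as) (nat k) ≋ 0F
  quotient-zero k N<k = ⊗-cancel {nat k ⊕ ⊝ b}
    (λ e → ℕ.<⇒≢ N<k (≡.sym (nat-injective {k} {N} (difference≋0 e)))) (begin
    (x ⊕ ⊝ b) ⊗ q
      ≈⟨ solve 3 (λ a h s → s := (a :+ (h :+ s)) :- (a :+ h)) K.refl a (b ⊗ horner as b) ((x ⊕ ⊝ b) ⊗ q) ⟩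
    (a ⊕ (b ⊗ horner as b ⊕ (x ⊕ ⊝ b) ⊗ q)) ⊕ ⊝ (a ⊕ b ⊗ horner as b)
      ≈⟨ K.+-cong (K.+-congˡ (K.sym (horner-synthetic b as x))) (K.-‿cong (v N ℕ.≤-refl)) ⟩
    (a ⊕ x ⊗ horner as x) ⊕ ⊝ 0F
      ≈⟨ K.+-congʳ (v k (ℕ.<⇒≤ N<k)) ⟩
    0F ⊕ ⊝ 0F
      ≈⟨ K.-‿inverseʳ 0F ⟩
    0F ∎)
    where
    x q : 𝔽
    x = nat k
    q = horner (synthetic b as) x
  zeros : All (_≋ 0F) as × horner as b ≋ 0F
  zeros = synthetic-zero b as (horner-zero l (suc N) (synthetic b as) (≡.trans (length-synthetic b as) (ℕ.suc-injective e)) quotient-zero)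
  as≋0 : All (_≋ 0F) as
  as≋0 = proj₁ zeros
  a≋0 : a ≋ 0F
  a≋0 = begin
    a                     ≈⟨ solve 2 (λ a b → a := a :+ b :* con (+ 0)) K.refl a b ⟩
    a ⊕ b ⊗ 0F            ≈⟨ K.+-congˡ (K.*-congˡ (proj₂ zeros)) ⟨
    a ⊕ b ⊗ horner as b   ≈⟨ v N ℕ.≤-refl ⟩
    0F                    ∎

slices : ℕ → Poly (suc n) → Pt n → List 𝔽
slices zero    p z = []
slices (suc k) p z = ev z (slice₀ p) ∷ slices k (down p) z

HeadBelow : ℕ → Poly (suc n) → Set
HeadBelow k = All (λ t → head (proj₂ t) < k)

HeadBelow-down : ∀ {k} (p : Poly (suc n)) → HeadBelow (suc k) p → HeadBelow k (down p)
HeadBelow-down []                    []             = []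
HeadBelow-down ((c , zero  ∷ ν) ∷ p) (_ ∷ bs)       = HeadBelow-down p bs
HeadBelow-down ((c , suc l ∷ ν) ∷ p) (s≤s b ∷ bs)   = b ∷ HeadBelow-down p bs

head-bound : (p : Poly (suc n)) → ∃[ k ] HeadBelow k p
head-bound []            = 0 , []
head-bound ((c , ν) ∷ p) with head-bound p
... | k , b = suc (head ν) ℕ.⊔ k , ℕ.m≤m⊔n (suc (head ν)) k ∷ All.map (λ l → ℕ.≤-trans l (ℕ.m≤n⊔m (suc (head ν)) k)) b

cons : 𝔽 → Pt n → Pt (suc n)
cons x z zero    = x
cons x z (suc j) = z j

horner-slices : ∀ k (p : Poly (suc n)) x z → HeadBelow k p → horner (slices k p z) x ≋ ev (cons x z) p
horner-slices zero    []      x z b = K.refl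
horner-slices zero    (t ∷ p) x z (() ∷ _)
horner-slices (suc k) p       x z b = begin
  ev z (slice₀ p) ⊕ x ⊗ horner (slices k (down p) z) x
    ≈⟨ K.+-congˡ (K.*-congˡ (horner-slices k (down p) x z (HeadBelow-down p b))) ⟩
  ev z (slice₀ p) ⊕ x ⊗ ev (cons x z) (down p)
    ≈⟨ K.+-cong (lin-ext (λ ν → K.sym (K.*-identityˡ _)) (slice₀ p)) (K.sym (lin-⊗ x (mono (cons x z)) (down p))) ⟩
  lin (mono (cons x z) ∘ (0 ∷_)) (slice₀ p) ⊕ lin (λ ν → x ⊗ mono (cons x z) ν) (down p)
    ≈⟨ K.+-congˡ (lin-ext (λ { (l ∷ ν) → K.sym (K.*-assoc x _ _) }) (down p)) ⟩
  lin (mono (cons x z) ∘ (0 ∷_)) (slice₀ p) ⊕ lin (mono (cons x z) ∘ increment) (down p)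
    ≈⟨ lin-slice₀-down (mono (cons x z)) p ⟨
  ev (cons x z) p ∎

-- With the other variables fixed, the polynomial in x₁ vanishes at every natural number, so all its
-- coefficients vanish. These are values of polynomials in fewer variables, at arbitrary points.
ev-zero⇒coeff-zero : ∀ (p : Poly n) → (∀ z → ev z p ≋ 0F) → ∀ μ → lin (ind μ) p ≋ 0F
ev-zero⇒coeff-zero {zero}  p v [] = K.trans (lin-ext (λ { [] → K.refl }) p) (v (λ ()))
ev-zero⇒coeff-zero {suc n} p v (k ∷ μ) with head-bound p
... | b , below = go b p below
    (λ z → horner-zero _ 0 (slices b p z) refl (λ l _ → K.trans (horner-slices b p (nat l) z below) (v _))) k
  where
  go : ∀ b p → HeadBelow b p → (∀ z → All (_≋ 0F) (slices b p z)) → ∀ k → lin (ind (k ∷ μ)) p ≋ 0F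
  go zero    []      _        s k = K.refl
  go zero    (t ∷ p) (() ∷ _) s k
  go (suc b) p       below    s zero = begin
    lin (ind (0 ∷ μ)) p
      ≈⟨ lin-slice₀-down (ind (0 ∷ μ)) p ⟩
    lin (ind μ) (slice₀ p) ⊕ lin (ind (0 ∷ μ) ∘ increment) (down p)
      ≈⟨ K.+-cong (ev-zero⇒coeff-zero (slice₀ p) (All.head ∘ s) μ) (lin-ext (λ { (l ∷ ν) → K.refl }) (down p)) ⟩
    0F ⊕ lin (λ _ → 0F) (down p)
      ≈⟨ K.trans (K.+-identityˡ _) (lin-0 (down p)) ⟩
    0F ∎
  go (suc b) p       below    s (suc k) = begin
    lin (ind (suc k ∷ μ)) p
      ≈⟨ lin-slice₀-down (ind (suc k ∷ μ)) p ⟩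
    lin (λ _ → 0F) (slice₀ p) ⊕ lin (ind (suc k ∷ μ) ∘ increment) (down p)
      ≈⟨ K.+-cong (lin-0 (slice₀ p)) (lin-ext (λ { (l ∷ ν) → K.refl }) (down p)) ⟩
    0F ⊕ lin (ind (k ∷ μ)) (down p)
      ≈⟨ K.+-identityˡ _ ⟩
    lin (ind (k ∷ μ)) (down p)
      ≈⟨ go b (down p) (HeadBelow-down p below) (All.tail ∘ s) k ⟩
    0F ∎

ev⇒coeff : ∀ (p q : Poly n) → (∀ z → ev z p ≋ ev z q) → ∀ μ → lin (ind μ) p ≋ lin (ind μ) q
ev⇒coeff p q e μ = difference≋0 (K.trans (K.sym (lin-neg (ind μ) p q)) (ev-zero⇒coeff-zero (p ++ scaleP (⊝ 1F) q)
  (λ z → K.trans (lin-neg (mono z) p q) (K.trans (K.+-congʳ (e z)) (K.-‿inverseʳ _))) μ))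

≈P⇒coeff : ∀ (p q : Poly n) → p ≈P q → ∀ μ → lin (ind μ) p ≋ lin (ind μ) q
≈P⇒coeff p q e μ = K.trans (K.sym (coeff≋lin p μ)) (K.trans ⟪ e μ ⟫ (coeff≋lin q μ))

≈P⇒ev : ∀ (p q : Poly n) → p ≈P q → ∀ z → ev z p ≋ ev z q
≈P⇒ev p q e z = lin-cong (mono z) p q (≈P⇒coeff p q e)

ev⇒≈P : ∀ (p q : Poly n) → (∀ z → ev z p ≋ ev z q) → p ≈P q
ev⇒≈P p q e μ = equal (K.trans (coeff≋lin p μ) (K.trans (ev⇒coeff p q e μ) (K.sym (coeff≋lin q μ))))

pow-+ : ∀ x k l → pow x (k + l) ≋ pow x k ⊗ pow x l
pow-+ x zero    l = K.sym (K.*-identityˡ _)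
pow-+ x (suc k) l = K.trans (K.*-congˡ (pow-+ x k l)) (K.sym (K.*-assoc x _ _))

mono-zipWith : ∀ (z : Pt n) ν μ → mono z (V.zipWith _+_ ν μ) ≋ mono z ν ⊗ mono z μ
mono-zipWith z []      []      = K.sym (K.*-identityˡ 1F)
mono-zipWith z (k ∷ ν) (l ∷ μ) = K.trans (K.*-cong (pow-+ (z zero) k l) (mono-zipWith (z ∘ suc) ν μ))
  (solve 4 (λ a b c d → a :* b :* (c :* d) := a :* c :* (b :* d)) K.refl
    (pow (z zero) k) (pow (z zero) l) (mono (z ∘ suc) ν) (mono (z ∘ suc) μ))

mono-0 : ∀ (z : Pt n) → mono z (V.replicate n 0) ≋ 1F
mono-0 {zero}  z = K.refl
mono-0 {suc n} z = K.trans (K.*-identityˡ _) (mono-0 (z ∘ suc))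

mono-unit : ∀ (z : Pt n) i → mono z (V.replicate n 0 [ i ]≔ 1) ≋ z i
mono-unit {suc n} z zero    = K.trans (K.*-cong (K.*-identityʳ _) (mono-0 (z ∘ suc))) (K.*-identityʳ _)
mono-unit {suc n} z (suc i) = K.trans (K.*-identityˡ _) (mono-unit (z ∘ suc) i)

ev-++ : ∀ (z : Pt n) p q → ev z (p ++ q) ≋ ev z p ⊕ ev z q
ev-++ z = lin-++ (mono z)

ev-scaleP : ∀ (z : Pt n) c p → ev z (scaleP c p) ≋ c ⊗ ev z p
ev-scaleP z = lin-scaleP (mono z)

monomial : Comp n → Poly n
monomial ν = (1F , ν) ∷ []

ev-monomial : ∀ (z : Pt n) ν → ev z (monomial ν) ≋ mono z ν
ev-monomial z ν = solve 1 (λ x → con (+ 1) :* x :+ con (+ 0) := x) K.refl (mono z ν)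

ev-oneP : ∀ (z : Pt n) → ev z oneP ≋ 1F
ev-oneP {n} z = K.trans (ev-monomial z (V.replicate n 0)) (mono-0 z)

ev-var : ∀ (z : Pt n) i → ev z (var i) ≋ z i
ev-var {n} z i = K.trans (ev-monomial z (V.replicate n 0 [ i ]≔ 1)) (mono-unit z i)

ev-term-product : ∀ (z : Pt n) b ν q →
  ev z (L.map (λ t → (b *F proj₁ t , V.zipWith _+_ ν (proj₂ t))) q) ≋ b ⊗ mono z ν ⊗ ev z q
ev-term-product z b ν []            = K.sym (K.zeroʳ _)
ev-term-product z b ν ((c , μ) ∷ q) = begin
  (b *F c) ⊗ mono z (V.zipWith _+_ ν μ) ⊕ ev z (L.map (λ t → (b *F proj₁ t , V.zipWith _+_ ν (proj₂ t))) q)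
    ≈⟨ K.+-cong (K.*-cong (K.reflexive (*F≡⊗ b c)) (mono-zipWith z ν μ)) (ev-term-product z b ν q) ⟩
  (b ⊗ c) ⊗ (mono z ν ⊗ mono z μ) ⊕ b ⊗ mono z ν ⊗ ev z q
    ≈⟨ solve 5 (λ b c x y e → b :* c :* (x :* y) :+ b :* x :* e := b :* x :* (c :* y :+ e)) K.refl b c (mono z ν) (mono z μ) (ev z q) ⟩
  b ⊗ mono z ν ⊗ (c ⊗ mono z μ ⊕ ev z q) ∎

ev-mulP : ∀ (z : Pt n) p q → ev z (mulP p q) ≋ ev z p ⊗ ev z q
ev-mulP z []            q = K.sym (K.zeroˡ _)
ev-mulP z ((b , ν) ∷ p) q = begin
  ev z (L.map (λ t → (b *F proj₁ t , V.zipWith _+_ ν (proj₂ t))) q ++ mulP p q)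
    ≈⟨ ev-++ z (L.map (λ t → (b *F proj₁ t , V.zipWith _+_ ν (proj₂ t))) q) (mulP p q) ⟩
  ev z (L.map (λ t → (b *F proj₁ t , V.zipWith _+_ ν (proj₂ t))) q) ⊕ ev z (mulP p q)
    ≈⟨ K.+-cong (ev-term-product z b ν q) (ev-mulP z p q) ⟩
  b ⊗ mono z ν ⊗ ev z q ⊕ ev z p ⊗ ev z q
    ≈⟨ K.distribʳ (ev z q) (b ⊗ mono z ν) (ev z p) ⟨
  (b ⊗ mono z ν ⊕ ev z p) ⊗ ev z q ∎

ev-powP : ∀ (z : Pt n) p k → ev z (powP p k) ≋ pow (ev z p) k
ev-powP z p zero    = ev-oneP z
ev-powP z p (suc k) = K.trans (ev-mulP z p (powP p k)) (K.*-congˡ (ev-powP z p k))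

ev-power-product : ∀ {k} (z : Pt n) (σ : Fin n → Poly n) (ν : Comp n) (f : Fin k → Fin n) (ν′ : Comp k) →
  (∀ i → lookup ν (f i) ≡ lookup ν′ i) →
  ev z (L.foldr (λ j acc → mulP (powP (σ j) (lookup ν j)) acc) oneP (L.tabulate f)) ≋ mono (λ i → ev z (σ (f i))) ν′
ev-power-product z σ ν f []       e = ev-oneP z
ev-power-product z σ ν f (l ∷ ν′) e = K.trans
  (ev-mulP z (powP (σ (f zero)) (lookup ν (f zero)))
    (L.foldr (λ j acc → mulP (powP (σ j) (lookup ν j)) acc) oneP (L.tabulate (f ∘ suc))))
  (K.*-cong (K.trans (ev-powP z (σ (f zero)) (lookup ν (f zero))) (K.reflexive (cong (pow (ev z (σ (f zero)))) (e zero))))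
    (ev-power-product z σ ν (f ∘ suc) ν′ (e ∘ suc)))

ev-subst : ∀ (z : Pt n) σ p → ev z (subst σ p) ≋ ev (λ j → ev z (σ j)) p
ev-subst z σ []                = K.refl
ev-subst {n} z σ ((c , ν) ∷ p) = begin
  ev z (scaleP c powers ++ subst σ p)
    ≈⟨ ev-++ z (scaleP c powers) (subst σ p) ⟩
  ev z (scaleP c powers) ⊕ ev z (subst σ p)
    ≈⟨ K.+-cong (K.trans (ev-scaleP z c powers) (K.*-congˡ (ev-power-product z σ ν (λ j → j) ν (λ _ → refl)))) (ev-subst z σ p) ⟩
  c ⊗ mono (λ j → ev z (σ j)) ν ⊕ ev (λ j → ev z (σ j)) p ∎
  where
  powers : Poly n
  powers = L.foldr (λ j acc → mulP (powP (σ j) (lookup ν j)) acc) oneP (allFin n)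

pow-PFun : ∀ (j : Fin n) k → PFun k (λ z → pow (z j) k)
pow-PFun j zero    = const 1F
pow-PFun j (suc k) = mul (coord j) (pow-PFun j k)

mono-PFun : ∀ (ν : Comp n) → PFun ∣ ν ∣ (λ z → mono z ν)
mono-PFun []      = const 1F
mono-PFun (k ∷ ν) = mul (pow-PFun zero k) (PFun-comp {T = λ j z → z (suc j)} (λ j → coord (suc j)) (mono-PFun ν))

ev-PFun : ∀ {d} (p : Poly n) → All (λ t → ∣ proj₂ t ∣ ≤ d) p → PFun d (λ z → ev z p)
ev-PFun {d = d} []  []       = const 0F
ev-PFun {d = d} ((c , ν) ∷ p) (l ∷ ls) =
  add (resp l (λ _ → K.refl) (mul {d = 0} (const c) (mono-PFun ν))) (ev-PFun p ls)

ev-PFun-some : ∀ (p : Poly n) → ∃[ d ] PFun d (λ z → ev z p)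
ev-PFun-some []            = 0 , const 0F
ev-PFun-some ((c , ν) ∷ p) with ev-PFun-some p
... | d , q = ∣ ν ∣ ℕ.⊔ d , add (resp (ℕ.m≤m⊔n ∣ ν ∣ d) (λ _ → K.refl) (mul {d = 0} (const c) (mono-PFun ν)))
                               (resp (ℕ.m≤n⊔m ∣ ν ∣ d) (λ _ → K.refl) q)

ev-ext : ∀ (p : Poly n) {z z′} → z ≗ₚ z′ → ev z p ≋ ev z′ p
ev-ext p = PFun-ext (proj₂ (ev-PFun-some p))

-- Degree bounds: coefficients against functions

keep : (Comp n → Bool) → Poly n → Poly n
keep P = L.filterᵇ (P ∘ proj₂)

lin-keep : ∀ φ P (p : Poly n) → lin φ p ≋ lin φ (keep P p) ⊕ lin φ (keep (not ∘ P) p)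
lin-keep φ P [] = K.sym (K.+-identityʳ 0F)
lin-keep φ P ((c , ν) ∷ p) with P ν
... | true  = K.trans (K.+-congˡ (lin-keep φ P p)) (K.sym (K.+-assoc _ _ _))
... | false = K.trans (K.+-congˡ (lin-keep φ P p)) (solve 3 (λ x y z → x :+ (y :+ z) := y :+ (x :+ z)) K.refl (c ⊗ φ ν) _ _)

coeff-keep : ∀ P (p : Poly n) μ → lin (ind μ) (keep P p) ≋ (if P μ then lin (ind μ) p else 0F)
coeff-keep P [] μ with P μ
... | true  = K.refl
... | false = K.refl
coeff-keep P ((c , ν) ∷ p) μ with V.≡-dec ℕ._≟_ μ ν
... | yes refl with P μ | coeff-keep P p μ
...   | true  | ih = K.+-congˡ ih
...   | false | ih = ih
coeff-keep P ((c , ν) ∷ p) μ | no μ≢ν rewrite ind-≢ μ ν μ≢ν = K.trans drop (K.trans (coeff-keep P p μ) (restore (P μ)))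
  where
  zero-term : ∀ x → c ⊗ 0F ⊕ x ≋ x
  zero-term x = solve 2 (λ c x → c :* con (+ 0) :+ x := x) K.refl c x
  restore : ∀ b → (if b then lin (ind μ) p else 0F) ≋ (if b then c ⊗ 0F ⊕ lin (ind μ) p else 0F)
  restore true  = K.sym (zero-term _)
  restore false = K.refl
  drop : lin (ind μ) (keep P ((c , ν) ∷ p)) ≋ lin (ind μ) (keep P p)
  drop with P ν
  ... | true rewrite ind-≢ μ ν μ≢ν = zero-term _
  ... | false = K.refl

keep-degree : ∀ d (p : Poly n) → All (λ t → ∣ proj₂ t ∣ ≤ d) (keep (λ ν → ∣ ν ∣ ≤ᵇ d) p)
keep-degree d [] = []
keep-degree d ((c , ν) ∷ p) with ∣ ν ∣ ≤ᵇ d in eq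
... | true  = ℕ.≤ᵇ⇒≤ ∣ ν ∣ d (≡.subst T (≡.sym eq) _) ∷ keep-degree d p
... | false = keep-degree d p

-- The list may still contain terms of high degree that cancel among themselves. Their total value
-- is zero by `lin-zero`, so the derivation is built from the low terms alone.
coeff⇒PFun< : ∀ d (p : Poly n) → (∀ μ → d ≤ ∣ μ ∣ → lin (ind μ) p ≋ 0F) → PFun< d (λ z → ev z p)
coeff⇒PFun< zero    p v = λ z → lin-zero (mono z) p (λ μ → v μ z≤n)
coeff⇒PFun< (suc d) p v = resp ℕ.≤-refl
  (λ z → K.sym (K.trans (lin-keep (mono z) (λ ν → ∣ ν ∣ ≤ᵇ d) p)
    (K.trans (K.+-congˡ (lin-zero (mono z) high (high≋0))) (K.+-identityʳ _))))
  (ev-PFun (keep (λ ν → ∣ ν ∣ ≤ᵇ d) p) (keep-degree d p))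
  where
  high : Poly _
  high = keep (λ ν → not (∣ ν ∣ ≤ᵇ d)) p
  high≋0 : ∀ μ → lin (ind μ) high ≋ 0F
  high≋0 μ with ∣ μ ∣ ≤ᵇ d in eq | coeff-keep (λ ν → not (∣ ν ∣ ≤ᵇ d)) p μ
  ... | true  | e = e
  ... | false | e = K.trans e (v μ (ℕ.≰⇒> (λ l → ≡.subst T eq (ℕ.≤⇒≤ᵇ l))))

sum-zipWith : ∀ (ν μ : Comp n) → ∣ V.zipWith _+_ ν μ ∣ ≡ ∣ ν ∣ + ∣ μ ∣
sum-zipWith []      []      = refl
sum-zipWith (k ∷ ν) (l ∷ μ) = ≡.trans (cong (_+_ (k + l)) (sum-zipWith ν μ))
  (≡.trans (ℕ.+-assoc k l _) (≡.trans (cong (_+_ k) (exchange l ∣ ν ∣ ∣ μ ∣)) (≡.sym (ℕ.+-assoc k _ _))))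

DegreeAtMost : ℕ → Poly n → Set
DegreeAtMost d = All (λ t → ∣ proj₂ t ∣ ≤ d)

mulP-degree : ∀ {d e} (p q : Poly n) → DegreeAtMost d p → DegreeAtMost e q → DegreeAtMost (d + e) (mulP p q)
mulP-degree []            q []       ms = []
mulP-degree ((b , ν) ∷ p) q (l ∷ ls) ms = All.++⁺
  (All.map⁺ (All.map (λ {t} m → ℕ.≤-trans (ℕ.≤-reflexive (sum-zipWith ν (proj₂ t))) (ℕ.+-mono-≤ l m)) ms))
  (mulP-degree p q ls ms)

sum-0 : ∀ n → ∣ V.replicate n 0 ∣ ≡ 0
sum-0 zero    = refl
sum-0 (suc n) = sum-0 n

sum-unit : ∀ (i : Fin n) → ∣ V.replicate n 0 [ i ]≔ 1 ∣ ≡ 1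
sum-unit {suc n} zero    = cong suc (sum-0 n)
sum-unit {suc n} (suc i) = sum-unit i

PFun⇒Poly : ∀ {d F} → PFun {n} d F → ∃[ p ] DegreeAtMost d p × (∀ z → ev z p ≋ F z)
PFun⇒Poly {n} (const c) = constP c , ℕ.≤-trans (ℕ.≤-reflexive (sum-0 n)) z≤n ∷ [] , λ z →
  K.trans (K.+-congʳ (K.*-congˡ (mono-0 z))) (solve 1 (λ c → c :* con (+ 1) :+ con (+ 0) := c) K.refl c)
PFun⇒Poly (coord j) = var j , ℕ.≤-trans (ℕ.≤-reflexive (sum-unit j)) (s≤s z≤n) ∷ [] , λ z → ev-var z j
PFun⇒Poly (add f g) with PFun⇒Poly f | PFun⇒Poly g
... | p , dp , ep | q , dq , eq = p ++ q , All.++⁺ dp dq , λ z → K.trans (ev-++ z p q) (K.+-cong (ep z) (eq z))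
PFun⇒Poly (mul f g) with PFun⇒Poly f | PFun⇒Poly g
... | p , dp , ep | q , dq , eq = mulP p q , mulP-degree p q dp dq , λ z → K.trans (ev-mulP z p q) (K.*-cong (ep z) (eq z))
PFun⇒Poly (resp l e f) with PFun⇒Poly f
... | p , dp , ep = p , All.map (λ m → ℕ.≤-trans m l) dp , λ z → K.trans (ep z) (e z)

degree⇒coeff : ∀ {d} (p : Poly n) → DegreeAtMost d p → ∀ μ → d < ∣ μ ∣ → lin (ind μ) p ≋ 0F
degree⇒coeff []            []       μ d<μ = K.refl
degree⇒coeff ((c , ν) ∷ p) (l ∷ ls) μ d<μ = begin
  c ⊗ ind μ ν ⊕ lin (ind μ) p
    ≈⟨ K.+-cong (K.*-congˡ (K.reflexive (ind-≢ μ ν (λ e → ℕ.<⇒≱ d<μ (≡.subst (λ μ → ∣ μ ∣ ≤ _) (≡.sym e) l))))) (degree⇒coeff p ls μ d<μ) ⟩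
  c ⊗ 0F ⊕ 0F
    ≈⟨ solve 1 (λ c → c :* con (+ 0) :+ con (+ 0) := con (+ 0)) K.refl c ⟩
  0F ∎

-- Coefficients depend only on the function, so they can be read from another list: the one compiled
-- from the derivation, in which every single term has low degree.
PFun<⇒coeff : ∀ d (p : Poly n) → PFun< d (λ z → ev z p) → ∀ μ → d ≤ ∣ μ ∣ → lin (ind μ) p ≋ 0F
PFun<⇒coeff zero    p f μ _   = ev-zero⇒coeff-zero p f μ
PFun<⇒coeff (suc d) p f μ d<μ with PFun⇒Poly f
... | q , dq , eq = K.trans (ev⇒coeff p q (K.sym ∘ eq) μ) (degree⇒coeff q dq μ d<μ)

Homogeneous : ℕ → Poly n → Set
Homogeneous d h = ∀ μ → ∣ μ ∣ ≢ d → lin (ind μ) h ≋ 0F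

homogeneous-zero : ∀ d (h : Poly n) → Homogeneous d h → PFun< d (λ z → ev z h) → ∀ z → ev z h ≋ 0F
homogeneous-zero d h hom f z = lin-zero (mono z) h λ μ → zero-coeff μ
  where
  zero-coeff : ∀ μ → lin (ind μ) h ≋ 0F
  zero-coeff μ with ∣ μ ∣ ℕ.≟ d
  ... | yes refl = PFun<⇒coeff d h f μ ℕ.≤-refl
  ... | no ≢d    = hom μ ≢d

-- The operators as functions

dense : ∀ {d e} {F G : Pt n → 𝔽} → PFun d F → PFun e G → (∀ γ → F (pt 0 γ) ≋ G (pt 0 γ)) → ∀ z → F z ≋ G z
dense {n} {d} {e} {F} {G} f g v z = difference≋0 (vanishing n (d ℕ.⊔ e) 0
  (add (resp (ℕ.m≤m⊔n d e) (λ _ → K.refl) f) (resp (ℕ.m≤n⊔m d e) (λ _ → K.refl) (neg g)))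
  (λ γ _ → K.trans (K.+-congʳ (v γ)) (K.-‿inverseʳ _)) z)
  where
  neg : ∀ {d F} → PFun {n} d F → PFun d (λ z → ⊝ F z)
  neg {F = F} f = resp ℕ.≤-refl (λ z → solve 1 (λ x → (:- con (+ 1)) :* x := :- x) K.refl (F z)) (mul {d = 0} (const (⊝ 1F)) f)

tied⇒δ : ∀ (i : Fin m) (γ : Comp (suc m)) → lookup γ (inject₁ i) ≡ lookup γ (suc i) → δ γ (inject₁ i) ≢ δ γ (suc i)
tied⇒δ i γ tie e = ℕ.1+n≢n (≡.trans (≡.sym (δ-tie i γ tie)) e)

-- Equal coordinates would force equal entries and equal values of δ, but δ differs by one on a tie.
pt-separated : ∀ (i : Fin m) γ → ¬ (pt 0 γ (inject₁ i) ⊕ ⊝ pt 0 γ (suc i) ≋ 0F)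
pt-separated i γ e = tied⇒δ i γ (proj₁ eqs) (ℕ.+-cancelʳ-≡ 0 _ _ (proj₂ eqs))
  where
  eqs : lookup γ (inject₁ i) ≡ lookup γ (suc i) × δ γ (inject₁ i) + 0 ≡ δ γ (suc i) + 0
  eqs = linear-injective (⊝-injective (difference≋0 e))

ev-swapImg : ∀ (i : Fin m) (z : Pt (suc m)) k → ev z (swapImg i k) ≋ z (transpose i k)
ev-swapImg i z k with k F.≟ inject₁ i | k F.≟ suc i
... | yes refl | _        = K.trans (ev-var z (suc i)) (K.reflexive (cong z (≡.sym (transpose-left i))))
... | no _     | yes refl = K.trans (ev-var z (inject₁ i)) (K.reflexive (cong z (≡.sym (transpose-right i))))
... | no k≢i   | no k≢j   = K.trans (ev-var z k) (K.reflexive (cong z (≡.sym (transpose-other i k k≢i k≢j))))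

ev-s : ∀ (i : Fin m) z f → ev z (s i f) ≋ ev (z ∘ transpose i) f
ev-s i z f = K.trans (ev-subst z (swapImg i) f) (ev-ext f (ev-swapImg i z))

rotate-point₀ : Pt (suc m) → Pt (suc m)
rotate-point₀ {m} z zero    = z (fromℕ m)
rotate-point₀ {m} z (suc k) = z (inject₁ k)

ev-Φ : ∀ (z : Pt (suc m)) f → ev z (Φ f) ≋ z (fromℕ m) ⊗ ev (rotate-point₀ z) f
ev-Φ {m} z f = K.trans (ev-mulP z (var (fromℕ m)) (subst ΦImg f))
  (K.*-cong (ev-var z (fromℕ m)) (K.trans (ev-subst z ΦImg f) (ev-ext f images)))
  where
  images : (λ j → ev z (ΦImg j)) ≗ₚ rotate-point₀ z
  images zero    = ev-var z (fromℕ m)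
  images (suc k) = ev-var z (inject₁ k)

ev-Φ⁺ : ∀ (z : Pt (suc m)) f → ev z (Φ⁺ f) ≋ z (fromℕ m) ⊗ ev (rotate-point z) f
ev-Φ⁺ {m} z f = K.trans (ev-mulP z (var (fromℕ m)) (subst Φ⁺Img f))
  (K.*-cong (ev-var z (fromℕ m)) (K.trans (ev-subst z Φ⁺Img f) (ev-ext f images)))
  where
  images : (λ j → ev z (Φ⁺Img j)) ≗ₚ rotate-point z
  images zero    = K.trans (ev-++ z (var (fromℕ m)) oneP) (K.+-cong (ev-var z (fromℕ m)) (ev-oneP z))
  images (suc k) = ev-var z (inject₁ k)

mono-swap : ∀ (i : Fin m) (z : Pt (suc m)) ν → mono z (swap i ν) ≋ mono (z ∘ transpose i) ν
mono-swap zero z (a ∷ b ∷ ν) = K.trans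
  (K.reflexive (cong (λ ν → pow (z zero) b ⊗ (pow (z (suc zero)) a ⊗ mono (λ k → z (suc (suc k))) ν)) (V.tabulate∘lookup ν)))
  (solve 3 (λ x y r → x :* (y :* r) := y :* (x :* r)) K.refl (pow (z zero) b) (pow (z (suc zero)) a) (mono (λ k → z (suc (suc k))) ν))
mono-swap (suc i) z (a ∷ ν) = K.*-congˡ (mono-swap i (z ∘ suc) ν)

mono-∷ʳ : ∀ (z : Pt (suc m)) ν k → mono z (ν ∷ʳ k) ≋ mono (z ∘ inject₁) ν ⊗ pow (z (fromℕ m)) k
mono-∷ʳ z []      k = K.*-comm (pow (z zero) k) 1F
mono-∷ʳ z (a ∷ ν) k = K.trans (K.*-congˡ (mono-∷ʳ (z ∘ suc) ν k)) (K.sym (K.*-assoc _ _ _))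

mono-rotate : ∀ (z : Pt (suc m)) ν → mono z (rotate ν) ≋ z (fromℕ m) ⊗ mono (rotate-point₀ z) ν
mono-rotate {m} z (a ∷ ν) = K.trans (mono-∷ʳ z ν (suc a))
  (solve 3 (λ p x r → r :* (x :* p) := x :* (p :* r)) K.refl (pow (z (fromℕ m)) a) (z (fromℕ m)) (mono (z ∘ inject₁) ν))

-- The monomials in a divided difference share one cofactor `rest`, free of xᵢ and xᵢ₊₁; this
-- reduces the computation of ∂ᵢ to two variables.
record PairFactor (i : Fin m) (z : Pt (suc m)) (ν : Comp (suc m)) : Set where
  field
    rest : 𝔽
    updated  : ∀ p q → mono z ((ν [ inject₁ i ]≔ p) [ suc i ]≔ q) ≋ pow (z (inject₁ i)) p ⊗ pow (z (suc i)) q ⊗ rest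
    original : mono z ν ≋ pow (z (inject₁ i)) (lookup ν (inject₁ i)) ⊗ pow (z (suc i)) (lookup ν (suc i)) ⊗ rest
    swapped  : mono (z ∘ transpose i) ν ≋ pow (z (inject₁ i)) (lookup ν (suc i)) ⊗ pow (z (suc i)) (lookup ν (inject₁ i)) ⊗ rest

pair-factor : ∀ (i : Fin m) z ν → PairFactor i z ν
pair-factor zero z (a ∷ b ∷ ν) = record
  { rest     = r
  ; updated  = λ p q → K.sym (K.*-assoc _ _ _)
  ; original = K.sym (K.*-assoc _ _ _)
  ; swapped  = solve 3 (λ x y r → y :* (x :* r) := x :* y :* r) K.refl (pow (z zero) b) (pow (z (suc zero)) a) r }
  where
  r : 𝔽
  r = mono (λ k → z (suc (suc k))) ν
pair-factor (suc i) z (a ∷ ν) = record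
  { rest     = c ⊗ rest
  ; updated  = λ p q → push (pow _ p) (pow _ q) (updated p q)
  ; original = push (pow _ (lookup ν (inject₁ i))) (pow _ (lookup ν (suc i))) original
  ; swapped  = push (pow _ (lookup ν (suc i))) (pow _ (lookup ν (inject₁ i))) swapped }
  where
  open PairFactor (pair-factor i (z ∘ suc) ν)
  c : 𝔽
  c = pow (z zero) a
  push : ∀ {e} u v → e ≋ u ⊗ v ⊗ rest → c ⊗ e ≋ u ⊗ v ⊗ (c ⊗ rest)
  push u v e = K.trans (K.*-congˡ e) (solve 4 (λ c u v r → c :* (u :* v :* r) := u :* v :* (c :* r)) K.refl c u v rest)

module _ (i : Fin m) (z : Pt (suc m)) (ν : Comp (suc m)) where
  private
    x y : 𝔽
    x = z (inject₁ i)
    y = z (suc i)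
    open PairFactor (pair-factor i z ν)

  -- (x - y) Σ_{k<D} x^{u+k} y^{t+D-1-k} = x^{u+D} y^t - x^u y^{t+D}
  telescope : ∀ c (e₁ e₂ : ℕ → ℕ) D u t → (∀ k → k < D → e₁ k ≡ u + k) → (∀ k → k < D → e₂ k ≡ t + (D ∸ 1 ∸ k)) →
    (x ⊕ ⊝ y) ⊗ ev z (L.applyUpTo (λ k → (c , (ν [ inject₁ i ]≔ e₁ k) [ suc i ]≔ e₂ k)) D)
      ≋ c ⊗ (pow x (u + D) ⊗ pow y t ⊕ ⊝ (pow x u ⊗ pow y (t + D))) ⊗ rest
  telescope c e₁ e₂ zero u t p q = begin
    (x ⊕ ⊝ y) ⊗ 0F
      ≈⟨ solve 4 (λ l c w r → l :* con (+ 0) := c :* (w :- w) :* r) K.refl (x ⊕ ⊝ y) c (pow x u ⊗ pow y t) rest ⟩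
    c ⊗ (pow x u ⊗ pow y t ⊕ ⊝ (pow x u ⊗ pow y t)) ⊗ rest
      ≡⟨ cong₂ (λ a b → c ⊗ (pow x a ⊗ pow y t ⊕ ⊝ (pow x u ⊗ pow y b)) ⊗ rest) (ℕ.+-identityʳ u) (ℕ.+-identityʳ t) ⟨
    c ⊗ (pow x (u + 0) ⊗ pow y t ⊕ ⊝ (pow x u ⊗ pow y (t + 0))) ⊗ rest ∎
  telescope c e₁ e₂ (suc D) u t p q = begin
    (x ⊕ ⊝ y) ⊗ (c ⊗ mono z ((ν [ inject₁ i ]≔ e₁ 0) [ suc i ]≔ e₂ 0) ⊕ sum)
      ≡⟨ cong₂ (λ a b → (x ⊕ ⊝ y) ⊗ (c ⊗ mono z ((ν [ inject₁ i ]≔ a) [ suc i ]≔ b) ⊕ sum))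
           (≡.trans (p 0 (s≤s z≤n)) (ℕ.+-identityʳ u)) (q 0 (s≤s z≤n)) ⟩
    (x ⊕ ⊝ y) ⊗ (c ⊗ mono z ((ν [ inject₁ i ]≔ u) [ suc i ]≔ (t + D)) ⊕ sum)
      ≈⟨ K.*-congˡ (K.+-congʳ (K.*-congˡ (updated u (t + D)))) ⟩
    (x ⊕ ⊝ y) ⊗ (c ⊗ (pow x u ⊗ pow y (t + D) ⊗ rest) ⊕ sum)
      ≈⟨ K.distribˡ _ _ _ ⟩
    (x ⊕ ⊝ y) ⊗ (c ⊗ (pow x u ⊗ pow y (t + D) ⊗ rest)) ⊕ (x ⊕ ⊝ y) ⊗ sum
      -- The tail of `applyUpTo` carries the shifted functions. This is why the exponents are
      -- arbitrary functions constrained by equations instead of fixed formulas.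
      ≈⟨ K.+-congˡ (telescope c (e₁ ∘ suc) (e₂ ∘ suc) D (suc u) t
           (λ k k<D → ≡.trans (p (suc k) (s≤s k<D)) (ℕ.+-suc u k))
           (λ k k<D → ≡.trans (q (suc k) (s≤s k<D)) (cong (_+_ t) (≡.sym (ℕ.∸-+-assoc D 1 k))))) ⟩
    (x ⊕ ⊝ y) ⊗ (c ⊗ (pow x u ⊗ pow y (t + D) ⊗ rest))
      ⊕ c ⊗ (x ⊗ pow x (u + D) ⊗ pow y t ⊕ ⊝ (x ⊗ pow x u ⊗ pow y (t + D))) ⊗ rest
      ≈⟨ solve 8 (λ x y c pu pt w pd r →
           (x :- y) :* (c :* (pu :* w :* r)) :+ c :* (x :* pd :* pt :- x :* pu :* w) :* r
             := c :* ((x :* pd) :* pt :- pu :* (y :* w)) :* r) K.refl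
           x y c (pow x u) (pow y t) (pow y (t + D)) (pow x (u + D)) rest ⟩
    c ⊗ (pow x (suc (u + D)) ⊗ pow y t ⊕ ⊝ (pow x u ⊗ pow y (suc (t + D)))) ⊗ rest
      ≡⟨ cong₂ (λ a b → c ⊗ (pow x a ⊗ pow y t ⊕ ⊝ (pow x u ⊗ pow y b)) ⊗ rest) (ℕ.+-suc u D) (ℕ.+-suc t D) ⟨
    c ⊗ (pow x (u + suc D) ⊗ pow y t ⊕ ⊝ (pow x u ⊗ pow y (t + suc D))) ⊗ rest ∎
    where
    sum : 𝔽
    sum = ev z (L.applyUpTo (λ k → (c , (ν [ inject₁ i ]≔ e₁ (suc k)) [ suc i ]≔ e₂ (suc k))) D)

  block : 𝔽 → ℕ → ℕ → Poly (suc m)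
  block c u w = L.applyUpTo (λ k → (c , (ν [ inject₁ i ]≔ (u + k)) [ suc i ]≔ (w ∸ 1 ∸ k))) (w ∸ u)

  ev-block : ∀ c u w → u ≤ w → (x ⊕ ⊝ y) ⊗ ev z (block c u w) ≋ c ⊗ (pow x w ⊗ pow y u ⊕ ⊝ (pow x u ⊗ pow y w)) ⊗ rest
  ev-block c u w u≤w = K.trans
    (telescope c (_+_ u) (λ k → w ∸ 1 ∸ k) (w ∸ u) u u (λ _ _ → refl) exponent)
    (K.reflexive (cong (λ a → c ⊗ (pow x a ⊗ pow y u ⊕ ⊝ (pow x u ⊗ pow y a)) ⊗ rest) (ℕ.m+[n∸m]≡n u≤w)))
    where
    exponent : ∀ k → k < w ∸ u → w ∸ 1 ∸ k ≡ u + (w ∸ u ∸ 1 ∸ k)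
    exponent k k<D = ≡.trans (ℕ.∸-+-assoc w 1 k)
      (≡.trans (cong (_∸ suc k) (≡.sym (ℕ.m+[n∸m]≡n u≤w)))
      (≡.trans (ℕ.+-∸-assoc u k<D)
        (cong (_+_ u) (≡.sym (ℕ.∸-+-assoc (w ∸ u) 1 k)))))

  -- The list that `∂` produces from a single term, restated here because the original is local to
  -- `∂`.
  ∂-term : 𝔽 → Poly (suc m)
  ∂-term c = if lookup ν (suc i) <ᵇ lookup ν (inject₁ i)
    then block (-F c) (lookup ν (suc i)) (lookup ν (inject₁ i))
    else block c (lookup ν (inject₁ i)) (lookup ν (suc i))

  ev-∂-term : ∀ c → (x ⊕ ⊝ y) ⊗ ev z (∂-term c) ≋ c ⊗ mono (z ∘ transpose i) ν ⊕ ⊝ (c ⊗ mono z ν)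
  ev-∂-term c with lookup ν (suc i) <ᵇ lookup ν (inject₁ i) in eq
  ... | true = begin
    (x ⊕ ⊝ y) ⊗ ev z (block (-F c) b a)
      ≈⟨ ev-block (-F c) b a (ℕ.<⇒≤ (ℕ.<ᵇ⇒< b a (≡.subst T (≡.sym eq) _))) ⟩
    (-F c) ⊗ (pow x a ⊗ pow y b ⊕ ⊝ (pow x b ⊗ pow y a)) ⊗ rest
      ≡⟨ cong (λ c → c ⊗ (pow x a ⊗ pow y b ⊕ ⊝ (pow x b ⊗ pow y a)) ⊗ rest) (-F≡⊝ c) ⟩
    ⊝ c ⊗ (pow x a ⊗ pow y b ⊕ ⊝ (pow x b ⊗ pow y a)) ⊗ rest
      ≈⟨ solve 4 (λ c u v r → :- c :* (u :- v) :* r := c :* (v :* r) :- c :* (u :* r)) K.refl c (pow x a ⊗ pow y b) (pow x b ⊗ pow y a) rest ⟩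
    c ⊗ (pow x b ⊗ pow y a ⊗ rest) ⊕ ⊝ (c ⊗ (pow x a ⊗ pow y b ⊗ rest))
      ≈⟨ K.+-cong (K.*-congˡ swapped) (K.-‿cong (K.*-congˡ original)) ⟨
    c ⊗ mono (z ∘ transpose i) ν ⊕ ⊝ (c ⊗ mono z ν) ∎
    where
    a b : ℕ
    a = lookup ν (inject₁ i)
    b = lookup ν (suc i)
  ... | false = begin
    (x ⊕ ⊝ y) ⊗ ev z (block c a b)
      ≈⟨ ev-block c a b (ℕ.≮⇒≥ (λ b<a → ≡.subst T eq (ℕ.<⇒<ᵇ b<a))) ⟩
    c ⊗ (pow x b ⊗ pow y a ⊕ ⊝ (pow x a ⊗ pow y b)) ⊗ rest
      ≈⟨ solve 4 (λ c u v r → c :* (u :- v) :* r := c :* (u :* r) :- c :* (v :* r)) K.refl c (pow x b ⊗ pow y a) (pow x a ⊗ pow y b) rest ⟩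
    c ⊗ (pow x b ⊗ pow y a ⊗ rest) ⊕ ⊝ (c ⊗ (pow x a ⊗ pow y b ⊗ rest))
      ≈⟨ K.+-cong (K.*-congˡ swapped) (K.-‿cong (K.*-congˡ original)) ⟨
    c ⊗ mono (z ∘ transpose i) ν ⊕ ⊝ (c ⊗ mono z ν) ∎
    where
    a b : ℕ
    a = lookup ν (inject₁ i)
    b = lookup ν (suc i)

gap : Fin m → Pt (suc m) → 𝔽
gap i z = z (inject₁ i) ⊕ ⊝ z (suc i)

ev-∂ : ∀ (i : Fin m) z f → gap i z ⊗ ev z (∂ i f) ≋ ev (z ∘ transpose i) f ⊕ ⊝ ev z f
ev-∂ i z []            = solve 1 (λ x → x :* con (+ 0) := con (+ 0) :- con (+ 0)) K.refl (gap i z)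
ev-∂ i z ((c , ν) ∷ f) = begin
  gap i z ⊗ ev z (∂-term i z ν c ++ ∂ i f)
    ≈⟨ K.*-congˡ (ev-++ z (∂-term i z ν c) (∂ i f)) ⟩
  gap i z ⊗ (ev z (∂-term i z ν c) ⊕ ev z (∂ i f))
    ≈⟨ K.distribˡ _ _ _ ⟩
  gap i z ⊗ ev z (∂-term i z ν c) ⊕ gap i z ⊗ ev z (∂ i f)
    ≈⟨ K.+-cong (ev-∂-term i z ν c) (ev-∂ i z f) ⟩
  (c ⊗ mono (z ∘ transpose i) ν ⊕ ⊝ (c ⊗ mono z ν)) ⊕ (ev (z ∘ transpose i) f ⊕ ⊝ ev z f)
    ≈⟨ solve 4 (λ a b c d → (a :- b) :+ (c :- d) := (a :+ c) :- (b :+ d)) K.refl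
         (c ⊗ mono (z ∘ transpose i) ν) (c ⊗ mono z ν) (ev (z ∘ transpose i) f) (ev z f) ⟩
  (c ⊗ mono (z ∘ transpose i) ν ⊕ ev (z ∘ transpose i) f) ⊕ ⊝ (c ⊗ mono z ν ⊕ ev z f) ∎

-- The points separate adjacent coordinates, so the quotient by x_i - x_{i+1} is determined by its values there.
∂-unique : ∀ (i : Fin m) f {d F} → PFun d F → (∀ z → gap i z ⊗ F z ≋ ev (z ∘ transpose i) f ⊕ ⊝ ev z f) → ∀ z → ev z (∂ i f) ≋ F z
∂-unique i f {F = F} p e = dense (proj₂ (ev-PFun-some (∂ i f))) p λ γ → difference≋0 (⊗-cancel (pt-separated i γ) (begin
  gap i (pt 0 γ) ⊗ (ev (pt 0 γ) (∂ i f) ⊕ ⊝ F (pt 0 γ))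
    ≈⟨ solve 3 (λ g a b → g :* (a :- b) := g :* a :- g :* b) K.refl (gap i (pt 0 γ)) (ev (pt 0 γ) (∂ i f)) (F (pt 0 γ)) ⟩
  gap i (pt 0 γ) ⊗ ev (pt 0 γ) (∂ i f) ⊕ ⊝ (gap i (pt 0 γ) ⊗ F (pt 0 γ))
    ≈⟨ K.+-cong (ev-∂ i (pt 0 γ) f) (K.-‿cong (e (pt 0 γ))) ⟩
  _ ⊕ ⊝ _
    ≈⟨ K.-‿inverseʳ _ ⟩
  0F ∎))

ev-σ⁺ : ∀ (i : Fin m) z f → ev z (σ⁺ i f) ≋ ev (z ∘ transpose i) f ⊕ rF ⊗ ev z (∂ i f)
ev-σ⁺ i z f = K.trans (ev-++ z (s i f) (scaleP rF (∂ i f))) (K.+-cong (ev-s i z f) (ev-scaleP z rF (∂ i f)))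

-- Polynomials with prescribed leading monomial

-- The two conditions characterise Ξ(x^ν) without mentioning Ξ: `lower` fixes the top component, and
-- `vanish` puts g into the class of degree |ν|.
record Bar (ν : Comp n) (g : Poly n) : Set where
  field
    lower  : PFun< ∣ ν ∣ (λ z → ev z g ⊕ ⊝ mono z ν)
    vanish : ∀ γ → ∣ γ ∣ < ∣ ν ∣ → ev (pt 0 γ) g ≋ 0F
open Bar

linear-00 : linear 0 0 ≋ 0F
linear-00 = begin
  linear 0 0              ≡⟨ linear-nat 0 0 ⟩
  nat 0 ⊕ rF ⊗ nat 0      ≈⟨ K.+-cong nat-zero (K.*-congˡ nat-zero) ⟩
  0F ⊕ rF ⊗ 0F            ≈⟨ solve 1 (λ r → con (+ 0) :+ r :* con (+ 0) := con (+ 0)) K.refl rF ⟩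
  0F                      ∎

linear-suc-slope : ∀ a b → linear a (suc b) ≋ linear a b ⊕ rF
linear-suc-slope a b = begin
  linear a (suc b)              ≡⟨ linear-nat a (suc b) ⟩
  nat a ⊕ rF ⊗ nat (suc b)      ≈⟨ K.+-congˡ (K.*-congˡ (nat-suc b)) ⟩
  nat a ⊕ rF ⊗ (1F ⊕ nat b)     ≈⟨ solve 3 (λ a r b → a :+ r :* (con (+ 1) :+ b) := a :+ r :* b :+ r) K.refl (nat a) rF (nat b) ⟩
  nat a ⊕ rF ⊗ nat b ⊕ rF       ≡⟨ cong (_⊕ rF) (linear-nat a b) ⟨
  linear a b ⊕ rF               ∎

1F≉0F : ¬ 1F ≋ 0F
1F≉0F e = ℕ.1+n≢0 {0} (nat-injective {1} {0} (begin
  nat 1        ≈⟨ nat-suc 0 ⟩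
  1F ⊕ nat 0   ≈⟨ K.+-congʳ e ⟩
  0F ⊕ nat 0   ≈⟨ K.+-identityˡ (nat 0) ⟩
  nat 0        ∎))

rotate-pt-rotate : ∀ (γ : Comp (suc m)) → rotate-point (pt 0 (rotate γ)) ≗ₚ pt 0 γ
rotate-pt-rotate {m} γ zero = begin
  pt 0 (rotate γ) (fromℕ m) ⊕ 1F        ≈⟨ K.+-congʳ (pt-rotate 0 γ (fromℕ m)) ⟩
  unrotate (pt 0 γ) (fromℕ m) ⊕ 1F      ≡⟨ cong (_⊕ 1F) (snoc-fromℕ (pt 0 γ ∘ suc) _) ⟩
  pt 0 γ zero ⊕ ⊝ 1F ⊕ 1F               ≈⟨ solve 1 (λ x → x :- con (+ 1) :+ con (+ 1) := x) K.refl (pt 0 γ zero) ⟩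
  pt 0 γ zero                           ∎
rotate-pt-rotate γ (suc k) = K.trans (pt-rotate 0 γ (inject₁ k)) (K.reflexive (snoc-inject₁ (pt 0 γ ∘ suc) _ k))

Φ⁺-vanish : ∀ d (g : Poly (suc m)) → (∀ γ → ∣ γ ∣ < d → ev (pt 0 γ) g ≋ 0F) →
  ∀ γ → ∣ γ ∣ < suc d → ev (pt 0 γ) (Φ⁺ g) ≋ 0F
Φ⁺-vanish {m} d g v γ γ<d with V.initLast γ
... | γ′ , zero , refl = begin
  ev (pt 0 (γ′ ∷ʳ 0)) (Φ⁺ g)
    ≈⟨ ev-Φ⁺ (pt 0 (γ′ ∷ʳ 0)) g ⟩
  pt 0 (γ′ ∷ʳ 0) (fromℕ m) ⊗ ev (rotate-point (pt 0 (γ′ ∷ʳ 0))) g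
    ≈⟨ K.*-congʳ (K.trans (pt-∷ʳ0 0 γ′ (fromℕ m)) (K.trans (K.reflexive (snoc-fromℕ (pt 1 γ′) _))
         (K.trans (K.-‿cong linear-00) (solve 0 (:- con (+ 0) := con (+ 0)) K.refl)))) ⟩
  0F ⊗ ev (rotate-point (pt 0 (γ′ ∷ʳ 0))) g
    ≈⟨ K.zeroˡ _ ⟩
  0F ∎
-- A positive last entry makes γ the rotation of a composition of size one less, which accounts for
-- the step from d to d+1.
... | γ′ , suc k , refl = begin
  ev (pt 0 (rotate (k ∷ γ′))) (Φ⁺ g)
    ≈⟨ ev-Φ⁺ (pt 0 (rotate (k ∷ γ′))) g ⟩
  pt 0 (rotate (k ∷ γ′)) (fromℕ m) ⊗ ev (rotate-point (pt 0 (rotate (k ∷ γ′)))) g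
    ≈⟨ K.*-congˡ (K.trans (ev-ext g (rotate-pt-rotate (k ∷ γ′)))
         (v (k ∷ γ′) (ℕ.≤-pred (≡.subst (_< suc d) (∣rotate∣ (k ∷ γ′)) γ<d)))) ⟩
  pt 0 (rotate (k ∷ γ′)) (fromℕ m) ⊗ 0F
    ≈⟨ K.zeroʳ _ ⟩
  0F ∎

rotate-point-affine : ∀ j → PFun 1 (λ (z : Pt (suc m)) → rotate-point z j)
rotate-point-affine zero    = add (coord _) (const 1F)
rotate-point-affine (suc k) = coord (inject₁ k)

rotate-point₀-affine : ∀ j → PFun 1 (λ (z : Pt (suc m)) → rotate-point₀ z j)
rotate-point₀-affine zero    = coord _
rotate-point₀-affine (suc k) = coord (inject₁ k)

Bar-Φ⁺ : ∀ {ν : Comp (suc m)} {g} → Bar ν g → Bar (rotate ν) (Φ⁺ g)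
Bar-Φ⁺ {m} {ν} {g} b = record
  { lower  = ≡.subst (λ d → PFun< d (λ z → ev z (Φ⁺ g) ⊕ ⊝ mono z (rotate ν))) (≡.sym (∣rotate∣ ν)) lower′
  ; vanish = λ γ γ<d → Φ⁺-vanish ∣ ν ∣ g (vanish b) γ (≡.subst (∣ γ ∣ <_) (∣rotate∣ ν) γ<d) }
  where
  offset : Fin (suc m) → 𝔽
  offset zero    = 1F
  offset (suc _) = 0F

  shift : ∀ j z → rotate-point z j ≋ rotate-point₀ z j ⊕ 1F ⊗ offset j
  shift zero    z = solve 1 (λ x → x :+ con (+ 1) := x :+ con (+ 1) :* con (+ 1)) K.refl (z (fromℕ m))
  shift (suc k) z = solve 1 (λ x → x := x :+ con (+ 1) :* con (+ 0)) K.refl (z (inject₁ k))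

  -- With L = 1 the quotient is the difference itself: the translation by 1 changes x^ν only in
  -- degrees below |ν|.
  difference : ∃[ Q ] PFun< ∣ ν ∣ Q × (∀ z → mono (rotate-point z) ν ≋ mono (rotate-point₀ z) ν ⊕ 1F ⊗ Q z)
  difference = difference-quotient {T = λ j z → rotate-point z j} {U = λ j z → rotate-point₀ z j}
    rotate-point-affine rotate-point₀-affine (λ _ → 1F) offset shift (mono-PFun ν)

  lower′ : PFun< (suc ∣ ν ∣) (λ z → ev z (Φ⁺ g) ⊕ ⊝ mono z (rotate ν))
  lower′ = PFun<-resp {d = ∣ ν ∣ + 1} (ℕ.≤-reflexive (ℕ.+-comm ∣ ν ∣ 1)) (λ z → begin
      (ev (rotate-point z) g ⊕ ⊝ mono (rotate-point z) ν ⊕ proj₁ difference z) ⊗ z (fromℕ m)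
        ≈⟨ solve 4 (λ g t q x → (g :- t :+ q) :* x := x :* g :- x :* (t :- con (+ 1) :* q)) K.refl
             (ev (rotate-point z) g) (mono (rotate-point z) ν) (proj₁ difference z) (z (fromℕ m)) ⟩
      z (fromℕ m) ⊗ ev (rotate-point z) g ⊕ ⊝ (z (fromℕ m) ⊗ (mono (rotate-point z) ν ⊕ ⊝ (1F ⊗ proj₁ difference z)))
        ≈⟨ K.+-cong (ev-Φ⁺ z g) (K.-‿cong (K.trans (mono-rotate z ν) (K.*-congˡ (K.trans
             (solve 2 (λ a q → a := (a :+ q) :- q) K.refl (mono (rotate-point₀ z) ν) (1F ⊗ proj₁ difference z))
             (K.+-congʳ (K.sym (proj₂ (proj₂ difference) z))))))) ⟨
      ev z (Φ⁺ g) ⊕ ⊝ mono z (rotate ν) ∎)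
    (PFun<-mul {d = ∣ ν ∣} (PFun<-add {d = ∣ ν ∣}
      (PFun<-comp {d = ∣ ν ∣} {T = λ j z → rotate-point z j} rotate-point-affine (lower b)) (proj₁ (proj₂ difference))) (coord (fromℕ m)))

pt-swap : ∀ (i : Fin m) γ → lookup γ (inject₁ i) ≢ lookup γ (suc i) → (pt 0 γ ∘ transpose i) ≗ₚ pt 0 (swap i γ)
pt-swap i γ γᵢ≢γⱼ j = K.reflexive (cong₂ (λ a b → ⊝ linear a (b + 0))
  (≡.sym (lookup-swap i γ j)) (≡.sym (δ-swap i γ γᵢ≢γⱼ j)))

pt-tie : ∀ (i : Fin m) γ → lookup γ (inject₁ i) ≡ lookup γ (suc i) → gap i (pt 0 γ) ≋ ⊝ rF
pt-tie i γ tie = begin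
  ⊝ linear (lookup γ (inject₁ i)) (δ γ (inject₁ i) + 0) ⊕ ⊝ ⊝ linear a (b + 0)
    ≡⟨ cong₂ (λ u v → ⊝ linear u (v + 0) ⊕ ⊝ ⊝ linear a (b + 0)) tie (δ-tie i γ tie) ⟩
  ⊝ linear a (suc (b + 0)) ⊕ ⊝ ⊝ linear a (b + 0)
    ≈⟨ K.+-congʳ (K.-‿cong (linear-suc-slope a (b + 0))) ⟩
  ⊝ (linear a (b + 0) ⊕ rF) ⊕ ⊝ ⊝ linear a (b + 0)
    ≈⟨ solve 2 (λ l r → :- (l :+ r) :- (:- l) := :- r) K.refl (linear a (b + 0)) rF ⟩
  ⊝ rF ∎
  where
  a b : ℕ
  a = lookup γ (suc i)
  b = δ γ (suc i)

σ⁺-vanish : ∀ (i : Fin m) d (g : Poly (suc m)) → (∀ γ → ∣ γ ∣ < d → ev (pt 0 γ) g ≋ 0F) →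
  ∀ γ → ∣ γ ∣ < d → ev (pt 0 γ) (σ⁺ i g) ≋ 0F
σ⁺-vanish i d g v γ γ<d with lookup γ (inject₁ i) ℕ.≟ lookup γ (suc i)
... | yes tie = begin
  ev z (σ⁺ i g)
    ≈⟨ ev-σ⁺ i z g ⟩
  ev (z ∘ transpose i) g ⊕ rF ⊗ ev z (∂ i g)
    ≈⟨ solve 3 (λ a b c → a :+ b := (a :- c) :- (:- b) :+ c) K.refl (ev (z ∘ transpose i) g) (rF ⊗ ev z (∂ i g)) (ev z g) ⟩
  (ev (z ∘ transpose i) g ⊕ ⊝ ev z g) ⊕ ⊝ (⊝ (rF ⊗ ev z (∂ i g))) ⊕ ev z g
    ≈⟨ K.+-cong (K.+-congʳ (K.sym (ev-∂ i z g))) (v γ γ<d) ⟩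
  gap i z ⊗ ev z (∂ i g) ⊕ ⊝ (⊝ (rF ⊗ ev z (∂ i g))) ⊕ 0F
    ≈⟨ K.+-congʳ (K.+-congʳ (K.*-congʳ (pt-tie i γ tie))) ⟩
  ⊝ rF ⊗ ev z (∂ i g) ⊕ ⊝ (⊝ (rF ⊗ ev z (∂ i g))) ⊕ 0F
    ≈⟨ solve 2 (λ r e → :- r :* e :- (:- (r :* e)) :+ con (+ 0) := con (+ 0)) K.refl rF (ev z (∂ i g)) ⟩
  0F ∎
  where
  z : Pt _
  z = pt 0 γ
... | no γᵢ≢γⱼ = begin
  ev z (σ⁺ i g)
    ≈⟨ ev-σ⁺ i z g ⟩
  ev (z ∘ transpose i) g ⊕ rF ⊗ ev z (∂ i g)
    -- Both sᵢg and g vanish at this point, hence so does the gap times ∂ᵢg, and the gap is nonzero.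
    ≈⟨ K.+-cong swapped≋0 (K.*-congˡ (⊗-cancel (pt-separated i γ) (K.trans (ev-∂ i z g)
         (K.trans (K.+-cong swapped≋0 (K.-‿cong (v γ γ<d))) (K.-‿inverseʳ 0F))))) ⟩
  0F ⊕ rF ⊗ 0F
    ≈⟨ solve 1 (λ r → con (+ 0) :+ r :* con (+ 0) := con (+ 0)) K.refl rF ⟩
  0F ∎
  where
  z : Pt _
  z = pt 0 γ
  swapped≋0 : ev (z ∘ transpose i) g ≋ 0F
  swapped≋0 = K.trans (ev-ext g (pt-swap i γ γᵢ≢γⱼ)) (v (swap i γ) (≡.subst (_< d) (≡.sym (∣swap∣ i γ)) γ<d))

-- The root direction eᵢ₊₁ - eᵢ, along which the reflection sᵢ moves a point by zᵢ - zᵢ₊₁.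
transpose-offset : Fin m → Fin (suc m) → 𝔽
transpose-offset zero    zero          = ⊝ 1F
transpose-offset zero    (suc zero)    = 1F
transpose-offset zero    (suc (suc k)) = 0F
transpose-offset (suc i) zero          = 0F
transpose-offset (suc i) (suc k)       = transpose-offset i k

transpose-shift : ∀ (i : Fin m) j (z : Pt (suc m)) → z (transpose i j) ≋ z j ⊕ gap i z ⊗ transpose-offset i j
transpose-shift zero    zero          z = solve 2 (λ x y → y := x :+ (x :- y) :* (:- con (+ 1))) K.refl (z zero) (z (suc zero))
transpose-shift zero    (suc zero)    z = solve 2 (λ x y → x := y :+ (x :- y) :* con (+ 1)) K.refl (z zero) (z (suc zero))
transpose-shift zero    (suc (suc k)) z = solve 2 (λ x g → x := x :+ g :* con (+ 0)) K.refl (z (suc (suc k))) (gap zero z)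
transpose-shift (suc i) zero          z = solve 2 (λ x g → x := x :+ g :* con (+ 0)) K.refl (z zero) (gap (suc i) z)
transpose-shift (suc i) (suc k)       z = transpose-shift i k (z ∘ suc)

-- The quotient found by `difference-quotient` comes with its degree bound, and `∂-unique`
-- identifies it with the value of the term list.
∂-lower : ∀ (i : Fin m) g {d} → PFun d (λ z → ev z g) → PFun< d (λ z → ev z (∂ i g))
∂-lower i g {d} p = PFun<-resp {d = d} ℕ.≤-refl (λ z → K.sym (∂-unique i g (PFun<⇒PFun Q<)
    (λ z → K.trans (solve 2 (λ a b → a := (b :+ a) :- b) K.refl (gap i z ⊗ Q z) (ev z g)) (K.+-congʳ (K.sym (Q≋ z)))) z)) Q<
  where
  division : ∃[ Q ] PFun< d Q × (∀ z → ev (z ∘ transpose i) g ≋ ev z g ⊕ gap i z ⊗ Q z)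
  division = difference-quotient {T = λ j z → z (transpose i j)} {U = λ j z → z j} (coord ∘ transpose i) coord
    (gap i) (transpose-offset i) (transpose-shift i) p
  Q : Pt _ → 𝔽
  Q = proj₁ division
  Q< : PFun< d Q
  Q< = proj₁ (proj₂ division)
  Q≋ : ∀ z → ev (z ∘ transpose i) g ≋ ev z g ⊕ gap i z ⊗ Q z
  Q≋ = proj₂ (proj₂ division)

Bar-σ⁺ : ∀ (i : Fin m) {ν g} → Bar ν g → Bar (swap i ν) (σ⁺ i g)
Bar-σ⁺ i {ν} {g} b = record
  { lower  = ≡.subst (λ d → PFun< d (λ z → ev z (σ⁺ i g) ⊕ ⊝ mono z (swap i ν))) (≡.sym (∣swap∣ i ν)) lower′
  ; vanish = λ γ γ<d → σ⁺-vanish i ∣ ν ∣ g (vanish b) γ (≡.subst (∣ γ ∣ <_) (∣swap∣ i ν) γ<d) }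
  where
  g-PFun : PFun ∣ ν ∣ (λ z → ev z g)
  g-PFun = resp ℕ.≤-refl (λ z → solve 2 (λ a b → (a :- b) :+ b := a) K.refl (ev z g) (mono z ν))
    (add (PFun<⇒PFun (lower b)) (mono-PFun ν))
  lower′ : PFun< ∣ ν ∣ (λ z → ev z (σ⁺ i g) ⊕ ⊝ mono z (swap i ν))
  lower′ = PFun<-resp {d = ∣ ν ∣} ℕ.≤-refl (λ z → begin
      ev (z ∘ transpose i) g ⊕ ⊝ mono (z ∘ transpose i) ν ⊕ rF ⊗ ev z (∂ i g)
        ≈⟨ solve 3 (λ a b c → a :- b :+ c := a :+ c :- b) K.refl (ev (z ∘ transpose i) g) (mono (z ∘ transpose i) ν) (rF ⊗ ev z (∂ i g)) ⟩
      ev (z ∘ transpose i) g ⊕ rF ⊗ ev z (∂ i g) ⊕ ⊝ mono (z ∘ transpose i) ν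
        ≈⟨ K.+-cong (ev-σ⁺ i z g) (K.-‿cong (mono-swap i z ν)) ⟨
      ev z (σ⁺ i g) ⊕ ⊝ mono z (swap i ν) ∎)
    (PFun<-add {d = ∣ ν ∣} (PFun<-comp {d = ∣ ν ∣} {T = λ j z → z (transpose i j)} (coord ∘ transpose i) (lower b))
      (PFun<-scale {d = ∣ ν ∣} rF (∂-lower i g g-PFun)))

nonzero-entry : ∀ (ν : Comp n) {e} → ∣ ν ∣ ≡ suc e → ∃[ j ] ∃[ k ] lookup ν j ≡ suc k
nonzero-entry (zero  ∷ ν) e with nonzero-entry ν e
... | j , k , p = suc j , k , p
nonzero-entry (suc k ∷ ν) e = zero , k , refl

-- Every monomial arises from 1 by rotations and adjacent transpositions.
bar-exists : ∀ d (ν : Comp (suc m)) → ∣ ν ∣ ≡ d → ∃[ g ] Bar ν g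
bar-exists zero ν e = monomial ν , record
  { lower  = PFun<-resp {d = ∣ ν ∣} ℕ.≤-refl
      (λ z → K.sym (K.trans (K.+-congʳ (ev-monomial z ν)) (K.-‿inverseʳ _))) (PFun<-zero {d = ∣ ν ∣})
  ; vanish = λ γ γ<0 → ⊥-elim (ℕ.n≮0 (≡.subst (∣ γ ∣ <_) e γ<0)) }
bar-exists {m} (suc d) ν e with nonzero-entry ν e
-- A positive entry in last position exhibits ν as a rotation. In any earlier position a swap moves
-- it one place to the right, so the induction descends from the last index.
... | j , k , νⱼ = >-weakInduction P last previous j ν e k νⱼ
  where
  P : Fin (suc m) → Set
  P j = ∀ ν → ∣ ν ∣ ≡ suc d → ∀ k → lookup ν j ≡ suc k → ∃[ g ] Bar ν g
  last : P (fromℕ m)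
  last ν e k νⱼ with V.initLast ν
  ... | ν′ , l , refl with ≡.trans (≡.sym (lookup-∷ʳ-fromℕ ν′ l)) νⱼ
  ...   | refl with bar-exists d (k ∷ ν′) (ℕ.suc-injective (≡.trans (≡.sym (∣rotate∣ (k ∷ ν′))) e))
  ...     | g , b = Φ⁺ g , Bar-Φ⁺ b
  previous : ∀ i → P (suc i) → P (inject₁ i)
  previous i p ν e k νⱼ with p (swap i ν) (≡.trans (∣swap∣ i ν) e) k
      (≡.trans (lookup-swap i ν (suc i)) (≡.trans (cong (lookup ν) (transpose-right i)) νⱼ))
  ... | g , b = σ⁺ i g , ≡.subst (λ ν → Bar ν (σ⁺ i g)) (swap-involutive i ν) (Bar-σ⁺ i b)

-- A finite list that covers all compositions of size at most d. It also contains larger ones, which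
-- the elimination in `Ξ-determined` skips.
box : ∀ n → ℕ → List (Comp n)
box zero    d = [] ∷ []
box (suc n) d = L.cartesianProductWith _∷_ (L.upTo (suc d)) (box n d)

∈-box : ∀ (γ : Comp n) d → ∣ γ ∣ ≤ d → γ ∈ box n d
∈-box []      d _ = here refl
∈-box (k ∷ γ) d l = ∈-cartesianProductWith⁺ _∷_ (∈-upTo⁺ (s≤s (ℕ.m+n≤o⇒m≤o k l))) (∈-box γ d (ℕ.m+n≤o⇒n≤o k l))

-- Signs, the reflection x ↦ -x and top components

sign : ℕ → 𝔽
sign = pow (⊝ 1F)

sign² : ∀ d → sign d ⊗ sign d ≋ 1F
sign² zero    = K.*-identityˡ 1F
sign² (suc d) = K.trans (solve 1 (λ x → (:- con (+ 1)) :* x :* ((:- con (+ 1)) :* x) := x :* x) K.refl (sign d)) (sign² d)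

sign≉0 : ∀ d → ¬ sign d ≋ 0F
sign≉0 d e = 1F≉0F (K.trans (K.sym (sign² d)) (K.trans (K.*-congʳ e) (K.zeroˡ (sign d))))

infix 9 -ₚ_
-ₚ_ : Pt n → Pt n
(-ₚ z) j = ⊝ z j

mono-neg : ∀ (z : Pt n) ν → mono (-ₚ z) ν ≋ sign ∣ ν ∣ ⊗ mono z ν
mono-neg z []      = K.sym (K.*-identityˡ 1F)
mono-neg z (k ∷ ν) = begin
  pow (⊝ z zero) k ⊗ mono (-ₚ (z ∘ suc)) ν
    ≈⟨ K.*-cong (pow-neg (z zero) k) (mono-neg (z ∘ suc) ν) ⟩
  (sign k ⊗ pow (z zero) k) ⊗ (sign ∣ ν ∣ ⊗ mono (z ∘ suc) ν)
    ≈⟨ solve 4 (λ a b c d → (a :* b) :* (c :* d) := (a :* c) :* (b :* d)) K.refl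
         (sign k) (pow (z zero) k) (sign ∣ ν ∣) (mono (z ∘ suc) ν) ⟩
  (sign k ⊗ sign ∣ ν ∣) ⊗ (pow (z zero) k ⊗ mono (z ∘ suc) ν)
    ≈⟨ K.*-congʳ (pow-+ (⊝ 1F) k ∣ ν ∣) ⟨
  sign (k + ∣ ν ∣) ⊗ (pow (z zero) k ⊗ mono (z ∘ suc) ν) ∎
  where
  pow-neg : ∀ x k → pow (⊝ x) k ≋ sign k ⊗ pow x k
  pow-neg x zero    = K.sym (K.*-identityˡ 1F)
  pow-neg x (suc k) = K.trans (K.*-congˡ (pow-neg x k))
    (solve 3 (λ x s p → (:- x) :* (s :* p) := (:- con (+ 1)) :* s :* (x :* p)) K.refl x (sign k) (pow x k))

ev-top-neg : ∀ (z : Pt n) d p → ev (-ₚ z) (top d p) ≋ sign d ⊗ ev z (top d p)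
ev-top-neg z d [] = K.sym (K.zeroʳ _)
ev-top-neg z d ((c , ν) ∷ p) with ∣ ν ∣ ≡ᵇ d in eq
... | false = ev-top-neg z d p
... | true with ℕ.≡ᵇ⇒≡ ∣ ν ∣ d (≡.subst T (≡.sym eq) _)
...   | refl = K.trans (K.+-cong (K.*-congˡ (mono-neg z ν)) (ev-top-neg z ∣ ν ∣ p))
  (solve 4 (λ c s x y → c :* (s :* x) :+ s :* y := s :* (c :* x :+ y)) K.refl c (sign ∣ ν ∣) (mono z ν) _)

top-homogeneous : ∀ d (p : Poly n) → Homogeneous d (top d p)
top-homogeneous d p μ μ≢d = K.trans (coeff-keep (λ ν → ∣ ν ∣ ≡ᵇ d) p μ)
  (K.reflexive (cong (λ b → if b then lin (ind μ) p else 0F) (≡ᵇ-false μ≢d)))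

bar≡linear : ∀ (γ : Comp n) j → bar γ j ≡ linear (lookup γ j) (δ γ j + 0)
bar≡linear {n} γ j = ≡.trans (+F≡⊕ (natF (lookup γ j)) (rF *F natF (n ∸ 1 ∸ rankγ γ j)))
  (≡.trans (cong₂ _⊕_ (natF≡nat (lookup γ j))
    (≡.trans (*F≡⊗ rF (natF (n ∸ 1 ∸ rankγ γ j)))
      (cong (rF ⊗_) (≡.trans (natF≡nat (n ∸ 1 ∸ rankγ γ j))
        (cong nat (≡.trans (codegree-rank γ j) (≡.sym (ℕ.+-identityʳ (δ γ j)))))))))
    (≡.sym (linear-nat (lookup γ j) (δ γ j + 0))))

-- The operator Ξ

-- Multiplied by r, the factor becomes (a+1) + r(l+1), whose constant coefficient is positive.
hook-factor≉0 : ∀ a l → ¬ ((αF *F natF (suc a)) +F natF (suc l) ≋ 0F)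
hook-factor≉0 a l e = ℕ.1+n≢0 (proj₁ (linear-injective {suc a} {suc l} {0} {0} (begin
  linear (suc a) (suc l)
    ≡⟨ linear-nat (suc a) (suc l) ⟩
  nat (suc a) ⊕ rF ⊗ nat (suc l)
    -- αr = 1 is unknown to the solver, so αr enters as an atom c together with the correction (1 -
    -- c)x, which the next step makes vanish.
    ≈⟨ solve 4 (λ r x y c → x :+ r :* y := c :* x :+ (r :* y :+ (con (+ 1) :- c) :* x)) K.refl
         rF (nat (suc a)) (nat (suc l)) (αF ⊗ rF) ⟩
  αF ⊗ rF ⊗ nat (suc a) ⊕ (rF ⊗ nat (suc l) ⊕ (1F ⊕ ⊝ (αF ⊗ rF)) ⊗ nat (suc a))
    ≈⟨ K.+-congˡ (K.+-congˡ (K.*-congʳ (K.+-congˡ (K.-‿cong αF-inverse)))) ⟩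
  αF ⊗ rF ⊗ nat (suc a) ⊕ (rF ⊗ nat (suc l) ⊕ (1F ⊕ ⊝ 1F) ⊗ nat (suc a))
    ≈⟨ solve 4 (λ α r x y → α :* r :* x :+ (r :* y :+ (con (+ 1) :- con (+ 1)) :* x) := r :* (α :* x :+ y)) K.refl
         αF rF (nat (suc a)) (nat (suc l)) ⟩
  rF ⊗ (αF ⊗ nat (suc a) ⊕ nat (suc l))
    ≡⟨ cong (rF ⊗_) (≡.trans (+F≡⊕ (αF *F natF (suc a)) (natF (suc l)))
         (cong₂ _⊕_ (≡.trans (*F≡⊗ αF (natF (suc a))) (cong (αF ⊗_) (natF≡nat (suc a)))) (natF≡nat (suc l)))) ⟨
  rF ⊗ ((αF *F natF (suc a)) +F natF (suc l))
    ≈⟨ K.*-congˡ e ⟩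
  rF ⊗ 0F
    ≈⟨ K.zeroʳ rF ⟩
  0F
    ≈⟨ linear-00 ⟨
  linear 0 0 ∎)))

prodF≉0 : ∀ xs → All (λ x → ¬ x ≋ 0F) xs → ¬ prodF xs ≋ 0F
prodF≉0 []       []       e = 1F≉0F e
prodF≉0 (x ∷ xs) (p ∷ ps) e = prodF≉0 xs ps (⊗-cancel p (K.trans (K.reflexive (≡.sym (*F≡⊗ x (prodF xs)))) e))

dη≉0 : ∀ (η : Comp n) → ¬ dη η ≋ 0F
dη≉0 {n} η = prodF≉0 _ (All.concat⁺ (All.map⁺ (All.universal (λ i →
  All.map⁺ (All.universal (λ j → hook-factor≉0 (arm η i j) (leg η i j)) (L.applyUpTo suc (lookup η i)))) (L.allFin n))))

-- (-1)^|η| p(-x); the sign restores the top component of p.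
reflected : Comp n → Poly n → Poly n
reflected η p = scaleP (sign ∣ η ∣) (subst negVars p)

ev-negVars : ∀ (z : Pt n) p → ev z (subst negVars p) ≋ ev (-ₚ z) p
ev-negVars z p = K.trans (ev-subst z negVars p) (ev-ext p (λ j → begin
  ev z (scaleP (-F 1F) (var j))   ≈⟨ ev-scaleP z (-F 1F) (var j) ⟩
  (-F 1F) ⊗ ev z (var j)          ≡⟨ cong (_⊗ ev z (var j)) (-F≡⊝ 1F) ⟩
  ⊝ 1F ⊗ ev z (var j)             ≈⟨ K.*-congˡ (ev-var z j) ⟩
  ⊝ 1F ⊗ z j                      ≈⟨ solve 1 (λ x → (:- con (+ 1)) :* x := :- x) K.refl (z j) ⟩
  ⊝ z j                           ∎))

ev-reflected : ∀ (z : Pt n) η p → ev z (reflected η p) ≋ sign ∣ η ∣ ⊗ ev (-ₚ z) p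
ev-reflected z η p = K.trans (ev-scaleP z (sign ∣ η ∣) (subst negVars p)) (K.*-congˡ (ev-negVars z p))

neg-affine : ∀ (j : Fin n) → PFun 1 (λ z → (-ₚ z) j)
neg-affine j = resp ℕ.≤-refl (λ z → solve 1 (λ x → (:- con (+ 1)) :* x := :- x) K.refl (z j)) (mul {d = 0} (const (⊝ 1F)) (coord j))

drop-top-coeff : ∀ d (p : Poly n) → (∀ μ → d < ∣ μ ∣ → lin (ind μ) p ≋ 0F) →
  ∀ μ → d ≤ ∣ μ ∣ → lin (ind μ) (keep (λ ν → not (∣ ν ∣ ≡ᵇ d)) p) ≋ 0F
drop-top-coeff d p v μ l with ∣ μ ∣ ≡ᵇ d in eq | coeff-keep (λ ν → not (∣ ν ∣ ≡ᵇ d)) p μ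
... | true  | e = e
... | false | e = K.trans e (v μ (ℕ.≤∧≢⇒< l (λ d≡μ → ≡.subst T eq (ℕ.≡⇒≡ᵇ ∣ μ ∣ d (≡.sym d≡μ)))))

module _ {n} (η : Comp n) (p : Poly n) (interp : IsInterp η p) where

  interp-coeff : ∀ μ → ∣ η ∣ < ∣ μ ∣ → lin (ind μ) p ≋ 0F
  interp-coeff μ l = K.trans (K.sym (coeff≋lin p μ)) ⟪ proj₁ interp μ l ⟫

  interp-vanish : ∀ γ → ∣ γ ∣ ≤ ∣ η ∣ → γ ≢ η → ev (-ₚ pt 0 γ) p ≋ 0F
  interp-vanish γ l γ≢η = begin
    ev (-ₚ pt 0 γ) p   ≈⟨ ev-ext p (λ j → K.trans (solve 1 (λ x → :- (:- x) := x) K.refl (linear (lookup γ j) (δ γ j + 0)))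
                                            (K.reflexive (≡.sym (bar≡linear γ j)))) ⟩
    ev (bar γ) p       ≡⟨ eval≡ev (bar γ) p ⟨
    eval (bar γ) p     ≈⟨ ⟪ proj₂ (proj₂ interp) γ l γ≢η ⟫ ⟩
    0F                 ∎

  reflected-vanish : ∀ γ → ∣ γ ∣ ≤ ∣ η ∣ → γ ≢ η → ev (pt 0 γ) (reflected η p) ≋ 0F
  reflected-vanish γ l γ≢η = K.trans (ev-reflected (pt 0 γ) η p) (K.trans (K.*-congˡ (interp-vanish γ l γ≢η)) (K.zeroʳ _))

  -- Vanishing at η as well would mean vanishing at every point of size at most |η|, hence being
  -- zero, against the coefficient 1 at x^η. This value is the pivot of the elimination in
  -- `Ξ-determined`.
  reflected≉0 : ¬ ev (pt 0 η) (reflected η p) ≋ 0F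
  reflected≉0 e = 1F≉0F (begin
    1F              ≈⟨ ⟪ proj₁ (proj₂ interp) ⟫ ⟨
    coeff p η       ≈⟨ coeff≋lin p η ⟩
    lin (ind η) p   ≈⟨ ev-zero⇒coeff-zero p (λ z → K.trans
                         (ev-ext p (λ j → solve 1 (λ x → x := :- (:- x)) K.refl (z j))) (reflection-zero (-ₚ z))) η ⟩
    0F              ∎)
    where
    vanish-everywhere : ∀ γ → ∣ γ ∣ ≤ ∣ η ∣ → ev (-ₚ pt 0 γ) p ≋ 0F
    vanish-everywhere γ l = by-cases (V.≡-dec ℕ._≟_ γ η)
      where
      by-cases : Dec (γ ≡ η) → ev (-ₚ pt 0 γ) p ≋ 0F
      by-cases (no γ≢η)  = interp-vanish γ l γ≢η
      by-cases (yes γ≡η) = ≡.subst (λ γ → ev (-ₚ pt 0 γ) p ≋ 0F) (≡.sym γ≡η)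
        (⊗-cancel (sign≉0 ∣ η ∣) (K.trans (K.sym (ev-reflected (pt 0 η) η p)) e))
    reflection-zero : ∀ z → ev (-ₚ z) p ≋ 0F
    reflection-zero = vanishing n ∣ η ∣ 0 (PFun-comp {T = λ j z → (-ₚ z) j} neg-affine
      (coeff⇒PFun< (suc ∣ η ∣) p interp-coeff)) vanish-everywhere

  reflected-lower : PFun< ∣ η ∣ (λ z → ev z (reflected η p) ⊕ ⊝ ev z (top ∣ η ∣ p))
  reflected-lower = PFun<-resp {d = ∣ η ∣} ℕ.≤-refl (λ z → begin
      sign ∣ η ∣ ⊗ ev (-ₚ z) rest
        ≈⟨ solve 3 (λ s r t → s :* r := s :* (s :* t :+ r) :- s :* s :* t) K.refl (sign ∣ η ∣) (ev (-ₚ z) rest) (ev z (top ∣ η ∣ p)) ⟩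
      sign ∣ η ∣ ⊗ (sign ∣ η ∣ ⊗ ev z (top ∣ η ∣ p) ⊕ ev (-ₚ z) rest) ⊕ ⊝ (sign ∣ η ∣ ⊗ sign ∣ η ∣ ⊗ ev z (top ∣ η ∣ p))
        ≈⟨ K.+-cong (K.*-congˡ (K.+-congʳ (K.sym (ev-top-neg z ∣ η ∣ p)))) (K.-‿cong (K.trans (K.*-congʳ (sign² ∣ η ∣)) (K.*-identityˡ _))) ⟩
      sign ∣ η ∣ ⊗ (ev (-ₚ z) (top ∣ η ∣ p) ⊕ ev (-ₚ z) rest) ⊕ ⊝ ev z (top ∣ η ∣ p)
        ≈⟨ K.+-congʳ (K.*-congˡ (lin-keep (mono (-ₚ z)) (λ ν → ∣ ν ∣ ≡ᵇ ∣ η ∣) p)) ⟨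
      sign ∣ η ∣ ⊗ ev (-ₚ z) p ⊕ ⊝ ev z (top ∣ η ∣ p)
        ≈⟨ K.+-congʳ (ev-reflected z η p) ⟨
      ev z (reflected η p) ⊕ ⊝ ev z (top ∣ η ∣ p) ∎)
    (PFun<-scale {d = ∣ η ∣} (sign ∣ η ∣) (PFun<-comp {d = ∣ η ∣} {T = λ j z → (-ₚ z) j} neg-affine
      (coeff⇒PFun< ∣ η ∣ rest (drop-top-coeff ∣ η ∣ p interp-coeff))))
    where
    rest : Poly n
    rest = keep (λ ν → not (∣ ν ∣ ≡ᵇ ∣ η ∣)) p

-- Linear operators modulo equality of values

infix 4 _≈E_
_≈E_ : Poly n → Poly n → Set
f ≈E g = ∀ z → ev z f ≋ ev z g

-- Linearity restated for equality of values. Operators act on lists of terms, so compatibility with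
-- equality is part of the notion.
record EvLinear (A : Poly n → Poly n) : Set where
  field
    A-cong  : ∀ {f g} → f ≈E g → A f ≈E A g
    A-++    : ∀ f g → A (f ++ g) ≈E A f ++ A g
    A-scale : ∀ c f → A (scaleP c f) ≈E scaleP c (A f)
open EvLinear

∘-EvLinear : ∀ {A B : Poly n → Poly n} → EvLinear A → EvLinear B → EvLinear (A ∘ B)
∘-EvLinear {A = A} {B} a b = record
  { A-cong  = λ {f} {g} e → A-cong a {B f} {B g} (A-cong b {f} {g} e)
  ; A-++    = λ f g z → K.trans (A-cong a {B (f ++ g)} {B f ++ B g} (A-++ b f g) z) (A-++ a (B f) (B g) z)
  ; A-scale = λ c f z → K.trans (A-cong a {B (scaleP c f)} {scaleP c (B f)} (A-scale b c f) z) (A-scale a c (B f) z) }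

-- `scaleP 0F []` computes to `[]`, so homogeneity with the scalar 0 gives the claim.
EvLinear-[] : ∀ {A : Poly n → Poly n} → EvLinear A → ∀ z → ev z (A []) ≋ 0F
EvLinear-[] {A = A} a z = K.trans (A-scale a 0F [] z) (K.trans (ev-scaleP z 0F (A [])) (K.zeroˡ _))

EvLinear-∷ : ∀ {A : Poly n → Poly n} → EvLinear A → ∀ c ν f z → ev z (A ((c , ν) ∷ f)) ≋ c ⊗ ev z (A (monomial ν)) ⊕ ev z (A f)
EvLinear-∷ {A = A} a c ν f z = begin
  ev z (A ((c , ν) ∷ f))
    ≈⟨ A-cong a {(c , ν) ∷ f} {scaleP c (monomial ν) ++ f} (λ z → K.+-congʳ (K.*-congʳ
         (K.trans (K.sym (K.*-identityʳ c)) (K.reflexive (≡.sym (*F≡⊗ c 1F)))))) z ⟩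
  ev z (A (scaleP c (monomial ν) ++ f))
    ≈⟨ A-++ a (scaleP c (monomial ν)) f z ⟩
  ev z (A (scaleP c (monomial ν)) ++ A f)
    ≈⟨ ev-++ z (A (scaleP c (monomial ν))) (A f) ⟩
  ev z (A (scaleP c (monomial ν))) ⊕ ev z (A f)
    ≈⟨ K.+-congʳ (K.trans (A-scale a c (monomial ν) z) (ev-scaleP z c (A (monomial ν)))) ⟩
  c ⊗ ev z (A (monomial ν)) ⊕ ev z (A f) ∎

linear-extension : ∀ {A B : Poly n → Poly n} → EvLinear A → EvLinear B →
  (∀ ν → A (monomial ν) ≈E B (monomial ν)) → ∀ f → A f ≈E B f
linear-extension a b e [] z = K.trans (EvLinear-[] a z) (K.sym (EvLinear-[] b z))
linear-extension a b e ((c , ν) ∷ f) z = K.trans (EvLinear-∷ a c ν f z)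
  (K.trans (K.+-cong (K.*-congˡ (e ν z)) (linear-extension a b e f z)) (K.sym (EvLinear-∷ b c ν f z)))

weighted-EvLinear : ∀ {A : Poly n → Poly n} (w : Pt n → 𝔽) (T : Pt n → Pt n) →
  (∀ z f → ev z (A f) ≋ w z ⊗ ev (T z) f) → EvLinear A
weighted-EvLinear {A = A} w T e = record
  { A-cong  = λ {f} {g} f≈g z → K.trans (e z f) (K.trans (K.*-congˡ (f≈g (T z))) (K.sym (e z g)))
  ; A-++    = λ f g z → begin
      ev z (A (f ++ g))                        ≈⟨ e z (f ++ g) ⟩
      w z ⊗ ev (T z) (f ++ g)                  ≈⟨ K.*-congˡ (ev-++ (T z) f g) ⟩
      w z ⊗ (ev (T z) f ⊕ ev (T z) g)          ≈⟨ K.distribˡ _ _ _ ⟩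
      w z ⊗ ev (T z) f ⊕ w z ⊗ ev (T z) g      ≈⟨ K.+-cong (e z f) (e z g) ⟨
      ev z (A f) ⊕ ev z (A g)                  ≈⟨ ev-++ z (A f) (A g) ⟨
      ev z (A f ++ A g)                        ∎
  ; A-scale = λ c f z → begin
      ev z (A (scaleP c f))          ≈⟨ e z (scaleP c f) ⟩
      w z ⊗ ev (T z) (scaleP c f)    ≈⟨ K.*-congˡ (ev-scaleP (T z) c f) ⟩
      w z ⊗ (c ⊗ ev (T z) f)         ≈⟨ solve 3 (λ w c x → w :* (c :* x) := c :* (w :* x)) K.refl (w z) c (ev (T z) f) ⟩
      c ⊗ (w z ⊗ ev (T z) f)         ≈⟨ K.*-congˡ (e z f) ⟨
      c ⊗ ev z (A f)                 ≈⟨ ev-scaleP z c (A f) ⟨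
      ev z (scaleP c (A f))          ∎ }

Φ-EvLinear : EvLinear (Φ {m})
Φ-EvLinear {m} = weighted-EvLinear (λ z → z (fromℕ m)) rotate-point₀ ev-Φ

Φ⁺-EvLinear : EvLinear (Φ⁺ {m})
Φ⁺-EvLinear {m} = weighted-EvLinear (λ z → z (fromℕ m)) rotate-point ev-Φ⁺

s-EvLinear : ∀ (i : Fin m) → EvLinear (s i)
s-EvLinear i = weighted-EvLinear (λ _ → 1F) (_∘ transpose i) (λ z f → K.trans (ev-s i z f) (K.sym (K.*-identityˡ _)))

-- `∂` acts on each term separately, so its compatibility with equality of values is not visible.
-- Multiplied by zᵢ - zᵢ₊₁ each law becomes one about values of f and g, and `∂-unique` divides
-- again.
∂-EvLinear : ∀ (i : Fin m) → EvLinear (∂ i)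
∂-EvLinear i = record
  { A-cong  = λ {f} {g} e → ∂-unique i f (proj₂ (ev-PFun-some (∂ i g))) (λ z →
      K.trans (ev-∂ i z g) (K.+-cong (K.sym (e (z ∘ transpose i))) (K.-‿cong (K.sym (e z)))))
  ; A-++    = λ f g → ∂-unique i (f ++ g) (proj₂ (ev-PFun-some (∂ i f ++ ∂ i g))) (λ z → begin
      gap i z ⊗ ev z (∂ i f ++ ∂ i g)
        ≈⟨ K.trans (K.*-congˡ (ev-++ z (∂ i f) (∂ i g))) (K.distribˡ _ _ _) ⟩
      gap i z ⊗ ev z (∂ i f) ⊕ gap i z ⊗ ev z (∂ i g)
        ≈⟨ K.+-cong (ev-∂ i z f) (ev-∂ i z g) ⟩
      (ev (z ∘ transpose i) f ⊕ ⊝ ev z f) ⊕ (ev (z ∘ transpose i) g ⊕ ⊝ ev z g)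
        ≈⟨ solve 4 (λ a b c d → (a :- b) :+ (c :- d) := (a :+ c) :- (b :+ d)) K.refl
             (ev (z ∘ transpose i) f) (ev z f) (ev (z ∘ transpose i) g) (ev z g) ⟩
      (ev (z ∘ transpose i) f ⊕ ev (z ∘ transpose i) g) ⊕ ⊝ (ev z f ⊕ ev z g)
        ≈⟨ K.+-cong (ev-++ (z ∘ transpose i) f g) (K.-‿cong (ev-++ z f g)) ⟨
      ev (z ∘ transpose i) (f ++ g) ⊕ ⊝ ev z (f ++ g) ∎)
  ; A-scale = λ c f → ∂-unique i (scaleP c f) (proj₂ (ev-PFun-some (scaleP c (∂ i f)))) (λ z → begin
      gap i z ⊗ ev z (scaleP c (∂ i f))
        ≈⟨ K.*-congˡ (ev-scaleP z c (∂ i f)) ⟩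
      gap i z ⊗ (c ⊗ ev z (∂ i f))
        ≈⟨ solve 3 (λ g c x → g :* (c :* x) := c :* (g :* x)) K.refl (gap i z) c (ev z (∂ i f)) ⟩
      c ⊗ (gap i z ⊗ ev z (∂ i f))
        ≈⟨ K.*-congˡ (ev-∂ i z f) ⟩
      c ⊗ (ev (z ∘ transpose i) f ⊕ ⊝ ev z f)
        ≈⟨ solve 3 (λ c a b → c :* (a :- b) := c :* a :- c :* b) K.refl c (ev (z ∘ transpose i) f) (ev z f) ⟩
      c ⊗ ev (z ∘ transpose i) f ⊕ ⊝ (c ⊗ ev z f)
        ≈⟨ K.+-cong (ev-scaleP (z ∘ transpose i) c f) (K.-‿cong (ev-scaleP z c f)) ⟨
      ev (z ∘ transpose i) (scaleP c f) ⊕ ⊝ ev z (scaleP c f) ∎) }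

σ⁺-EvLinear : ∀ (i : Fin m) → EvLinear (σ⁺ i)
σ⁺-EvLinear i = record
  { A-cong  = λ {f} {g} e z → K.trans (ev-σ⁺ i z f) (K.trans
      (K.+-cong (e (z ∘ transpose i)) (K.*-congˡ (A-cong (∂-EvLinear i) {f} {g} e z))) (K.sym (ev-σ⁺ i z g)))
  ; A-++    = λ f g z → begin
      ev z (σ⁺ i (f ++ g))
        ≈⟨ ev-σ⁺ i z (f ++ g) ⟩
      ev (z ∘ transpose i) (f ++ g) ⊕ rF ⊗ ev z (∂ i (f ++ g))
        ≈⟨ K.+-cong (ev-++ (z ∘ transpose i) f g) (K.*-congˡ (K.trans (A-++ (∂-EvLinear i) f g z) (ev-++ z (∂ i f) (∂ i g)))) ⟩
      ev (z ∘ transpose i) f ⊕ ev (z ∘ transpose i) g ⊕ rF ⊗ (ev z (∂ i f) ⊕ ev z (∂ i g))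
        ≈⟨ solve 5 (λ a b r c d → a :+ b :+ r :* (c :+ d) := (a :+ r :* c) :+ (b :+ r :* d)) K.refl
             (ev (z ∘ transpose i) f) (ev (z ∘ transpose i) g) rF (ev z (∂ i f)) (ev z (∂ i g)) ⟩
      (ev (z ∘ transpose i) f ⊕ rF ⊗ ev z (∂ i f)) ⊕ (ev (z ∘ transpose i) g ⊕ rF ⊗ ev z (∂ i g))
        ≈⟨ K.+-cong (ev-σ⁺ i z f) (ev-σ⁺ i z g) ⟨
      ev z (σ⁺ i f) ⊕ ev z (σ⁺ i g)
        ≈⟨ ev-++ z (σ⁺ i f) (σ⁺ i g) ⟨
      ev z (σ⁺ i f ++ σ⁺ i g) ∎
  ; A-scale = λ c f z → begin
      ev z (σ⁺ i (scaleP c f))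
        ≈⟨ ev-σ⁺ i z (scaleP c f) ⟩
      ev (z ∘ transpose i) (scaleP c f) ⊕ rF ⊗ ev z (∂ i (scaleP c f))
        ≈⟨ K.+-cong (ev-scaleP (z ∘ transpose i) c f) (K.*-congˡ (K.trans (A-scale (∂-EvLinear i) c f z) (ev-scaleP z c (∂ i f)))) ⟩
      c ⊗ ev (z ∘ transpose i) f ⊕ rF ⊗ (c ⊗ ev z (∂ i f))
        ≈⟨ solve 4 (λ c a r b → c :* a :+ r :* (c :* b) := c :* (a :+ r :* b)) K.refl c (ev (z ∘ transpose i) f) rF (ev z (∂ i f)) ⟩
      c ⊗ (ev (z ∘ transpose i) f ⊕ rF ⊗ ev z (∂ i f))
        ≈⟨ K.*-congˡ (ev-σ⁺ i z f) ⟨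
      c ⊗ ev z (σ⁺ i f)
        ≈⟨ ev-scaleP z c (σ⁺ i f) ⟨
      ev z (scaleP c (σ⁺ i f)) ∎ }

IsLinear⇒EvLinear : ∀ {A : Poly n → Poly n} → IsLinear A → EvLinear A
IsLinear⇒EvLinear {A = A} (c , a , s) = record
  { A-cong  = λ {f} {g} e → ≈P⇒ev (A f) (A g) (c f g (ev⇒≈P f g e))
  ; A-++    = λ f g → ≈P⇒ev (A (f ++ g)) (A f ++ A g) (a f g)
  ; A-scale = λ k f → ≈P⇒ev (A (scaleP k f)) (scaleP k (A f)) (s k f) }

-- H η stands for the top component and G η for the reflected interpolation polynomial. Among the
-- points of size at most |η|, G η is nonzero exactly at the one of η, so it acts as a Lagrange
-- basis element.
module Determination {n} {Ξ : Poly n → Poly n} (ξ : EvLinear Ξ) (H G : Comp n → Poly n)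
  (H-homogeneous : ∀ η → Homogeneous ∣ η ∣ (H η))
  (G-lower : ∀ η → PFun< ∣ η ∣ (λ z → ev z (G η) ⊕ ⊝ ev z (H η)))
  (G-vanish : ∀ η γ → ∣ γ ∣ ≤ ∣ η ∣ → γ ≢ η → ev (pt 0 γ) (G η) ≋ 0F)
  (G≉0 : ∀ η → ¬ ev (pt 0 η) (G η) ≋ 0F)
  (Ξ-H : ∀ η → Ξ (H η) ≈E G η) where

  -- Subtracting multiples of the G η one at a time reduces g to a polynomial vanishing at all points.
  Ξ-determined : ∀ ηs d h g → Homogeneous d h → PFun< d (λ z → ev z g ⊕ ⊝ ev z h) →
    (∀ γ → ∣ γ ∣ < d → ev (pt 0 γ) g ≋ 0F) → (∀ γ → ∣ γ ∣ ≡ d → γ ∉ ηs → ev (pt 0 γ) g ≋ 0F) → Ξ h ≈E g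
  -- With no index left, g vanishes at all points of size at most d and is zero. Then h has degree
  -- below d, so being homogeneous of degree d it is zero too.
  Ξ-determined [] d h g hom low below on z = begin
    ev z (Ξ h)    ≈⟨ A-cong ξ {h} {[]} h≋0 z ⟩
    ev z (Ξ [])   ≈⟨ EvLinear-[] ξ z ⟩
    0F            ≈⟨ g≋0 z ⟨
    ev z g        ∎
    where
    h-PFun : PFun d (λ z → ev z h)
    h-PFun = coeff⇒PFun< (suc d) h (λ μ d<μ → hom μ (λ μ≡d → ℕ.<⇒≢ d<μ (≡.sym μ≡d)))
    g-PFun : PFun d (λ z → ev z g)
    g-PFun = resp ℕ.≤-refl (λ z → solve 2 (λ a b → (a :- b) :+ b := a) K.refl (ev z g) (ev z h)) (add (PFun<⇒PFun low) h-PFun)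
    vanish-upto : ∀ γ → ∣ γ ∣ ≤ d → ev (pt 0 γ) g ≋ 0F
    vanish-upto γ l with ∣ γ ∣ ℕ.≟ d
    ... | yes ≡d = on γ ≡d (λ ())
    ... | no ≢d  = below γ (ℕ.≤∧≢⇒< l ≢d)
    g≋0 : ∀ z → ev z g ≋ 0F
    g≋0 = vanishing n d 0 g-PFun vanish-upto
    h≋0 : ∀ z → ev z h ≋ 0F
    h≋0 = homogeneous-zero d h hom (PFun<-resp {d = d} ℕ.≤-refl (λ z → begin
      ⊝ 1F ⊗ (ev z g ⊕ ⊝ ev z h)   ≈⟨ K.*-congˡ (K.+-congʳ (g≋0 z)) ⟩
      ⊝ 1F ⊗ (0F ⊕ ⊝ ev z h)       ≈⟨ solve 1 (λ h → (:- con (+ 1)) :* (con (+ 0) :- h) := h) K.refl (ev z h) ⟩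
      ev z h                       ∎) (PFun<-scale {d = d} (⊝ 1F) low))
  Ξ-determined (η ∷ ηs) d h g hom low below on with ∣ η ∣ ℕ.≟ d
  ... | no η≢d = Ξ-determined ηs d h g hom low below
          (λ γ γ≡d γ∉ηs → on γ γ≡d (λ { (here refl) → η≢d γ≡d ; (there γ∈ηs) → γ∉ηs γ∈ηs }))
  ... | yes refl = λ z → begin
    ev z (Ξ h)
      ≈⟨ solve 3 (λ a c b → a := (a :+ (:- c) :* b) :+ c :* b) K.refl (ev z (Ξ h)) c (ev z (G η)) ⟩
    (ev z (Ξ h) ⊕ ⊝ c ⊗ ev z (G η)) ⊕ c ⊗ ev z (G η)
      ≈⟨ K.+-congʳ (K.+-congˡ (K.*-congˡ (Ξ-H η z))) ⟨
    (ev z (Ξ h) ⊕ ⊝ c ⊗ ev z (Ξ (H η))) ⊕ c ⊗ ev z (G η)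
      ≈⟨ K.+-congʳ (K.+-congˡ (K.trans (A-scale ξ (⊝ c) (H η) z) (ev-scaleP z (⊝ c) (Ξ (H η))))) ⟨
    (ev z (Ξ h) ⊕ ev z (Ξ (scaleP (⊝ c) (H η)))) ⊕ c ⊗ ev z (G η)
      ≈⟨ K.+-congʳ (K.trans (A-++ ξ h (scaleP (⊝ c) (H η)) z) (ev-++ z (Ξ h) (Ξ (scaleP (⊝ c) (H η))))) ⟨
    ev z (Ξ h′) ⊕ c ⊗ ev z (G η)
      ≈⟨ K.+-congʳ (Ξ-determined ηs d h′ g′ hom′ low′ below′ on′ z) ⟩
    ev z g′ ⊕ c ⊗ ev z (G η)
      ≈⟨ K.+-congʳ (ev-g′ z) ⟩
    (ev z g ⊕ ⊝ c ⊗ ev z (G η)) ⊕ c ⊗ ev z (G η)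
      ≈⟨ solve 3 (λ a c b → (a :+ (:- c) :* b) :+ c :* b := a) K.refl (ev z g) c (ev z (G η)) ⟩
    ev z g ∎
    where
    pivot : 𝔽
    pivot = ev (pt 0 η) (G η)
    pivot⁻¹ : ∃[ w ] pivot ⊗ w ≋ 1F
    pivot⁻¹ = inverse pivot (G≉0 η)
    -- Chosen to make g - c G η vanish at the point of η. The zeros already obtained persist,
    -- because G η vanishes at all the other points concerned.
    c : 𝔽
    c = ev (pt 0 η) g ⊗ proj₁ pivot⁻¹
    h′ g′ : Poly n
    h′ = h ++ scaleP (⊝ c) (H η)
    g′ = g ++ scaleP (⊝ c) (G η)
    ev-g′ : ∀ z → ev z g′ ≋ ev z g ⊕ ⊝ c ⊗ ev z (G η)
    ev-g′ z = K.trans (ev-++ z g (scaleP (⊝ c) (G η))) (K.+-congˡ (ev-scaleP z (⊝ c) (G η)))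
    ev-h′ : ∀ φ → lin φ h′ ≋ lin φ h ⊕ ⊝ c ⊗ lin φ (H η)
    ev-h′ φ = K.trans (lin-++ φ h (scaleP (⊝ c) (H η))) (K.+-congˡ (lin-scaleP φ (⊝ c) (H η)))
    hom′ : Homogeneous ∣ η ∣ h′
    hom′ μ μ≢d = K.trans (ev-h′ (ind μ)) (K.trans (K.+-cong (hom μ μ≢d) (K.*-congˡ (H-homogeneous η μ μ≢d)))
      (solve 1 (λ c → con (+ 0) :+ (:- c) :* con (+ 0) := con (+ 0)) K.refl c))
    low′ : PFun< ∣ η ∣ (λ z → ev z g′ ⊕ ⊝ ev z h′)
    low′ = PFun<-resp {d = ∣ η ∣} ℕ.≤-refl (λ z → begin
        (ev z g ⊕ ⊝ ev z h) ⊕ ⊝ c ⊗ (ev z (G η) ⊕ ⊝ ev z (H η))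
          ≈⟨ solve 5 (λ g h c x y → (g :- h) :+ (:- c) :* (x :- y) := (g :+ (:- c) :* x) :- (h :+ (:- c) :* y)) K.refl
               (ev z g) (ev z h) c (ev z (G η)) (ev z (H η)) ⟩
        (ev z g ⊕ ⊝ c ⊗ ev z (G η)) ⊕ ⊝ (ev z h ⊕ ⊝ c ⊗ ev z (H η))
          ≈⟨ K.+-cong (ev-g′ z) (K.-‿cong (ev-h′ (mono z))) ⟨
        ev z g′ ⊕ ⊝ ev z h′ ∎)
      (PFun<-add {d = ∣ η ∣} low (PFun<-scale {d = ∣ η ∣} (⊝ c) (G-lower η)))
    vanish′ : ∀ γ → ∣ γ ∣ ≤ ∣ η ∣ → γ ≢ η → ev (pt 0 γ) g ≋ 0F → ev (pt 0 γ) g′ ≋ 0F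
    vanish′ γ l γ≢η v = K.trans (ev-g′ (pt 0 γ)) (K.trans
      (K.+-cong v (K.*-congˡ (G-vanish η γ l γ≢η)))
      (solve 1 (λ c → con (+ 0) :+ (:- c) :* con (+ 0) := con (+ 0)) K.refl c))
    below′ : ∀ γ → ∣ γ ∣ < ∣ η ∣ → ev (pt 0 γ) g′ ≋ 0F
    below′ γ l = vanish′ γ (ℕ.<⇒≤ l) (λ γ≡η → ℕ.<⇒≢ l (cong ∣_∣ γ≡η)) (below γ l)
    on′ : ∀ γ → ∣ γ ∣ ≡ ∣ η ∣ → γ ∉ ηs → ev (pt 0 γ) g′ ≋ 0F
    on′ γ γ≡d γ∉ηs with V.≡-dec ℕ._≟_ γ η
    ... | no γ≢η = vanish′ γ (ℕ.≤-reflexive γ≡d) γ≢η (on γ γ≡d (λ { (here γ≡η) → γ≢η γ≡η ; (there γ∈ηs) → γ∉ηs γ∈ηs }))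
    ... | yes refl = begin
      ev (pt 0 η) g′
        ≈⟨ ev-g′ (pt 0 η) ⟩
      ev (pt 0 η) g ⊕ ⊝ (ev (pt 0 η) g ⊗ proj₁ pivot⁻¹) ⊗ pivot
        ≈⟨ solve 3 (λ g w v → g :+ (:- (g :* w)) :* v := g :* (con (+ 1) :- v :* w)) K.refl (ev (pt 0 η) g) (proj₁ pivot⁻¹) pivot ⟩
      ev (pt 0 η) g ⊗ (1F ⊕ ⊝ (pivot ⊗ proj₁ pivot⁻¹))
        ≈⟨ K.*-congˡ (K.+-congˡ (K.-‿cong (proj₂ pivot⁻¹))) ⟩
      ev (pt 0 η) g ⊗ (1F ⊕ ⊝ 1F)
        ≈⟨ solve 1 (λ g → g :* (con (+ 1) :- con (+ 1)) := con (+ 0)) K.refl (ev (pt 0 η) g) ⟩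
      0F ∎

  Ξ-monomial : ∀ {ν g} → Bar ν g → Ξ (monomial ν) ≈E g
  Ξ-monomial {ν} {g} b = Ξ-determined (box n ∣ ν ∣) ∣ ν ∣ (monomial ν) g
    (λ μ μ≢ → K.trans (K.+-congʳ (K.*-congˡ (K.reflexive (ind-≢ μ ν (λ μ≡ν → μ≢ (cong ∣_∣ μ≡ν))))))
      (solve 0 (con (+ 1) :* con (+ 0) :+ con (+ 0) := con (+ 0)) K.refl))
    (PFun<-resp {d = ∣ ν ∣} ℕ.≤-refl (λ z → K.+-congˡ (K.-‿cong (K.sym (ev-monomial z ν)))) (Bar.lower b))
    (Bar.vanish b)
    -- Every composition of size |ν| lies in the box, so no vanishing at that size is demanded of g
    -- beforehand.
    (λ γ γ≡d γ∉ → ⊥-elim (γ∉ (∈-box γ ∣ ν ∣ (ℕ.≤-reflexive γ≡d))))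

module Intertwining (m : ℕ)
  (E : Comp (suc m) → Poly (suc m)) (interp : ∀ η → IsInterp η (E η))
  (Ξ : Poly (suc m) → Poly (suc m)) (Ξ-linear : IsLinear Ξ)
  (Ξ-F : ∀ η → Ξ (Fα E η) ≈P Frδ E η) where

  ξ : EvLinear Ξ
  ξ = IsLinear⇒EvLinear Ξ-linear

  G : Comp (suc m) → Poly (suc m)
  G η = reflected η (E η)

  Ξ-Eα : ∀ η → Ξ (Eα E η) ≈E G η
  Ξ-Eα η z = difference≋0 (⊗-cancel (dη≉0 η) (begin
    dη η ⊗ (ev z (Ξ (Eα E η)) ⊕ ⊝ ev z (G η))
      ≈⟨ solve 3 (λ d x y → d :* (x :- y) := d :* x :- d :* y) K.refl (dη η) (ev z (Ξ (Eα E η))) (ev z (G η)) ⟩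
    dη η ⊗ ev z (Ξ (Eα E η)) ⊕ ⊝ (dη η ⊗ ev z (G η))
      ≈⟨ K.+-cong (K.trans (A-scale ξ (dη η) (Eα E η) z) (ev-scaleP z (dη η) (Ξ (Eα E η)))) K.refl ⟨
    ev z (Ξ (Fα E η)) ⊕ ⊝ (dη η ⊗ ev z (G η))
      ≈⟨ K.+-cong (≈P⇒ev (Ξ (Fα E η)) (Frδ E η) (Ξ-F η) z) (K.-‿cong (K.*-congˡ (ev-scaleP z (sign ∣ η ∣) N))) ⟩
    ev z (Frδ E η) ⊕ ⊝ (dη η ⊗ (sign ∣ η ∣ ⊗ ev z N))
      ≈⟨ K.+-congʳ (K.trans (ev-scaleP z (powF (-F 1F) ∣ η ∣ *F dη η) N) (K.*-congʳ (K.reflexive scalar))) ⟩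
    (sign ∣ η ∣ ⊗ dη η) ⊗ ev z N ⊕ ⊝ (dη η ⊗ (sign ∣ η ∣ ⊗ ev z N))
      ≈⟨ solve 3 (λ s d x → s :* d :* x :- d :* (s :* x) := con (+ 0)) K.refl (sign ∣ η ∣) (dη η) (ev z N) ⟩
    0F ∎))
    where
    N : Poly (suc m)
    N = subst negVars (E η)
    scalar : powF (-F 1F) ∣ η ∣ *F dη η ≡ sign ∣ η ∣ ⊗ dη η
    scalar = ≡.trans (*F≡⊗ (powF (-F 1F) ∣ η ∣) (dη η))
      (cong (_⊗ dη η) (≡.trans (powF≡pow (-F 1F) ∣ η ∣) (cong (λ x → pow x ∣ η ∣) (-F≡⊝ 1F))))

  open Determination ξ (Eα E) G (λ η → top-homogeneous ∣ η ∣ (E η)) (λ η → reflected-lower η (E η) (interp η))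
    (λ η → reflected-vanish η (E η) (interp η)) (λ η → reflected≉0 η (E η) (interp η)) Ξ-Eα

  Φ-intertwined : ∀ f → Φ⁺ (Ξ f) ≈E Ξ (Φ f)
  Φ-intertwined = linear-extension (∘-EvLinear Φ⁺-EvLinear ξ) (∘-EvLinear ξ Φ-EvLinear) λ ν z → on-monomial ν (bar-exists ∣ ν ∣ ν refl) z
    where
    on-monomial : ∀ ν → ∃[ g ] Bar ν g → Φ⁺ (Ξ (monomial ν)) ≈E Ξ (Φ (monomial ν))
    on-monomial ν (g , b) z = begin
      ev z (Φ⁺ (Ξ (monomial ν)))        ≈⟨ A-cong Φ⁺-EvLinear {Ξ (monomial ν)} {g} (Ξ-monomial b) z ⟩
      -- `Ξ-monomial` is applied a second time, now backwards: `Φ⁺ g` belongs to the exponent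
      -- `rotate ν`, and that monomial is Φ(x^ν).
      ev z (Φ⁺ g)                       ≈⟨ Ξ-monomial (Bar-Φ⁺ b) z ⟨
      ev z (Ξ (monomial (rotate ν)))    ≈⟨ A-cong ξ {monomial (rotate ν)} {Φ (monomial ν)} (λ z → begin
          ev z (monomial (rotate ν))                         ≈⟨ ev-monomial z (rotate ν) ⟩
          mono z (rotate ν)                                  ≈⟨ mono-rotate z ν ⟩
          z (fromℕ m) ⊗ mono (rotate-point₀ z) ν             ≈⟨ K.*-congˡ (ev-monomial (rotate-point₀ z) ν) ⟨
          z (fromℕ m) ⊗ ev (rotate-point₀ z) (monomial ν)    ≈⟨ ev-Φ z (monomial ν) ⟨
          ev z (Φ (monomial ν))                              ∎) z ⟩
      ev z (Ξ (Φ (monomial ν)))         ∎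

  σ-intertwined : ∀ i f → σ⁺ i (Ξ f) ≈E Ξ (s i f)
  σ-intertwined i = linear-extension (∘-EvLinear (σ⁺-EvLinear i) ξ) (∘-EvLinear ξ (s-EvLinear i)) λ ν z → on-monomial ν (bar-exists ∣ ν ∣ ν refl) z
    where
    on-monomial : ∀ ν → ∃[ g ] Bar ν g → σ⁺ i (Ξ (monomial ν)) ≈E Ξ (s i (monomial ν))
    on-monomial ν (g , b) z = begin
      ev z (σ⁺ i (Ξ (monomial ν)))      ≈⟨ A-cong (σ⁺-EvLinear i) {Ξ (monomial ν)} {g} (Ξ-monomial b) z ⟩
      ev z (σ⁺ i g)                     ≈⟨ Ξ-monomial (Bar-σ⁺ i b) z ⟨
      ev z (Ξ (monomial (swap i ν)))    ≈⟨ A-cong ξ {monomial (swap i ν)} {s i (monomial ν)} (λ z → begin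
          ev z (monomial (swap i ν))           ≈⟨ ev-monomial z (swap i ν) ⟩
          mono z (swap i ν)                    ≈⟨ mono-swap i z ν ⟩
          mono (z ∘ transpose i) ν                    ≈⟨ ev-monomial (z ∘ transpose i) ν ⟨
          ev (z ∘ transpose i) (monomial ν)           ≈⟨ ev-s i z (monomial ν) ⟨
          ev z (s i (monomial ν))              ∎) z ⟩
      ev z (Ξ (s i (monomial ν)))       ∎

theorem3p7 : (m : ℕ)
    → (E : Comp (suc m) → Poly (suc m)) → (∀ η → IsInterp η (E η))
    → (Ξ : Poly (suc m) → Poly (suc m)) → IsLinear Ξ
    → (∀ η → Ξ (Fα E η) ≈P Frδ E η)
    → (∀ f → Φ⁺ (Ξ f) ≈P Ξ (Φ f))
    × (∀ (i : Fin m) f → σ⁺ i (Ξ f) ≈P Ξ (s i f))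
theorem3p7 m E interp Ξ Ξ-linear Ξ-F =
  (λ f → ev⇒≈P (Φ⁺ (Ξ f)) (Ξ (Φ f)) (Φ-intertwined f)) ,
  (λ i f → ev⇒≈P (σ⁺ i (Ξ f)) (Ξ (s i f)) (σ-intertwined i f))
  where open Intertwining m E interp Ξ Ξ-linear Ξ-F
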